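{- Let $q=p^s$ where $p$ is an odd prime and $s\geq 1$ is an integer, let $H=\{x^2\mid x\in\mathbb{F}_q^*\}$, and let $k$ be an integer with $1\leq k\leq \frac{q-1}{2}$. Let $N_H(k,0)$ be the number of $k$-element subsets $S\subseteq H$ with $\sum_{a\in S}a=0$. (1) If either $p\equiv 1 \pmod 4$, or $p\equiv 3\pmod 4$ and $s$ is even, then $$N_H(k,0)=\frac{1}{q}\binom{\frac{q-1}{2}}{k}+(-1)^k\frac{q-1}{2q\,k!}\Big\{A_{k,1}\Big(\tfrac{1-\sqrt{q}}{2},\tfrac{1+\sqrt{q}}{2},\tfrac{1-q}{2}\Big)+A_{k,1}\Big(\tfrac{1+\sqrt{q}}{2},\tfrac{1-\sqrt{q}}{2},\tfrac{1-q}{2}\Big)\Big\}.$$ (2) If $p\equiv 3\pmod 4$ and $s$ is odd, then $$N_H(k,0)=\frac{1}{q}\binom{\frac{q-1}{2}}{k}+(-1)^k\frac{q-1}{2q\,k!}\Big\{A_{k,1}\Big(\tfrac{1-\sqrt{q}i}{2},\tfrac{1+\sqrt{q}i}{2},\tfrac{1-q}{2}\Big)+A_{k,1}\Big(\tfrac{1+\sqrt{q}i}{2},\tfrac{1-\sqrt{q}i}{2},\tfrac{1-q}{2}\Big)\Big\},$$ where $i=\sqrt{ -1}$.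
   Context: $\chi$ denotes the quadratic character of $\mathbb{F}_q^*$, and for an integer $j$, $\chi(j)$ means $\chi$ evaluated at the image of $j$ in $\mathbb{F}_q$. For integers $c_1,\dots,c_k\geq 0$ with $\sum_j jc_j=k$, let $N(c_1,\dots,c_k)=\frac{k!}{1^{c_1}c_1!\,2^{c_2}c_2!\cdots k^{c_k}c_k!}$. For $b\in\mathbb{F}_q^*$ and complex numbers $u,v,w$, define $$A_{k,b}(u,v,w)=\sum_{c_1,\dots,c_k\ge 0,\ \sum_j jc_j=k}N(c_1,\dots,c_k)\,t_1^{c_1}\cdots t_k^{c_k},$$ where $t_j=u$ if $p\nmid j$ and $\chi(j)=\chi(b)$; $t_j=v$ if $p\nmid j$ and $\chi(j)=-\chi(b)$; $t_j=w$ if $p\mid j$. (So $A_{k,1}$ uses $\chi(b)=1$.) For real $x$ and integer $j\ge0$, $\binom{x}{j}=x(x-1)\cdots(x-j+1)/j!$. -}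

module Defs where

open import Data.Bool using (Bool; true; false; if_then_else_; not; _∧_)
open import Data.Nat as ℕ using (ℕ; zero; suc; _∸_; _^_; _≡ᵇ_; _!)
open import Data.Nat.Combinatorics as Comb using ()
open import Data.Nat.DivMod as DM using ()
open import Data.Nat.Divisibility using (_∣?_)
open import Data.Integer as ℤ using (ℤ; +_)
open import Data.Rational as ℚ using (ℚ; 0ℚ; 1ℚ)
open import Data.Fin using (Fin; toℕ)
open import Data.List using (List; []; _∷_; map; _++_; concatMap; upTo; allFin; filterᵇ; length; foldr)
open import Data.Bool.ListAction using (any)
open import Data.Product using (_×_; _,_; proj₁; proj₂; ∃)
open import Function.Bundles using (_↔_; Inverse)
open import Relation.Binary.PropositionalEquality using (_≡_)
open import Relation.Nullary using (¬_; does)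
open import Algebra.Structures using (IsCommutativeRing)

record FiniteField (q : ℕ) : Set₁ where
  field
    F    : Set
    0F   : F
    1F   : F
    _+F_ : F → F → F
    _*F_ : F → F → F
    -F_  : F → F
    isCommutativeRing : IsCommutativeRing _≡_ _+F_ _*F_ -F_ 0F 1F
    0≢1  : ¬ (0F ≡ 1F)
    inverse : ∀ x → ¬ (x ≡ 0F) → ∃ λ y → (x *F y) ≡ 1F
    enum : F ↔ Fin q

  index : F → Fin q
  index = Inverse.to enum

  elems : List F
  elems = map (Inverse.from enum) (allFin q)

  _==_ : F → F → Bool
  x == y = toℕ (index x) ≡ᵇ toℕ (index y)

  isZero : F → Bool
  isZero x = x == 0F

  isNonzeroSquare : F → Bool
  isNonzeroSquare x = not (isZero x) ∧ any (λ y → (y *F y) == x) elems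

  Hlist : List F
  Hlist = filterᵇ isNonzeroSquare elems

  sumF : List F → F
  sumF = foldr _+F_ 0F

  fromℕF : ℕ → F
  fromℕF zero    = 0F
  fromℕF (suc n) = 1F +F fromℕF n

choose : {A : Set} → ℕ → List A → List (List A)
choose zero    xs       = [] ∷ []
choose (suc k) []       = []
choose (suc k) (x ∷ xs) = map (x ∷_) (choose k xs) ++ choose (suc k) xs

N-H : {q : ℕ} → FiniteField q → ℕ → ℕ
N-H K k = length (filterᵇ (λ S → isZero (sumF S)) (choose k Hlist))
  where open FiniteField K

-- The ring ℚ[√D] = ℚ[X]/(X² − D); a pair (a , b) stands for a + b√D.

Q2 : Set
Q2 = ℚ × ℚ

module QuadArith (D : ℚ) where
  _⊕_ : Q2 → Q2 → Q2
  (a , b) ⊕ (c , d) = (a ℚ.+ c , b ℚ.+ d)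

  _⊗_ : Q2 → Q2 → Q2
  (a , b) ⊗ (c , d) = (a ℚ.* c ℚ.+ D ℚ.* (b ℚ.* d) , a ℚ.* d ℚ.+ b ℚ.* c)

  0Q : Q2
  0Q = (0ℚ , 0ℚ)

  1Q : Q2
  1Q = (1ℚ , 0ℚ)

  _^Q_ : Q2 → ℕ → Q2
  x ^Q zero  = 1Q
  x ^Q suc n = x ⊗ (x ^Q n)

  sc : ℚ → Q2 → Q2
  sc r (a , b) = (r ℚ.* a , r ℚ.* b)

-- n / d as a rational (d is always nonzero where used; d = 0 gives 0)
frac : ℤ → ℕ → ℚ
frac n zero    = 0ℚ
frac n (suc d) = n ℚ./ suc d

ℕ→ℚ : ℕ → ℚ
ℕ→ℚ n = (+ n) ℚ./ 1

cands : ℕ → ℕ → List (List ℕ)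
cands zero    b = [] ∷ []
cands (suc n) b = concatMap (λ c → map (c ∷_) (cands n b)) (upTo (suc b))

weightFrom : ℕ → List ℕ → ℕ
weightFrom j []       = 0
weightFrom j (c ∷ cs) = j ℕ.* c ℕ.+ weightFrom (suc j) cs

denomFrom : ℕ → List ℕ → ℕ
denomFrom j []       = 1
denomFrom j (c ∷ cs) = (j ^ c) ℕ.* (c !) ℕ.* denomFrom (suc j) cs

Ncoef : ℕ → List ℕ → ℚ
Ncoef k c = frac (+ (k !)) (denomFrom 1 c)

-- A_{k,1}(u,v,w) in ℚ[√D], for the finite field K of characteristic p:
-- t_j = w if p ∣ j; u if p ∤ j and χ(j) = χ(1) = 1; v if p ∤ j and χ(j) = −1.
module _ {q : ℕ} (K : FiniteField q) (p : ℕ) (D : ℚ) where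
  open FiniteField K
  open QuadArith D

  tj : Q2 → Q2 → Q2 → ℕ → Q2
  tj u v w j with does (p ∣? j)
  ... | true  = w
  ... | false = if isNonzeroSquare (fromℕF j) then u else v

  prodFrom : Q2 → Q2 → Q2 → ℕ → List ℕ → Q2
  prodFrom u v w j []       = 1Q
  prodFrom u v w j (c ∷ cs) = (tj u v w j ^Q c) ⊗ prodFrom u v w (suc j) cs

  A1 : ℕ → Q2 → Q2 → Q2 → Q2
  A1 k u v w =
    foldr (λ c acc → sc (Ncoef k c) (prodFrom u v w 1 c) ⊕ acc) 0Q
      (filterᵇ (λ c → weightFrom 1 c ≡ᵇ k) (cands k k))

  -- right-hand side of Theorem 5.2 with √D in place of √q (case 1, D = q)
  -- or √q·i (case 2, D = −q):
  -- (1/q) C((q−1)/2, k) + (−1)^k (q−1)/(2 q k!) { A(u₀,v₀,w) + A(v₀,u₀,w) }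
  -- where u₀ = (1 − √D)/2, v₀ = (1 + √D)/2, w = (1 − q)/2.
  RHS : ℕ → Q2
  RHS k =
    ((frac (+ (((q ∸ 1) DM./ 2) Comb.C k)) q) , 0ℚ)
    ⊕ sc (sign ℚ.* frac (+ (q ∸ 1)) (2 ℕ.* q ℕ.* (k !)))
         (A1 k u₀ v₀ w ⊕ A1 k v₀ u₀ w)
    where
      half : ℚ
      half = frac (+ 1) 2
      u₀ v₀ w : Q2
      u₀ = (half , ℚ.- half)
      v₀ = (half , half)
      w  = (frac (ℤ.+ 1 ℤ.- ℤ.+ q) 2 , 0ℚ)
      sign : ℚ
      sign = frac ((ℤ.- ℤ.+ 1) ℤ.^ k) 1

{-# OPTIONS --safe #-}
-- Let eₖ(x) be (−1)ᵏ times the number of k-element subsets of H with sum x.  In the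
-- group algebra of 𝔽_q these satisfy Newton's identities k eₖ = − ∑_{j=1}^k pⱼ eₖ₋ⱼ,
-- where pⱼ is the sum of the translations by j h, h ∈ H.  Instead of applying
-- additive characters, one uses two integer-valued functionals,
-- α f = q f(0) − ∑ f(x) and β f = ∑ χ(x) f(x): since ∑_z χ(z) χ(y + z) = q [y = 0] − 1,
-- translation by pⱼ multiplies (α f , β f) ∈ ℚ[√D], D = χ(−1) q, by −tⱼ, where tⱼ is
-- (1 ∓ √D)/2 or (1 − q)/2 according to the class of j.  The numbers A_k / k! are the
-- coefficients of exp (∑ tⱼ xʲ / j), so they satisfy the same recurrence, and hence
-- (α eₖ , β eₖ) = (q − 1) A_k / k!.  The other sum A_k has t and the sign of β
-- conjugated.  As α eₖ = (−1)ᵏ (q N_H(k,0) − binom((q−1)/2, k)), adding the two gives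
-- the formula.  Finally D = ± q because the parity of |H| = (q−1)/2 decides whether
-- −1 is a square.
module Submission where

open import Defs
open import Data.Nat using (ℕ; _≤_; _^_; _∸_; _%_)
open import Data.Nat.DivMod using (_/_)
open import Data.Nat.Primality using (Prime)
open import Data.Rational using (0ℚ) renaming (-_ to -ℚ_)
open import Data.Product using (_×_; _,_)
open import Data.Sum using (_⊎_)
open import Relation.Binary.PropositionalEquality using (_≡_; _≢_)

open import Algebra.Bundles using (CommutativeMonoid; CommutativeRing)
import Algebra.Properties.CommutativeMonoid.Sum as MonoidSum
import Algebra.Properties.Ring as RingProperties
import Algebra.Properties.Semiring.Sum as SemiringSum
open import Algebra.Structures using (IsCommutativeRing)
open import Data.Bool using (Bool; true; false; if_then_else_; T)
open import Data.Bool.ListAction using (any)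
open import Data.Empty using (⊥-elim)
open import Data.Fin as Fin using (Fin; toℕ)
open import Data.Fin.Permutation using (permutation)
import Data.Fin.Properties as Finₚ
open import Data.Integer as ℤ using (ℤ; 0ℤ; 1ℤ; -1ℤ)
import Data.Integer.Properties as ℤₚ
open import Data.Integer.Solver using (module +-*-Solver)
open import Data.List using (List; []; _∷_; map; _++_; concatMap; upTo; applyUpTo; filterᵇ; foldr; length; tabulate; allFin)
open import Data.Nat as ℕ using (zero; suc; _<_; z≤n; s≤s; _≡ᵇ_; _<ᵇ_; _!)
open import Data.Nat.Combinatorics using (_C_; nCk+nC[k+1]≡[n+1]C[k+1]; k>n⇒nCk≡0)
open import Data.Nat.Coprimality using (Coprime; coprime-Bézout)
open import Data.Nat.DivMod using (m≡m%n+[m/n]*n; %-distribˡ-*; m*n/n≡m)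
open import Data.Nat.Divisibility using (_∣_; _∣?_; divides; ∣⇒≤)
open import Data.Nat.GCD using (module Bézout)
open import Data.Nat.Induction using (<-rec)
open import Data.Nat.Primality using (prime⇒irreducible; prime⇒nonTrivial; prime⇒nonZero)
import Data.Nat.Properties as ℕₚ
open import Data.Nat.Solver using () renaming (module +-*-Solver to ℕSolver)
open import Data.Product using (proj₁; proj₂; ∃)
open import Data.Rational as ℚ using (ℚ; 1ℚ; fromℚᵘ)
import Data.Rational.Properties as ℚₚ
open import Data.Rational.Solver using () renaming (module +-*-Solver to ℚSolver)
open import Data.Rational.Unnormalised as ℚᵘ using (mkℚᵘ; *≡*)
import Data.Rational.Unnormalised.Properties as ℚᵘₚ
open import Data.Sum using (inj₁; inj₂; [_,_]′)
open import Data.Unit using (tt)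
open import Function using (id; _∘_)
open import Function.Bundles using (Inverse)
open import Level using (0ℓ)
open import Relation.Binary.Definitions using (tri<; tri≈; tri>)
open import Relation.Binary.PropositionalEquality
open import Relation.Nullary using (¬_; Dec; yes; no; contradiction)
open import Relation.Nullary.Decidable using (toWitnessFalse)

-- In terms of additive characters, q f(0) is the sum of all Fourier coefficients of f, and α drops
-- the one at the trivial character, which for eₖ is a signed binomial and becomes the main term.
-- The other q - 1 characters fall into two classes, twisted by squares and by nonsquares, which √D
-- ↦ -√D interchanges; hence the two sums A_k. For j prime to p, tⱼ is up to sign a Gauss period ∑
-- ψ(j h) = (-1 ± G)/2 with G² = D. Here G is realised as convolution with χ, which acts on α f + β
-- f √D as multiplication by √D, so no root of unity has to be constructed. The identities hold in
-- ℚ[X]/(X² - D), and X may be sent to either complex square root of D. When D is a square in ℚ this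
-- ring has zero divisors, so the recurrences are compared using only the cancellation of positive
-- integers.

-- Sums along antidiagonals

-- antidiagonal _+_ 0# f k  is  f 0 (k-1) + f 1 (k-2) + ... + f (k-1) 0.
antidiagonal : {A : Set} → (A → A → A) → A → (ℕ → ℕ → A) → ℕ → A
antidiagonal _+_ 0# f zero    = 0#
antidiagonal _+_ 0# f (suc k) = f 0 k + antidiagonal _+_ 0# (λ j → f (suc j)) k

-- The equation is required only for `m < k`, so that `newton-unique` can rewrite with a strong
-- induction hypothesis.
antidiagonal-cong : {A : Set} (_+_ : A → A → A) (0# : A) (f g : ℕ → ℕ → A) (k : ℕ) →
  (∀ j m → m < k → f j m ≡ g j m) → antidiagonal _+_ 0# f k ≡ antidiagonal _+_ 0# g k
antidiagonal-cong _+_ 0# f g zero    eq = refl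
antidiagonal-cong _+_ 0# f g (suc k) eq =
  cong₂ _+_ (eq 0 k ℕₚ.≤-refl)
    (antidiagonal-cong _+_ 0# _ _ k (λ j m m<k → eq (suc j) m (ℕₚ.m<n⇒m<1+n m<k)))

antidiagonal-map : {A B : Set} (_+_ : A → A → A) (0# : A) (_+′_ : B → B → B) (0#′ : B) (h : A → B) →
  h 0# ≡ 0#′ → (∀ x y → h (x + y) ≡ h x +′ h y) → (f : ℕ → ℕ → A) (k : ℕ) →
  h (antidiagonal _+_ 0# f k) ≡ antidiagonal _+′_ 0#′ (λ j m → h (f j m)) k
antidiagonal-map _+_ 0# _+′_ 0#′ h h0 h+ f zero    = h0
antidiagonal-map _+_ 0# _+′_ 0#′ h h0 h+ f (suc k) =
  trans (h+ _ _) (cong (h (f 0 k) +′_) (antidiagonal-map _+_ 0# _+′_ 0#′ h h0 h+ _ k))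

-- Finite sums in a commutative ring

module ListSum {A : Set} {add mul : A → A → A} {neg : A → A} {0# 1# : A}
  (isCommutativeRing : IsCommutativeRing _≡_ add mul neg 0# 1#) where

  infixl 6 _+_
  infixl 7 _*_

  _+_ _*_ : A → A → A
  _+_ = add
  _*_ = mul

  open IsCommutativeRing isCommutativeRing
    using (+-assoc; +-comm; +-identityˡ; +-identityʳ; *-assoc; *-comm; *-identityˡ; distribˡ; distribʳ; zeroˡ; zeroʳ)
  open ≡-Reasoning

  +-interchange : ∀ a b c d → (a + b) + (c + d) ≡ (a + c) + (b + d)
  +-interchange a b c d = begin
    (a + b) + (c + d) ≡⟨ +-assoc a b (c + d) ⟩
    a + (b + (c + d)) ≡⟨ cong (a +_) (+-assoc b c d) ⟨
    a + ((b + c) + d) ≡⟨ cong (λ z → a + (z + d)) (+-comm b c) ⟩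
    a + ((c + b) + d) ≡⟨ cong (a +_) (+-assoc c b d) ⟩
    a + (c + (b + d)) ≡⟨ +-assoc a c (b + d) ⟨
    (a + c) + (b + d) ∎

  -- The `foldr` has the shape of the one in `A1`, which is thereby a `sumOver` by definition.
  sumOver : {X : Set} → (X → A) → List X → A
  sumOver f = foldr (λ x acc → f x + acc) 0#

  sumOver-cong : {X : Set} {f g : X → A} → (∀ x → f x ≡ g x) → ∀ xs → sumOver f xs ≡ sumOver g xs
  sumOver-cong eq []       = refl
  sumOver-cong eq (x ∷ xs) = cong₂ _+_ (eq x) (sumOver-cong eq xs)

  sumOver-+ : {X : Set} (f g : X → A) → ∀ xs → sumOver (λ x → f x + g x) xs ≡ sumOver f xs + sumOver g xs
  sumOver-+ f g []       = sym (+-identityˡ 0#)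
  sumOver-+ f g (x ∷ xs) = trans (cong ((f x + g x) +_) (sumOver-+ f g xs)) (+-interchange _ _ _ _)

  sumOver-*ˡ : {X : Set} (a : A) (f : X → A) → ∀ xs → sumOver (λ x → a * f x) xs ≡ a * sumOver f xs
  sumOver-*ˡ a f []       = sym (zeroʳ a)
  sumOver-*ˡ a f (x ∷ xs) = trans (cong ((a * f x) +_) (sumOver-*ˡ a f xs)) (sym (distribˡ a _ _))

  sumOver-0 : {X : Set} (f : X → A) → (∀ x → f x ≡ 0#) → ∀ xs → sumOver f xs ≡ 0#
  sumOver-0 f f0 []       = refl
  sumOver-0 f f0 (x ∷ xs) = trans (cong₂ _+_ (f0 x) (sumOver-0 f f0 xs)) (+-identityˡ 0#)

  sumOver-++ : {X : Set} (f : X → A) → ∀ xs ys → sumOver f (xs ++ ys) ≡ sumOver f xs + sumOver f ys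
  sumOver-++ f []       ys = sym (+-identityˡ _)
  sumOver-++ f (x ∷ xs) ys = trans (cong (f x +_) (sumOver-++ f xs ys)) (sym (+-assoc _ _ _))

  sumOver-map : {X Y : Set} (f : Y → A) (h : X → Y) → ∀ xs → sumOver f (map h xs) ≡ sumOver (f ∘ h) xs
  sumOver-map f h []       = refl
  sumOver-map f h (x ∷ xs) = cong (f (h x) +_) (sumOver-map f h xs)

  sumOver-concatMap : {X Y : Set} (f : Y → A) (h : X → List Y) → ∀ xs →
    sumOver f (concatMap h xs) ≡ sumOver (λ x → sumOver f (h x)) xs
  sumOver-concatMap f h []       = refl
  sumOver-concatMap f h (x ∷ xs) =
    trans (sumOver-++ f (h x) _) (cong (sumOver f (h x) +_) (sumOver-concatMap f h xs))

  sumOver-filter : {X : Set} (f : X → A) (P : X → Bool) → ∀ xs →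
    sumOver f (filterᵇ P xs) ≡ sumOver (λ x → if P x then f x else 0#) xs
  sumOver-filter f P [] = refl
  sumOver-filter f P (x ∷ xs) with P x
  ... | true  = cong (f x +_) (sumOver-filter f P xs)
  ... | false = trans (sumOver-filter f P xs) (sym (+-identityˡ _))

  sumOver-filter-* : {X : Set} (f : X → A) (P : X → Bool) → ∀ xs →
    sumOver f (filterᵇ P xs) ≡ sumOver (λ x → f x * (if P x then 1# else 0#)) xs
  sumOver-filter-* f P xs = trans (sumOver-filter f P xs) (sumOver-cong pointwise xs)
    where
    pointwise : ∀ x → (if P x then f x else 0#) ≡ f x * (if P x then 1# else 0#)
    pointwise x with P x
    ... | true  = sym (trans (*-comm (f x) 1#) (*-identityˡ (f x)))
    ... | false = sym (zeroʳ (f x))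

  sumBelow : (ℕ → A) → ℕ → A
  sumBelow f zero    = 0#
  sumBelow f (suc n) = f 0 + sumBelow (f ∘ suc) n

  sumOver-applyUpTo : {X : Set} (f : X → A) (h : ℕ → X) → ∀ n →
    sumOver f (applyUpTo h n) ≡ sumBelow (f ∘ h) n
  sumOver-applyUpTo f h zero    = refl
  sumOver-applyUpTo f h (suc n) = cong (f (h 0) +_) (sumOver-applyUpTo f (h ∘ suc) n)

  sumBelow-cong : {f g : ℕ → A} → (∀ x → f x ≡ g x) → ∀ n → sumBelow f n ≡ sumBelow g n
  sumBelow-cong eq zero    = refl
  sumBelow-cong eq (suc n) = cong₂ _+_ (eq 0) (sumBelow-cong (eq ∘ suc) n)

  sumBelow-snoc : (f : ℕ → A) → ∀ n → sumBelow f (suc n) ≡ sumBelow f n + f n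
  sumBelow-snoc f zero    = +-comm (f 0) 0#
  sumBelow-snoc f (suc n) = trans (cong (f 0 +_) (sumBelow-snoc (f ∘ suc) n)) (sym (+-assoc _ _ _))

  sumBelow-+ : (f g : ℕ → A) → ∀ n → sumBelow (λ x → f x + g x) n ≡ sumBelow f n + sumBelow g n
  sumBelow-+ f g zero    = sym (+-identityˡ 0#)
  sumBelow-+ f g (suc n) = trans (cong ((f 0 + g 0) +_) (sumBelow-+ (f ∘ suc) (g ∘ suc) n)) (+-interchange _ _ _ _)

  sumBelow-*ˡ : (a : A) (f : ℕ → A) → ∀ n → sumBelow (λ x → a * f x) n ≡ a * sumBelow f n
  sumBelow-*ˡ a f zero    = sym (zeroʳ a)
  sumBelow-*ˡ a f (suc n) = trans (cong ((a * f 0) +_) (sumBelow-*ˡ a (f ∘ suc) n)) (sym (distribˡ a _ _))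

  sumBelow-0 : (f : ℕ → A) → (∀ x → f x ≡ 0#) → ∀ n → sumBelow f n ≡ 0#
  sumBelow-0 f f0 zero    = refl
  sumBelow-0 f f0 (suc n) = trans (cong₂ _+_ (f0 0) (sumBelow-0 (f ∘ suc) (f0 ∘ suc) n)) (+-identityˡ 0#)

  sumFrom : (ℕ → A) → ℕ → ℕ → A
  sumFrom f j zero    = 0#
  sumFrom f j (suc n) = f j + sumFrom f (suc j) n

  sumFrom-cong : {f g : ℕ → A} → (∀ x → f x ≡ g x) → ∀ j n → sumFrom f j n ≡ sumFrom g j n
  sumFrom-cong eq j zero    = refl
  sumFrom-cong eq j (suc n) = cong₂ _+_ (eq j) (sumFrom-cong eq (suc j) n)

  sumBelow-sumFrom : (f : ℕ → ℕ → A) → ∀ m j n →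
    sumBelow (λ c → sumFrom (f c) j n) m ≡ sumFrom (λ i → sumBelow (λ c → f c i) m) j n
  sumBelow-sumFrom f m j zero    = sumBelow-0 _ (λ _ → refl) m
  sumBelow-sumFrom f m j (suc n) =
    trans (sumBelow-+ (λ c → f c j) (λ c → sumFrom (f c) (suc j) n) m)
          (cong (sumBelow (λ c → f c j) m +_) (sumBelow-sumFrom f m (suc j) n))

  sumFrom-*ˡ : (a : A) (f : ℕ → A) → ∀ j n → a * sumFrom f j n ≡ sumFrom (λ i → a * f i) j n
  sumFrom-*ˡ a f j zero    = zeroʳ a
  sumFrom-*ˡ a f j (suc n) = trans (distribˡ a _ _) (cong ((a * f j) +_) (sumFrom-*ˡ a f (suc j) n))

  natural : ℕ → A
  natural zero    = 0#
  natural (suc n) = 1# + natural n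

  natural-+ : ∀ m n → natural (m ℕ.+ n) ≡ natural m + natural n
  natural-+ zero    n = sym (+-identityˡ _)
  natural-+ (suc m) n = trans (cong (1# +_) (natural-+ m n)) (sym (+-assoc _ _ _))

  -- As a test function of the degree it extracts the coefficient of degree `m`.
  indicator : ℕ → ℕ → A
  indicator m w = if w ≡ᵇ m then 1# else 0#

  indicator-shift : ∀ i m w → indicator (i ℕ.+ m) (w ℕ.+ i) ≡ indicator m w
  indicator-shift i m w rewrite ℕₚ.+-comm w i = go i
    where
    go : ∀ i → indicator (i ℕ.+ m) (i ℕ.+ w) ≡ indicator m w
    go zero    = refl
    go (suc i) = go i

  indicator-≢ : ∀ m w → w ≢ m → indicator m w ≡ 0#
  indicator-≢ m w w≢m with w ≡ᵇ m in eq
  ... | true  = ⊥-elim (w≢m (ℕₚ.≡ᵇ⇒≡ w m (subst Data.Bool.T (sym eq) tt)))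
  ... | false = refl

  natural-indicator : ∀ m w → natural w * indicator m w ≡ natural m * indicator m w
  natural-indicator m w with w ≡ᵇ m in eq
  ... | true  = cong (λ z → natural z * 1#) (ℕₚ.≡ᵇ⇒≡ w m (subst Data.Bool.T (sym eq) tt))
  ... | false = trans (zeroʳ _) (sym (zeroʳ _))

  -- Partition sums as coefficients of an exponential series

  -- The hypotheses on e say e j c = (t j)ᶜ / (jᶜ c!), so that the weights are the
  -- terms of exp (∑ t j xʲ / j).  Testing against an arbitrary function g of the
  -- degree keeps all shifts free of subtraction.
  module PartitionSum (t : ℕ → A) (e : ℕ → ℕ → A) (e-zero : ∀ j → e j 0 ≡ 1#)
    (e-suc : ∀ j c → 1 ≤ j → natural (j ℕ.* suc c) * e j (suc c) ≡ t j * e j c) where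

    weight : ℕ → List ℕ → A
    weight j []       = 1#
    weight j (c ∷ cs) = e j c * weight (suc j) cs

    -- The result of replacing each power xʷ by `g w` in the product, over j ≤ i < j + n, of the
    -- truncated series ∑ e i c xⁱᶜ with c ≤ b.
    tested : ℕ → ℕ → ℕ → (ℕ → A) → A
    tested j n b g = sumOver (λ cs → weight j cs * g (weightFrom j cs)) (cands n b)

    tested-cong : ∀ j n b {g h : ℕ → A} → (∀ w → g w ≡ h w) → tested j n b g ≡ tested j n b h
    tested-cong j n b eq = sumOver-cong (λ cs → cong (weight j cs *_) (eq _)) (cands n b)

    tested-+ : ∀ j n b (g h : ℕ → A) → tested j n b (λ w → g w + h w) ≡ tested j n b g + tested j n b h
    tested-+ j n b g h = trans (sumOver-cong (λ cs → distribˡ _ _ _) (cands n b)) (sumOver-+ _ _ (cands n b))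

    *-swap : ∀ x y z → x * (y * z) ≡ y * (x * z)
    *-swap x y z = trans (sym (*-assoc x y z)) (trans (cong (_* z) (*-comm x y)) (*-assoc y x z))

    tested-* : ∀ j n b a (g : ℕ → A) → tested j n b (λ w → a * g w) ≡ a * tested j n b g
    tested-* j n b a g = trans (sumOver-cong (λ cs → *-swap _ _ _) (cands n b)) (sumOver-*ˡ a _ (cands n b))

    tested-0 : ∀ j n b {g : ℕ → A} → (∀ w → g w ≡ 0#) → tested j n b g ≡ 0#
    tested-0 j n b g0 = sumOver-0 _ (λ cs → trans (cong (weight j cs *_) (g0 _)) (zeroʳ _)) (cands n b)

    tested-suc : ∀ j n b (g : ℕ → A) → tested j (suc n) b g ≡
      sumBelow (λ c → e j c * tested (suc j) n b (λ w → g (j ℕ.* c ℕ.+ w))) (suc b)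
    tested-suc j n b g = begin
      tested j (suc n) b g
        ≡⟨ sumOver-concatMap _ (λ c → map (c ∷_) (cands n b)) (upTo (suc b)) ⟩
      sumOver (λ c → sumOver f (map (c ∷_) (cands n b))) (upTo (suc b))
        ≡⟨ sumOver-cong (λ c → sumOver-map f (c ∷_) (cands n b)) (upTo (suc b)) ⟩
      sumOver (λ c → sumOver (λ cs → f (c ∷ cs)) (cands n b)) (upTo (suc b))
        ≡⟨ sumOver-cong (λ c → trans (sumOver-cong (λ cs → *-assoc _ _ _) (cands n b)) (sumOver-*ˡ (e j c) _ (cands n b))) (upTo (suc b)) ⟩
      sumOver (λ c → e j c * tested (suc j) n b (λ w → g (j ℕ.* c ℕ.+ w))) (upTo (suc b))
        ≡⟨ sumOver-applyUpTo _ id (suc b) ⟩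
      sumBelow (λ c → e j c * tested (suc j) n b (λ w → g (j ℕ.* c ℕ.+ w))) (suc b) ∎
      where
      f : List ℕ → A
      f cs = weight j cs * g (weightFrom j cs)

    -- This is x F′ = (∑ tᵢ xⁱ) F for F = exp (∑ tᵢ xⁱ / i), proved by the product rule:
    -- differentiating the factor of index `j` gives `head`, differentiating the others gives
    -- `tail`, where the induction hypothesis applies. Truncating the factors at exponent `b` only
    -- disturbs degrees above `b`, where `g` vanishes.
    euler : ∀ n j b (g : ℕ → A) → 1 ≤ j → (∀ w → b < w → g w ≡ 0#) →
      tested j n b (λ w → natural w * g w) ≡ sumFrom (λ i → t i * tested j n b (λ w → g (w ℕ.+ i))) j n
    euler zero j b g 1≤j g0 = trans (+-identityʳ _) (trans (*-identityˡ _) (zeroˡ _))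
    euler (suc n) j b g 1≤j g0 = begin
      tested j (suc n) b (λ w → natural w * g w)
        ≡⟨ tested-suc j n b (λ w → natural w * g w) ⟩
      sumBelow (λ c → e j c * rest (λ w → natural (j ℕ.* c ℕ.+ w) * g (j ℕ.* c ℕ.+ w))) (suc b)
        ≡⟨ sumBelow-cong split (suc b) ⟩
      sumBelow (λ c → head c + tail c) (suc b)
        ≡⟨ sumBelow-+ head tail (suc b) ⟩
      sumBelow head (suc b) + sumBelow tail (suc b)
        ≡⟨ cong₂ _+_ headEq tailEq ⟩
      sumFrom (λ i → t i * tested j (suc n) b (λ w → g (w ℕ.+ i))) j (suc n) ∎
      where
      rest : (ℕ → A) → A
      rest = tested (suc j) n b
      head tail : ℕ → A
      head c = natural (j ℕ.* c) * e j c * rest (λ w → g (j ℕ.* c ℕ.+ w))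
      tail c = e j c * rest (λ w → natural w * g (j ℕ.* c ℕ.+ w))
      split : ∀ c → e j c * rest (λ w → natural (j ℕ.* c ℕ.+ w) * g (j ℕ.* c ℕ.+ w)) ≡ head c + tail c
      split c = begin
        e j c * rest (λ w → natural (j ℕ.* c ℕ.+ w) * g (j ℕ.* c ℕ.+ w))
          ≡⟨ cong (e j c *_) (trans (tested-cong (suc j) n b (λ w → trans (cong (_* g (j ℕ.* c ℕ.+ w)) (natural-+ (j ℕ.* c) w)) (distribʳ _ _ _)))
               (tested-+ (suc j) n b (λ w → natural (j ℕ.* c) * g (j ℕ.* c ℕ.+ w)) (λ w → natural w * g (j ℕ.* c ℕ.+ w)))) ⟩
        e j c * (rest (λ w → natural (j ℕ.* c) * g (j ℕ.* c ℕ.+ w)) + rest (λ w → natural w * g (j ℕ.* c ℕ.+ w)))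
          ≡⟨ distribˡ _ _ _ ⟩
        e j c * rest (λ w → natural (j ℕ.* c) * g (j ℕ.* c ℕ.+ w)) + tail c
          ≡⟨ cong (_+ tail c) (trans (cong (e j c *_) (tested-* (suc j) n b (natural (j ℕ.* c)) (λ w → g (j ℕ.* c ℕ.+ w)))) (trans (*-swap _ _ _) (sym (*-assoc _ _ _)))) ⟩
        head c + tail c ∎
      shifted : ℕ → A
      shifted c = e j c * rest (λ w → g (j ℕ.* c ℕ.+ w ℕ.+ j))
      j*suc : ∀ c w → j ℕ.* suc c ℕ.+ w ≡ j ℕ.* c ℕ.+ w ℕ.+ j
      j*suc c w = begin
        j ℕ.* suc c ℕ.+ w     ≡⟨ cong (ℕ._+ w) (ℕₚ.*-suc j c) ⟩
        j ℕ.+ j ℕ.* c ℕ.+ w   ≡⟨ ℕₚ.+-assoc j _ w ⟩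
        j ℕ.+ (j ℕ.* c ℕ.+ w) ≡⟨ ℕₚ.+-comm j _ ⟩
        j ℕ.* c ℕ.+ w ℕ.+ j   ∎
      head-suc : ∀ c → head (suc c) ≡ t j * shifted c
      head-suc c = trans (cong₂ _*_ (e-suc j c 1≤j) (tested-cong (suc j) n b (λ w → cong g (j*suc c w)))) (*-assoc _ _ _)
      -- Differentiation lowers the exponent, so `head` yields the shifted terms only for c < b. The
      -- missing term c = b has degree at least j (b + 1) > b and may be added for free.
      beyond : ∀ w → b < j ℕ.* b ℕ.+ w ℕ.+ j
      beyond w = subst (b <_) (j*suc b w)
        (ℕₚ.≤-trans (ℕₚ.m≤n*m (suc b) j ⦃ ℕ.>-nonZero 1≤j ⦄) (ℕₚ.m≤m+n _ w))
      headEq : sumBelow head (suc b) ≡ t j * tested j (suc n) b (λ w → g (w ℕ.+ j))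
      headEq = begin
        head 0 + sumBelow (head ∘ suc) b
          ≡⟨ cong₂ _+_ (trans (cong (_* rest (λ w → g (j ℕ.* 0 ℕ.+ w))) (trans (cong (λ z → natural z * e j 0) (ℕₚ.*-zeroʳ j)) (zeroˡ _))) (zeroˡ _))
                       (trans (sumBelow-cong head-suc b) (sumBelow-*ˡ (t j) shifted b)) ⟩
        0# + t j * sumBelow shifted b
          ≡⟨ +-identityˡ _ ⟩
        t j * sumBelow shifted b
          ≡⟨ cong (t j *_) (trans (cong (sumBelow shifted b +_) (trans (cong (e j b *_) (tested-0 (suc j) n b (λ w → g0 _ (beyond w)))) (zeroʳ _))) (+-identityʳ _)) ⟨
        t j * (sumBelow shifted b + shifted b)
          ≡⟨ cong (t j *_) (sumBelow-snoc shifted b) ⟨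
        t j * sumBelow shifted (suc b)
          ≡⟨ cong (t j *_) (tested-suc j n b (λ w → g (w ℕ.+ j))) ⟨
        t j * tested j (suc n) b (λ w → g (w ℕ.+ j)) ∎
      tail-term : ∀ c i → e j c * (t i * rest (λ w → g (j ℕ.* c ℕ.+ (w ℕ.+ i)))) ≡ t i * (e j c * rest (λ w → g (j ℕ.* c ℕ.+ w ℕ.+ i)))
      tail-term c i = trans (*-swap _ _ _) (cong (λ z → t i * (e j c * z)) (tested-cong (suc j) n b (λ w → cong g (sym (ℕₚ.+-assoc (j ℕ.* c) w i)))))
      tailEq : sumBelow tail (suc b) ≡ sumFrom (λ i → t i * tested j (suc n) b (λ w → g (w ℕ.+ i))) (suc j) n
      tailEq = begin
        sumBelow tail (suc b)
          ≡⟨ sumBelow-cong (λ c → trans (cong (e j c *_) (euler n (suc j) b (λ w → g (j ℕ.* c ℕ.+ w)) (s≤s z≤n)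
               (λ w b<w → g0 _ (ℕₚ.≤-trans b<w (ℕₚ.m≤n+m w _))))) (sumFrom-*ˡ (e j c) _ (suc j) n)) (suc b) ⟩
        sumBelow (λ c → sumFrom (λ i → e j c * (t i * rest (λ w → g (j ℕ.* c ℕ.+ (w ℕ.+ i))))) (suc j) n) (suc b)
          ≡⟨ sumBelow-sumFrom (λ c i → e j c * (t i * rest (λ w → g (j ℕ.* c ℕ.+ (w ℕ.+ i))))) (suc b) (suc j) n ⟩
        sumFrom (λ i → sumBelow (λ c → e j c * (t i * rest (λ w → g (j ℕ.* c ℕ.+ (w ℕ.+ i))))) (suc b)) (suc j) n
          ≡⟨ sumFrom-cong (λ i → trans (sumBelow-cong (λ c → tail-term c i) (suc b))
               (trans (sumBelow-*ˡ (t i) (λ c → e j c * rest (λ w → g (j ℕ.* c ℕ.+ w ℕ.+ i))) (suc b))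
                 (cong (t i *_) (sym (tested-suc j n b (λ w → g (w ℕ.+ i))))))) (suc j) n ⟩
        sumFrom (λ i → t i * tested j (suc n) b (λ w → g (w ℕ.+ i))) (suc j) n ∎

    -- For `m ≤ n` and `m ≤ b` neither the bound on the part sizes nor that on the multiplicities is
    -- felt, and this is the coefficient of xᵐ in the full exponential series.
    coefficient : ℕ → ℕ → ℕ → A
    coefficient n b m = tested 1 n b (indicator m)

    -- Shifting by i turns the test for degree j + m into the test for degree j + m - i. The first
    -- `m` indices give the antidiagonal; a larger shift exceeds the degree, and those terms vanish.
    sumFrom-antidiagonal : ∀ n b j m k → m ≤ k →
      sumFrom (λ i → t i * tested 1 n b (λ w → indicator (j ℕ.+ m) (w ℕ.+ i))) (suc j) k ≡
      antidiagonal _+_ 0# (λ i r → t (suc (j ℕ.+ i)) * coefficient n b r) m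
    sumFrom-antidiagonal n b j zero k m≤k = vanish (suc j) k ℕₚ.≤-refl
      where
      vanish : ∀ i k → j < i →
        sumFrom (λ i → t i * tested 1 n b (λ w → indicator (j ℕ.+ 0) (w ℕ.+ i))) i k ≡ 0#
      vanish i zero    j<i = refl
      vanish i (suc k) j<i = trans (cong₂ _+_
        (trans (cong (t i *_) (tested-0 1 n b (λ w → indicator-≢ (j ℕ.+ 0) (w ℕ.+ i) λ eq →
          ℕₚ.<-irrefl refl (ℕₚ.<-≤-trans j<i (ℕₚ.≤-trans (ℕₚ.m≤n+m i w) (ℕₚ.≤-reflexive (trans eq (ℕₚ.+-identityʳ j)))))))) (zeroʳ _))
        (vanish (suc i) k (ℕₚ.m<n⇒m<1+n j<i))) (+-identityˡ 0#)
    sumFrom-antidiagonal n b j (suc m) (suc k) (s≤s m≤k) = cong₂ _+_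
      (cong₂ _*_ (cong (t ∘ suc) (sym (ℕₚ.+-identityʳ j)))
        (tested-cong 1 n b (λ w → trans (cong (λ z → indicator z (w ℕ.+ suc j)) (ℕₚ.+-suc j m)) (indicator-shift (suc j) m w))))
      (trans (cong (λ z → sumFrom (λ i → t i * tested 1 n b (λ w → indicator z (w ℕ.+ i))) (suc (suc j)) k) (ℕₚ.+-suc j m))
        (trans (sumFrom-antidiagonal n b (suc j) m k m≤k)
          (antidiagonal-cong _+_ 0# _ _ m (λ i r _ → cong (λ z → t (suc z) * coefficient n b r) (sym (ℕₚ.+-suc j i))))))

    -- This is `euler` tested against the indicator of `m`, on whose support the degree may be
    -- exchanged with `m`. The bound `m ≤ b` makes that indicator vanish above `b`, and `m ≤ n`
    -- ensures that every shift up to `m` occurs.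
    coefficient-newton : ∀ n b m → m ≤ n → m ≤ b →
      natural m * coefficient n b m ≡ antidiagonal _+_ 0# (λ i r → t (suc i) * coefficient n b r) m
    coefficient-newton n b m m≤n m≤b = begin
      natural m * coefficient n b m
        ≡⟨ tested-* 1 n b (natural m) (indicator m) ⟨
      tested 1 n b (λ w → natural m * indicator m w)
        ≡⟨ tested-cong 1 n b (natural-indicator m) ⟨
      tested 1 n b (λ w → natural w * indicator m w)
        ≡⟨ euler n 1 b (indicator m) (s≤s z≤n) (λ w b<w → indicator-≢ m w (λ eq → ℕₚ.<⇒≱ b<w (subst (_≤ b) (sym eq) m≤b))) ⟩
      sumFrom (λ i → t i * tested 1 n b (λ w → indicator m (w ℕ.+ i))) 1 n
        ≡⟨ sumFrom-antidiagonal n b 0 m n m≤n ⟩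
      antidiagonal _+_ 0# (λ i r → t (suc i) * coefficient n b r) m ∎

    tested-indicator-0 : ∀ j n b → 1 ≤ j → tested j n b (indicator 0) ≡ 1#
    tested-indicator-0 j zero    b 1≤j = trans (+-identityʳ _) (*-identityˡ _)
    tested-indicator-0 j (suc n) b 1≤j = begin
      tested j (suc n) b (indicator 0)
        ≡⟨ tested-suc j n b (indicator 0) ⟩
      e j 0 * tested (suc j) n b (λ w → indicator 0 (j ℕ.* 0 ℕ.+ w))
        + sumBelow (λ c → e j (suc c) * tested (suc j) n b (λ w → indicator 0 (j ℕ.* suc c ℕ.+ w))) b
        ≡⟨ cong₂ _+_
             (trans (cong₂ _*_ (e-zero j) (trans (tested-cong (suc j) n b (λ w → cong (λ z → indicator 0 (z ℕ.+ w)) (ℕₚ.*-zeroʳ j)))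
               (tested-indicator-0 (suc j) n b (s≤s z≤n)))) (*-identityˡ _))
             (sumBelow-0 _ (λ c → trans (cong (e j (suc c) *_) (tested-0 (suc j) n b (λ w → indicator-≢ 0 _ (nonzero c w)))) (zeroʳ _)) b) ⟩
      1# + 0#
        ≡⟨ +-identityʳ 1# ⟩
      1# ∎
      where
      nonzero : ∀ c w → j ℕ.* suc c ℕ.+ w ≢ 0
      nonzero c w eq = ℕₚ.<⇒≢ (ℕₚ.≤-trans 1≤j (ℕₚ.≤-trans (ℕₚ.m≤m*n j (suc c)) (ℕₚ.m≤m+n _ w))) (sym eq)

    -- The recurrence expresses m ψ(m) through earlier values, so cancelling m determines ψ from
    -- ψ(0). The coefficients solve it with initial value 1, and a multiple of a solution is again a
    -- solution.
    newton-unique : (∀ m x y → natural (suc m) * x ≡ natural (suc m) * y → x ≡ y) → (ψ : ℕ → A) →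
      (∀ m → natural m * ψ m ≡ antidiagonal _+_ 0# (λ i r → t (suc i) * ψ r) m) →
      ∀ n b m → m ≤ n → m ≤ b → ψ m ≡ ψ 0 * coefficient n b m
    newton-unique cancel ψ ψ-newton n b = <-rec _ step
      where
      step : ∀ m → (∀ {r} → r < m → r ≤ n → r ≤ b → ψ r ≡ ψ 0 * coefficient n b r) →
        m ≤ n → m ≤ b → ψ m ≡ ψ 0 * coefficient n b m
      step zero    ih m≤n m≤b = sym (trans (cong (ψ 0 *_) (tested-indicator-0 1 n b (s≤s z≤n))) (trans (*-comm _ _) (*-identityˡ _)))
      step (suc m) ih m≤n m≤b = cancel m _ _ (begin
        natural (suc m) * ψ (suc m)
          ≡⟨ ψ-newton (suc m) ⟩
        antidiagonal _+_ 0# (λ i r → t (suc i) * ψ r) (suc m)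
          ≡⟨ antidiagonal-cong _+_ 0# _ _ (suc m) (λ i r r<m → trans
               (cong (t (suc i) *_) (ih r<m (ℕₚ.≤-trans (ℕₚ.<⇒≤ r<m) m≤n) (ℕₚ.≤-trans (ℕₚ.<⇒≤ r<m) m≤b)))
               (*-swap (t (suc i)) (ψ 0) (coefficient n b r))) ⟩
        antidiagonal _+_ 0# (λ i r → ψ 0 * (t (suc i) * coefficient n b r)) (suc m)
          ≡⟨ antidiagonal-map _+_ 0# _+_ 0# (ψ 0 *_) (zeroʳ (ψ 0)) (distribˡ (ψ 0)) (λ i r → t (suc i) * coefficient n b r) (suc m) ⟨
        ψ 0 * antidiagonal _+_ 0# (λ i r → t (suc i) * coefficient n b r) (suc m)
          ≡⟨ cong (ψ 0 *_) (coefficient-newton n b (suc m) m≤n m≤b) ⟨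
        ψ 0 * (natural (suc m) * coefficient n b (suc m))
          ≡⟨ *-swap (ψ 0) (natural (suc m)) (coefficient n b (suc m)) ⟩
        natural (suc m) * (ψ 0 * coefficient n b (suc m)) ∎)

-- Summation over a finite field

module _ where
  open import Data.Integer using (+_; _+_; _*_; _-_; -_)

  module FieldSum {q : ℕ} (K : FiniteField q) where
    open FiniteField K

    from : Fin q → F
    from = Inverse.from enum

    from-index : ∀ x → from (index x) ≡ x
    from-index x = Inverse.strictlyInverseʳ enum x

    index-from : ∀ i → index (from i) ≡ i
    index-from i = Inverse.strictlyInverseˡ enum i

    index-injective : ∀ {x y} → index x ≡ index y → x ≡ y
    index-injective {x} {y} eq = trans (sym (from-index x)) (trans (cong from eq) (from-index y))

    ==⇒≡ : ∀ x y → (x == y) ≡ true → x ≡ y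
    ==⇒≡ x y eq = index-injective (Finₚ.toℕ-injective (ℕₚ.≡ᵇ⇒≡ _ _ (subst T (sym eq) tt)))

    ==-refl : ∀ x → (x == x) ≡ true
    ==-refl x with x == x in eq
    ... | true  = refl
    ... | false = ⊥-elim (subst T eq (ℕₚ.≡⇒≡ᵇ (toℕ (index x)) _ refl))

    ≢⇒==false : ∀ {x y} → x ≢ y → (x == y) ≡ false
    ≢⇒==false {x} {y} x≢y with x == y in eq
    ... | true  = ⊥-elim (x≢y (==⇒≡ x y eq))
    ... | false = refl

    _≟F_ : (x y : F) → Dec (x ≡ y)
    x ≟F y with x == y in eq
    ... | true  = yes (==⇒≡ x y eq)
    ... | false = no λ { refl → contradiction (trans (sym eq) (==-refl x)) λ () }

    -- The monoid is arbitrary because besides integer-valued sums there is one sum in the field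
    -- itself, in the proof that q · 1 = 0.
    module Over (M : CommutativeMonoid 0ℓ 0ℓ) where
      open CommutativeMonoid M using (Carrier; _≈_; reflexive) renaming (trans to ≈-trans)
      open MonoidSum M using (sum; sum-permute; sum-cong-≗)

      ∑F : (F → Carrier) → Carrier
      ∑F f = sum (f ∘ from)

      ∑F-reindex : (f : F → Carrier) (σ τ : F → F) → (∀ x → σ (τ x) ≡ x) → (∀ x → τ (σ x) ≡ x) →
        ∑F f ≈ ∑F (f ∘ σ)
      ∑F-reindex f σ τ στ τσ = ≈-trans (sum-permute (f ∘ from) π)
          (reflexive (sum-cong-≗ {n = q} (λ i → cong f (from-index (σ (from i))))))
        where
        π = permutation (index ∘ σ ∘ from) (index ∘ τ ∘ from)
          (λ i → trans (cong (index ∘ σ) (from-index _)) (trans (cong index (στ _)) (index-from i)))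
          (λ i → trans (cong (index ∘ τ) (from-index _)) (trans (cong index (τσ _)) (index-from i)))

  -- Field arithmetic and integer-valued sums

  module FieldArithmetic {q : ℕ} (K : FiniteField q) where
    open FiniteField K
    open FieldSum K

    fieldRing : CommutativeRing 0ℓ 0ℓ
    fieldRing = record { isCommutativeRing = isCommutativeRing }

    open CommutativeRing fieldRing public using ()
      renaming (_+_ to _⊕_; _*_ to _⊛_; -_ to ⊖_; _-_ to _⊝_;
        +-assoc to ⊕-assoc; +-comm to ⊕-comm; +-identityˡ to ⊕-identityˡ; +-identityʳ to ⊕-identityʳ;
        -‿inverseˡ to ⊖-inverseˡ; -‿inverseʳ to ⊖-inverseʳ;
        *-assoc to ⊛-assoc; *-comm to ⊛-comm; *-identityˡ to ⊛-identityˡ; *-identityʳ to ⊛-identityʳ;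
        distribˡ to ⊛-distribˡ; distribʳ to ⊛-distribʳ; zeroˡ to ⊛-zeroˡ; zeroʳ to ⊛-zeroʳ)
    open RingProperties (CommutativeRing.ring fieldRing) public using ()
      renaming (-‿distribˡ-* to ⊖-distribˡ-⊛; -‿distribʳ-* to ⊖-distribʳ-⊛; -1*x≈-x to -1⊛x≡⊖x;
        -‿involutive to ⊖-involutive; -‿+-comm to ⊖-⊕-comm; -0#≈0# to ⊖0≡0;
        x∙y⁻¹≈ε⇒x≈y to x⊝y≡0⇒x≡y; +-inverseˡ-unique to x⊕y≡0⇒x≡⊖y)
    open ≡-Reasoning

    opaque
      -- The value `0F` at `0F` makes inversion an involution of the whole field, as `∑-involution`
      -- requires.
      inv : F → F
      inv x with x ≟F 0F
      ... | yes _   = 0F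
      ... | no  x≢0 = proj₁ (inverse x x≢0)

      inv-inverseʳ : ∀ {x} → x ≢ 0F → x ⊛ inv x ≡ 1F
      inv-inverseʳ {x} x≢0 with x ≟F 0F
      ... | yes x≡0 = ⊥-elim (x≢0 x≡0)
      ... | no  x≢0 = proj₂ (inverse x x≢0)

      inv-0 : inv 0F ≡ 0F
      inv-0 with 0F ≟F 0F
      ... | yes _   = refl
      ... | no  0≢0 = ⊥-elim (0≢0 refl)

    inv-inverseˡ : ∀ {x} → x ≢ 0F → inv x ⊛ x ≡ 1F
    inv-inverseˡ x≢0 = trans (⊛-comm _ _) (inv-inverseʳ x≢0)

    ⊛-cancel-inv : ∀ {a} x → a ≢ 0F → a ⊛ (inv a ⊛ x) ≡ x
    ⊛-cancel-inv x a≢0 = trans (sym (⊛-assoc _ _ _)) (trans (cong (_⊛ x) (inv-inverseʳ a≢0)) (⊛-identityˡ x))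

    inv-cancel-⊛ : ∀ {a} x → a ≢ 0F → inv a ⊛ (a ⊛ x) ≡ x
    inv-cancel-⊛ x a≢0 = trans (sym (⊛-assoc _ _ _)) (trans (cong (_⊛ x) (inv-inverseˡ a≢0)) (⊛-identityˡ x))

    ⊛-zero : ∀ x y → x ⊛ y ≡ 0F → x ≡ 0F ⊎ y ≡ 0F
    ⊛-zero x y xy≡0 with x ≟F 0F
    ... | yes x≡0 = inj₁ x≡0
    ... | no  x≢0 = inj₂ (trans (sym (inv-cancel-⊛ y x≢0)) (trans (cong (inv x ⊛_) xy≡0) (⊛-zeroʳ _)))

    ⊛-nonzero : ∀ {x y} → x ≢ 0F → y ≢ 0F → x ⊛ y ≢ 0F
    ⊛-nonzero x≢0 y≢0 xy≡0 with ⊛-zero _ _ xy≡0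
    ... | inj₁ x≡0 = x≢0 x≡0
    ... | inj₂ y≡0 = y≢0 y≡0

    inv-nonzero : ∀ {x} → x ≢ 0F → inv x ≢ 0F
    inv-nonzero {x} x≢0 eq = 0≢1 (trans (sym (⊛-zeroʳ x)) (trans (cong (x ⊛_) (sym eq)) (inv-inverseʳ x≢0)))

    inv-involutive : ∀ x → inv (inv x) ≡ x
    inv-involutive x with x ≟F 0F
    ... | yes refl = trans (cong inv inv-0) inv-0
    ... | no  x≢0  = begin
      inv (inv x)               ≡⟨ ⊛-cancel-inv (inv (inv x)) x≢0 ⟨
      x ⊛ (inv x ⊛ inv (inv x)) ≡⟨ cong (x ⊛_) (inv-inverseʳ (inv-nonzero x≢0)) ⟩
      x ⊛ 1F                    ≡⟨ ⊛-identityʳ x ⟩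
      x                         ∎

    ⊖⊛⊖ : ∀ x y → (⊖ x) ⊛ (⊖ y) ≡ x ⊛ y
    ⊖⊛⊖ x y = trans (sym (⊖-distribˡ-⊛ x (⊖ y))) (trans (cong ⊖_ (sym (⊖-distribʳ-⊛ x y))) (⊖-involutive _))

    ⊝⊕-cancel : ∀ x z → (x ⊝ z) ⊕ z ≡ x
    ⊝⊕-cancel x z = trans (⊕-assoc _ _ _) (trans (cong (x ⊕_) (⊖-inverseˡ z)) (⊕-identityʳ x))

    ⊕⊝-cancel : ∀ x z → (x ⊕ z) ⊝ z ≡ x
    ⊕⊝-cancel x z = trans (⊕-assoc _ _ _) (trans (cong (x ⊕_) (⊖-inverseʳ z)) (⊕-identityʳ x))

    ⊝-⊝-cancel : ∀ x z → x ⊝ (x ⊝ z) ≡ z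
    ⊝-⊝-cancel x z = begin
      x ⊕ ⊖ (x ⊕ ⊖ z)     ≡⟨ cong (x ⊕_) (⊖-⊕-comm x (⊖ z)) ⟨
      x ⊕ (⊖ x ⊕ ⊖ (⊖ z)) ≡⟨ ⊕-assoc _ _ _ ⟨
      (x ⊕ ⊖ x) ⊕ ⊖ (⊖ z) ≡⟨ cong₂ _⊕_ (⊖-inverseʳ x) (⊖-involutive z) ⟩
      0F ⊕ z              ≡⟨ ⊕-identityˡ z ⟩
      z                   ∎

    square-injective-up-to-sign : ∀ y r → y ⊛ y ≡ r ⊛ r → y ≡ r ⊎ y ≡ ⊖ r
    square-injective-up-to-sign y r eq with ⊛-zero (y ⊝ r) (y ⊕ r) product
      where
      product : (y ⊝ r) ⊛ (y ⊕ r) ≡ 0F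
      product = begin
        (y ⊕ ⊖ r) ⊛ (y ⊕ r)                     ≡⟨ ⊛-distribʳ _ _ _ ⟩
        y ⊛ (y ⊕ r) ⊕ ⊖ r ⊛ (y ⊕ r)             ≡⟨ cong₂ _⊕_ (⊛-distribˡ _ _ _) (trans (⊛-comm _ _) (sym (⊖-distribʳ-⊛ _ _))) ⟩
        (y ⊛ y ⊕ y ⊛ r) ⊕ ⊖ ((y ⊕ r) ⊛ r)       ≡⟨ cong₂ (λ a b → (a ⊕ y ⊛ r) ⊕ ⊖ b) eq (⊛-distribʳ _ _ _) ⟩
        (r ⊛ r ⊕ y ⊛ r) ⊕ ⊖ (y ⊛ r ⊕ r ⊛ r)     ≡⟨ cong (λ a → (r ⊛ r ⊕ y ⊛ r) ⊕ ⊖ a) (⊕-comm _ _) ⟩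
        (r ⊛ r ⊕ y ⊛ r) ⊕ ⊖ (r ⊛ r ⊕ y ⊛ r)     ≡⟨ ⊖-inverseʳ _ ⟩
        0F                                       ∎
    ... | inj₁ y-r≡0 = inj₁ (x⊝y≡0⇒x≡y y r y-r≡0)
    ... | inj₂ y+r≡0 = inj₂ (x⊕y≡0⇒x≡⊖y y r y+r≡0)

    fromℕF-+ : ∀ m n → fromℕF (m ℕ.+ n) ≡ fromℕF m ⊕ fromℕF n
    fromℕF-+ zero    n = sym (⊕-identityˡ _)
    fromℕF-+ (suc m) n = trans (cong (1F ⊕_) (fromℕF-+ m n)) (sym (⊕-assoc _ _ _))

    fromℕF-* : ∀ m n → fromℕF (m ℕ.* n) ≡ fromℕF m ⊛ fromℕF n
    fromℕF-* zero    n = sym (⊛-zeroˡ _)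
    fromℕF-* (suc m) n = trans (fromℕF-+ n (m ℕ.* n))
      (trans (cong₂ _⊕_ (sym (⊛-identityˡ _)) (fromℕF-* m n)) (sym (⊛-distribʳ _ _ _)))

    open SemiringSum ℤₚ.+-*-semiring using (sum; sum-cong-≗; ∑-distrib-+; ∑-comm; *-distribˡ-sum)
    open Over ℤₚ.+-0-commutativeMonoid public renaming (∑F to ∑; ∑F-reindex to ∑-reindex)

    ∑-cong : {f g : F → ℤ} → (∀ x → f x ≡ g x) → ∑ f ≡ ∑ g
    ∑-cong eq = sum-cong-≗ {n = q} (λ i → eq (from i))

    ∑-+ : (f g : F → ℤ) → ∑ (λ x → f x + g x) ≡ ∑ f + ∑ g
    ∑-+ f g = ∑-distrib-+ (f ∘ from) (g ∘ from)

    ∑-*ˡ : (c : ℤ) (f : F → ℤ) → ∑ (λ x → c * f x) ≡ c * ∑ f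
    ∑-*ˡ c f = sym (*-distribˡ-sum c (f ∘ from))

    ∑-*ʳ : (c : ℤ) (f : F → ℤ) → ∑ (λ x → f x * c) ≡ ∑ f * c
    ∑-*ʳ c f = trans (∑-cong (λ x → ℤₚ.*-comm (f x) c)) (trans (∑-*ˡ c f) (ℤₚ.*-comm c (∑ f)))

    ∑-neg : (f : F → ℤ) → ∑ (λ x → - f x) ≡ - ∑ f
    ∑-neg f = trans (∑-cong (λ x → sym (ℤₚ.-1*i≡-i (f x)))) (trans (∑-*ˡ -1ℤ f) (ℤₚ.-1*i≡-i (∑ f)))

    ∑-- : (f g : F → ℤ) → ∑ (λ x → f x - g x) ≡ ∑ f - ∑ g
    ∑-- f g = trans (∑-+ f (λ x → - g x)) (cong (λ z → ∑ f + z) (∑-neg g))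

    ∑-swap : (f : F → F → ℤ) → ∑ (λ x → ∑ (f x)) ≡ ∑ (λ y → ∑ (λ x → f x y))
    ∑-swap f = ∑-comm (λ i j → f (from i) (from j))

    ∑-translate : ∀ z (f : F → ℤ) → ∑ f ≡ ∑ (λ x → f (x ⊕ z))
    ∑-translate z f = ∑-reindex f (_⊕ z) (_⊝ z) (λ x → ⊝⊕-cancel x z) (λ x → ⊕⊝-cancel x z)

    ∑-translate⁻ : ∀ z (f : F → ℤ) → ∑ f ≡ ∑ (λ x → f (x ⊝ z))
    ∑-translate⁻ z f = ∑-reindex f (_⊝ z) (_⊕ z) (λ x → ⊕⊝-cancel x z) (λ x → ⊝⊕-cancel x z)

    ∑-const : (c : ℤ) → ∑ (λ _ → c) ≡ + q * c
    ∑-const c = go q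
      where
      go : ∀ n → sum {n} (λ _ → c) ≡ + n * c
      go zero    = sym (ℤₚ.*-zeroˡ c)
      go (suc n) = trans (cong (λ z → c + z) (go n)) (sym (ℤₚ.suc-* (+ n) c))

    ∑-nonpositive : (f : F → ℤ) → (∀ x → f x ℤ.≤ 0ℤ) → ∑ f ≡ 0ℤ → ∀ x → f x ≡ 0ℤ
    ∑-nonpositive f f≤0 ∑f≡0 x =
      trans (cong f (sym (from-index x))) (go (f ∘ from) (λ i → f≤0 (from i)) ∑f≡0 (index x))
      where
      sum≤0 : ∀ {n} (g : Fin n → ℤ) → (∀ i → g i ℤ.≤ 0ℤ) → sum g ℤ.≤ 0ℤ
      sum≤0 {zero}  g g≤0 = ℤₚ.≤-refl
      sum≤0 {suc n} g g≤0 = ℤₚ.+-mono-≤ (g≤0 Fin.zero) (sum≤0 (g ∘ Fin.suc) (g≤0 ∘ Fin.suc))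
      both : ∀ a b → a ℤ.≤ 0ℤ → b ℤ.≤ 0ℤ → a + b ≡ 0ℤ → a ≡ 0ℤ
      both a b a≤0 b≤0 eq = ℤₚ.≤-antisym a≤0
        (subst₂ ℤ._≤_ eq (ℤₚ.+-identityʳ a) (ℤₚ.+-monoʳ-≤ a b≤0))
      go : ∀ {n} (g : Fin n → ℤ) → (∀ i → g i ℤ.≤ 0ℤ) → sum g ≡ 0ℤ → ∀ i → g i ≡ 0ℤ
      go g g≤0 eq Fin.zero    = both _ _ (g≤0 Fin.zero) (sum≤0 (g ∘ Fin.suc) (g≤0 ∘ Fin.suc)) eq
      go g g≤0 eq (Fin.suc i) = go (g ∘ Fin.suc) (g≤0 ∘ Fin.suc)
        (both _ (g Fin.zero) (sum≤0 (g ∘ Fin.suc) (g≤0 ∘ Fin.suc)) (g≤0 Fin.zero) (trans (ℤₚ.+-comm _ (g Fin.zero)) eq)) i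

    -- With the comparison written as `x == a`, the function `δ 0F` is by definition the indicator
    -- of `isZero`, which is the test used in `N-H`.
    δ : F → F → ℤ
    δ a x = if x == a then 1ℤ else 0ℤ

    δ-refl : ∀ a → δ a a ≡ 1ℤ
    δ-refl a rewrite ==-refl a = refl

    δ-≢ : ∀ {a x} → x ≢ a → δ a x ≡ 0ℤ
    δ-≢ x≢a rewrite ≢⇒==false x≢a = refl

    ∑-δ-1 : ∀ a → ∑ (δ a) ≡ 1ℤ
    ∑-δ-1 a = trans (sum-cong-≗ {n = q} (λ i → cong (λ z → if toℕ z ≡ᵇ toℕ (index a) then 1ℤ else 0ℤ) (index-from i)))
                    (go (index a))
      where
      zeros : ∀ n → sum {n} (λ _ → 0ℤ) ≡ 0ℤ
      zeros zero    = refl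
      zeros (suc n) = trans (ℤₚ.+-identityˡ _) (zeros n)
      go : ∀ {n} (k : Fin n) → sum {n} (λ i → if toℕ i ≡ᵇ toℕ k then 1ℤ else 0ℤ) ≡ 1ℤ
      go {suc n} Fin.zero    = cong (λ z → 1ℤ + z) (zeros n)
      go {suc n} (Fin.suc k) = trans (ℤₚ.+-identityˡ _) (go k)

    δ-* : ∀ a x (f : F → ℤ) → δ a x * f x ≡ δ a x * f a
    δ-* a x f with x ≟F a
    ... | yes refl = refl
    ... | no  x≢a  = trans (cong (_* f x) (δ-≢ x≢a)) (sym (cong (_* f a) (δ-≢ x≢a)))

    ∑-δ : ∀ a (f : F → ℤ) → ∑ (λ x → δ a x * f x) ≡ f a
    ∑-δ a f = trans (∑-cong (λ x → δ-* a x f))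
      (trans (∑-*ʳ (f a) (δ a)) (trans (cong (_* f a) (∑-δ-1 a)) (ℤₚ.*-identityˡ (f a))))

    -- Squares and the quadratic character

    -- A view that supplies the root or its nonexistence, which the Boolean search in
    -- `isNonzeroSquare` hides; matching on it replaces a square by `r ⊛ r`.
    data SquareClass (x : F) : Set where
      isZero′     : x ≡ 0F → SquareClass x
      isSquare    : ∀ r → r ≢ 0F → r ⊛ r ≡ x → SquareClass x
      isNonsquare : x ≢ 0F → (∀ y → y ⊛ y ≢ x) → SquareClass x

    any-map-true : {X : Set} (p : F → Bool) (h : X → F) → ∀ xs → any p (map h xs) ≡ true → ∃ λ y → p y ≡ true
    any-map-true p h (x ∷ xs) eq with p (h x) in px
    ... | true  = h x , px
    ... | false = any-map-true p h xs eq

    any-tabulate-false : (p : F → Bool) → ∀ {n m} (h : Fin m → F) (g : Fin n → Fin m) → any p (map h (tabulate g)) ≡ false →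
      ∀ i → p (h (g i)) ≡ false
    any-tabulate-false p {suc n} h g eq i with p (h (g Fin.zero)) in px
    any-tabulate-false p {suc n} h g eq Fin.zero    | false = px
    any-tabulate-false p {suc n} h g eq (Fin.suc i) | false = any-tabulate-false p h (g ∘ Fin.suc) eq i

    any-elems-false : (p : F → Bool) → any p elems ≡ false → ∀ x → p x ≡ false
    any-elems-false p eq x = subst (λ z → p z ≡ false) (from-index x) (any-tabulate-false p from id eq (index x))

    squareClass : ∀ x → SquareClass x
    squareClass x with x ≟F 0F
    ... | yes x≡0 = isZero′ x≡0
    ... | no  x≢0 with any (λ y → (y *F y) == x) elems in eq
    ...   | true  = isSquare r r≢0 r²≡x
      where
      root = any-map-true (λ y → (y *F y) == x) from (tabulate id) eq
      r = proj₁ root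
      r²≡x : r ⊛ r ≡ x
      r²≡x = ==⇒≡ _ _ (proj₂ root)
      r≢0 : r ≢ 0F
      r≢0 r≡0 = x≢0 (trans (sym r²≡x) (trans (cong (_⊛ r) r≡0) (⊛-zeroˡ r)))
    ...   | false = isNonsquare x≢0 λ y y²≡x → contradiction
              (trans (sym (subst (λ z → ((y *F y) == z) ≡ true) y²≡x (==-refl _))) (any-elems-false _ eq y)) λ ()

    isNonzeroSquare-square : ∀ {x} r → r ≢ 0F → r ⊛ r ≡ x → isNonzeroSquare x ≡ true
    isNonzeroSquare-square {x} r r≢0 refl rewrite ≢⇒==false (⊛-nonzero r≢0 r≢0)
      with any (λ y → (y *F y) == (r *F r)) elems in eq
    ... | true  = refl
    ... | false = trans (sym (any-elems-false _ eq r)) (==-refl _)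

    isNonzeroSquare-nonsquare : ∀ {x} → x ≢ 0F → (∀ y → y ⊛ y ≢ x) → isNonzeroSquare x ≡ false
    isNonzeroSquare-nonsquare {x} x≢0 x≢² rewrite ≢⇒==false x≢0
      with any (λ y → (y *F y) == x) elems in eq
    ... | true  = ⊥-elim (x≢² _ (==⇒≡ _ _ (proj₂ (any-map-true (λ y → (y *F y) == x) from (tabulate id) eq))))
    ... | false = refl

    χ : F → ℤ
    χ x = if isZero x then 0ℤ else (if isNonzeroSquare x then 1ℤ else -1ℤ)

    χ-0 : χ 0F ≡ 0ℤ
    χ-0 rewrite ==-refl 0F = refl

    χ-square : ∀ {x} r → r ≢ 0F → r ⊛ r ≡ x → χ x ≡ 1ℤ
    χ-square r r≢0 refl
      rewrite isNonzeroSquare-square r r≢0 refl | ≢⇒==false (⊛-nonzero r≢0 r≢0) = refl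

    χ-nonsquare : ∀ {x} → x ≢ 0F → (∀ y → y ⊛ y ≢ x) → χ x ≡ -1ℤ
    χ-nonsquare x≢0 x≢² rewrite isNonzeroSquare-nonsquare x≢0 x≢² | ≢⇒==false x≢0 = refl

    squareIndicator : F → ℤ
    squareIndicator x = if isNonzeroSquare x then 1ℤ else 0ℤ

    -- The expansion of the indicator of `H` in the trivial and the quadratic multiplicative
    -- character. The factor 2 stays on the left to remain in ℤ.
    squareIndicator-χ : ∀ x → + 2 * squareIndicator x ≡ (1ℤ - δ 0F x) + χ x
    squareIndicator-χ x with squareClass x
    ... | isZero′ refl rewrite ==-refl 0F = refl
    ... | isSquare r r≢0 refl
      rewrite isNonzeroSquare-square r r≢0 refl | ≢⇒==false (⊛-nonzero r≢0 r≢0) = refl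
    ... | isNonsquare x≢0 x≢² rewrite isNonzeroSquare-nonsquare x≢0 x≢² | ≢⇒==false x≢0 = refl

  -- The quadratic character in odd characteristic

  module OddCharacteristic {q : ℕ} (K : FiniteField q) (2≢0 : FiniteField.fromℕF K 2 ≢ FiniteField.0F K) where
    open FiniteField K
    open FieldSum K
    open FieldArithmetic K
    open ≡-Reasoning
    open +-*-Solver using (solve; _:=_; _:+_; _:*_; _:-_; con)

    1≢0 : 1F ≢ 0F
    1≢0 = 0≢1 ∘ sym

    x≢⊖x : ∀ {x} → x ≢ 0F → x ≢ ⊖ x
    x≢⊖x {x} x≢0 x≡⊖x = ⊛-nonzero 2≢0 x≢0 (begin
      (1F ⊕ (1F ⊕ 0F)) ⊛ x ≡⟨ cong (λ z → (1F ⊕ z) ⊛ x) (⊕-identityʳ 1F) ⟩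
      (1F ⊕ 1F) ⊛ x        ≡⟨ ⊛-distribʳ _ _ _ ⟩
      1F ⊛ x ⊕ 1F ⊛ x      ≡⟨ cong₂ _⊕_ (⊛-identityˡ x) (⊛-identityˡ x) ⟩
      x ⊕ x                ≡⟨ cong (x ⊕_) x≡⊖x ⟩
      x ⊕ ⊖ x              ≡⟨ ⊖-inverseʳ x ⟩
      0F                   ∎)

    δ-sym : ∀ a x → δ a x ≡ δ x a
    δ-sym a x with x ≟F a
    ... | yes refl = refl
    ... | no  x≢a  = trans (δ-≢ x≢a) (sym (δ-≢ (x≢a ∘ sym)))

    -- A nonzero square r² has exactly the roots r and -r, which differ because 2 ≠ 0.
    ∑-roots : ∀ x → ∑ (λ y → δ x (y ⊛ y)) ≡ 1ℤ + χ x
    ∑-roots x with squareClass x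
    ... | isZero′ refl = trans (∑-cong δ-square) (trans (∑-δ-1 0F) (sym (cong (λ z → 1ℤ + z) χ-0)))
      where
      δ-square : ∀ y → δ 0F (y ⊛ y) ≡ δ 0F y
      δ-square y with y ≟F 0F
      ... | yes refl = cong (δ 0F) (⊛-zeroˡ 0F)
      ... | no  y≢0  = trans (δ-≢ (⊛-nonzero y≢0 y≢0)) (sym (δ-≢ y≢0))
    ... | isSquare r r≢0 refl = begin
        ∑ (λ y → δ (r ⊛ r) (y ⊛ y))     ≡⟨ ∑-cong δ-square ⟩
        ∑ (λ y → δ r y + δ (⊖ r) y)     ≡⟨ ∑-+ (δ r) (δ (⊖ r)) ⟩
        ∑ (δ r) + ∑ (δ (⊖ r))           ≡⟨ cong₂ _+_ (∑-δ-1 r) (∑-δ-1 (⊖ r)) ⟩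
        1ℤ + 1ℤ                         ≡⟨ cong (λ z → 1ℤ + z) (χ-square r r≢0 refl) ⟨
        1ℤ + χ (r ⊛ r)                  ∎
      where
      δ-square : ∀ y → δ (r ⊛ r) (y ⊛ y) ≡ δ r y + δ (⊖ r) y
      δ-square y with y ≟F r
      ... | yes refl = trans (δ-refl (r ⊛ r)) (sym (cong₂ _+_ (δ-refl r) (δ-≢ (x≢⊖x r≢0))))
      ... | no y≢r with y ≟F (⊖ r)
      ...   | yes refl = trans (trans (cong (δ (r ⊛ r)) (⊖⊛⊖ r r)) (δ-refl (r ⊛ r)))
                               (sym (cong₂ _+_ (δ-≢ y≢r) (δ-refl (⊖ r))))
      ...   | no y≢⊖r = trans (δ-≢ y²≢r²) (sym (cong₂ _+_ (δ-≢ y≢r) (δ-≢ y≢⊖r)))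
        where
        y²≢r² : y ⊛ y ≢ r ⊛ r
        y²≢r² eq with square-injective-up-to-sign y r eq
        ... | inj₁ y≡r  = y≢r y≡r
        ... | inj₂ y≡⊖r = y≢⊖r y≡⊖r
    ... | isNonsquare x≢0 x≢² = begin
      ∑ (λ y → δ x (y ⊛ y)) ≡⟨ ∑-cong (λ y → δ-≢ (x≢² y)) ⟩
      ∑ (λ _ → 0ℤ)          ≡⟨ ∑-const 0ℤ ⟩
      + q * 0ℤ              ≡⟨ ℤₚ.*-zeroʳ (+ q) ⟩
      0ℤ                    ≡⟨ cong (λ z → 1ℤ + z) (χ-nonsquare x≢0 x≢²) ⟨
      1ℤ + χ x              ∎

    -- The pairs (x , y) with y² = x are counted in two ways: each x has 1 + χ(x) partners y, each y
    -- has one partner x.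
    ∑χ≡0 : ∑ χ ≡ 0ℤ
    ∑χ≡0 = RingProperties.+-cancelˡ ℤₚ.+-*-ring (∑ (λ _ → 1ℤ)) (∑ χ) 0ℤ (begin
      ∑ (λ _ → 1ℤ) + ∑ χ              ≡⟨ ∑-+ (λ _ → 1ℤ) χ ⟨
      ∑ (λ x → 1ℤ + χ x)              ≡⟨ ∑-cong ∑-roots ⟨
      ∑ (λ x → ∑ (λ y → δ x (y ⊛ y))) ≡⟨ ∑-swap (λ x y → δ x (y ⊛ y)) ⟩
      ∑ (λ y → ∑ (λ x → δ x (y ⊛ y))) ≡⟨ ∑-cong (λ y → trans (∑-cong (λ x → δ-sym x (y ⊛ y))) (∑-δ-1 (y ⊛ y))) ⟩
      ∑ (λ _ → 1ℤ)                    ≡⟨ ℤₚ.+-identityʳ _ ⟨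
      ∑ (λ _ → 1ℤ) + 0ℤ               ∎)

    χ-nonsquare-* : ∀ {a} r → r ≢ 0F → a ≢ 0F → (∀ y → y ⊛ y ≢ a) → χ (a ⊛ (r ⊛ r)) ≡ -1ℤ
    χ-nonsquare-* {a} r r≢0 a≢0 a≢² = χ-nonsquare (⊛-nonzero a≢0 (⊛-nonzero r≢0 r≢0)) λ y y²≡ar² →
      a≢² (inv r ⊛ y) (begin
        (inv r ⊛ y) ⊛ (inv r ⊛ y)         ≡⟨ interchange (inv r) y ⟩
        inv r ⊛ (inv r ⊛ (y ⊛ y))         ≡⟨ cong (λ z → inv r ⊛ (inv r ⊛ z)) y²≡ar² ⟩
        inv r ⊛ (inv r ⊛ (a ⊛ (r ⊛ r)))   ≡⟨ cong (λ z → inv r ⊛ (inv r ⊛ z)) (trans (⊛-comm a _) (⊛-assoc r r a)) ⟩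
        inv r ⊛ (inv r ⊛ (r ⊛ (r ⊛ a)))   ≡⟨ cong (inv r ⊛_) (inv-cancel-⊛ (r ⊛ a) r≢0) ⟩
        inv r ⊛ (r ⊛ a)                   ≡⟨ inv-cancel-⊛ a r≢0 ⟩
        a                                 ∎)
      where
      interchange : ∀ u y → (u ⊛ y) ⊛ (u ⊛ y) ≡ u ⊛ (u ⊛ (y ⊛ y))
      interchange u y = begin
        (u ⊛ y) ⊛ (u ⊛ y) ≡⟨ ⊛-assoc _ _ _ ⟩
        u ⊛ (y ⊛ (u ⊛ y)) ≡⟨ cong (u ⊛_) (⊛-comm y (u ⊛ y)) ⟩
        u ⊛ ((u ⊛ y) ⊛ y) ≡⟨ cong (u ⊛_) (⊛-assoc u y y) ⟩
        u ⊛ (u ⊛ (y ⊛ y)) ∎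

    ∑-scale : ∀ {a} → a ≢ 0F → (f : F → ℤ) → ∑ f ≡ ∑ (λ x → f (a ⊛ x))
    ∑-scale {a} a≢0 f = ∑-reindex f (a ⊛_) (inv a ⊛_) (λ x → ⊛-cancel-inv x a≢0) (λ x → inv-cancel-⊛ x a≢0)

    -- χ (a x) + χ x is never positive and sums to 0, so it vanishes identically.
    χ-*-nonsquare : ∀ {a} → a ≢ 0F → (∀ y → y ⊛ y ≢ a) → ∀ x → χ (a ⊛ x) + χ x ≡ 0ℤ
    χ-*-nonsquare {a} a≢0 a≢² = ∑-nonpositive (λ x → χ (a ⊛ x) + χ x) nonpositive
        (trans (∑-+ (λ x → χ (a ⊛ x)) χ) (cong₂ _+_ (trans (sym (∑-scale a≢0 χ)) ∑χ≡0) ∑χ≡0))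
      where
      χ≤1 : ∀ y → χ y ℤ.≤ 1ℤ
      χ≤1 y with isZero y | isNonzeroSquare y
      ... | true  | _     = ℤ.+≤+ ℕ.z≤n
      ... | false | true  = ℤₚ.≤-refl
      ... | false | false = ℤ.-≤+
      nonpositive : ∀ x → χ (a ⊛ x) + χ x ℤ.≤ 0ℤ
      nonpositive x with squareClass x
      ... | isZero′ refl        = ℤₚ.≤-reflexive (cong₂ _+_ (trans (cong χ (⊛-zeroʳ a)) χ-0) χ-0)
      ... | isSquare r r≢0 refl = ℤₚ.≤-reflexive (cong₂ _+_ (χ-nonsquare-* r r≢0 a≢0 a≢²) (χ-square r r≢0 refl))
      -- That a x is a square is not known at this point; the bound χ(a x) ≤ 1 is enough.
      ... | isNonsquare x≢0 x≢² =
        ℤₚ.≤-trans (ℤₚ.≤-reflexive (cong (λ z → χ (a ⊛ x) + z) (χ-nonsquare x≢0 x≢²))) (ℤₚ.+-monoˡ-≤ -1ℤ (χ≤1 (a ⊛ x)))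

    χ-* : ∀ a b → χ (a ⊛ b) ≡ χ a * χ b
    χ-* a b with squareClass a
    ... | isZero′ refl = trans (trans (cong χ (⊛-zeroˡ b)) χ-0) (sym (trans (cong (_* χ b) χ-0) (ℤₚ.*-zeroˡ (χ b))))
    ... | isNonsquare a≢0 a≢² = begin
      χ (a ⊛ b)  ≡⟨ solve 2 (λ u v → u := (u :+ v) :- v) refl (χ (a ⊛ b)) (χ b) ⟩
      (χ (a ⊛ b) + χ b) - χ b ≡⟨ cong (_- χ b) (χ-*-nonsquare a≢0 a≢² b) ⟩
      0ℤ - χ b   ≡⟨ solve 1 (λ v → con 0ℤ :- v := con -1ℤ :* v) refl (χ b) ⟩
      -1ℤ * χ b  ≡⟨ cong (_* χ b) (χ-nonsquare a≢0 a≢²) ⟨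
      χ a * χ b  ∎
    ... | isSquare r r≢0 refl with squareClass b
    ...   | isZero′ refl = trans (trans (cong χ (⊛-zeroʳ _)) χ-0) (sym (trans (cong (χ (r ⊛ r) *_) χ-0) (ℤₚ.*-zeroʳ (χ (r ⊛ r)))))
    ...   | isSquare s s≢0 refl = trans (χ-square (r ⊛ s) (⊛-nonzero r≢0 s≢0) rs²)
              (sym (cong₂ _*_ (χ-square r r≢0 refl) (χ-square s s≢0 refl)))
      where
      rs² : (r ⊛ s) ⊛ (r ⊛ s) ≡ (r ⊛ r) ⊛ (s ⊛ s)
      rs² = begin
        (r ⊛ s) ⊛ (r ⊛ s) ≡⟨ ⊛-assoc _ _ _ ⟩
        r ⊛ (s ⊛ (r ⊛ s)) ≡⟨ cong (r ⊛_) (trans (⊛-comm _ _) (⊛-assoc _ _ _)) ⟩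
        r ⊛ (r ⊛ (s ⊛ s)) ≡⟨ ⊛-assoc _ _ _ ⟨
        (r ⊛ r) ⊛ (s ⊛ s) ∎
    ...   | isNonsquare b≢0 b≢² = trans (trans (cong χ (⊛-comm (r ⊛ r) b)) (χ-nonsquare-* r r≢0 b≢0 b≢²))
              (sym (cong₂ _*_ (χ-square r r≢0 refl) (χ-nonsquare b≢0 b≢²)))

    χ-² : ∀ x → χ x * χ x ≡ 1ℤ - δ 0F x
    χ-² x with squareClass x
    ... | isZero′ refl        = trans (cong₂ _*_ χ-0 χ-0) (sym (cong (λ z → 1ℤ - z) (δ-refl 0F)))
    ... | isSquare r r≢0 refl = trans (cong₂ _*_ (χ-square r r≢0 refl) (χ-square r r≢0 refl)) (sym (cong (λ z → 1ℤ - z) (δ-≢ (⊛-nonzero r≢0 r≢0))))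
    ... | isNonsquare x≢0 x≢² = trans (cong₂ _*_ (χ-nonsquare x≢0 x≢²) (χ-nonsquare x≢0 x≢²)) (sym (cong (λ z → 1ℤ - z) (δ-≢ x≢0)))

    χ-²-nonzero : ∀ {x} → x ≢ 0F → χ x * χ x ≡ 1ℤ
    χ-²-nonzero x≢0 = trans (χ-² _) (cong (λ z → 1ℤ - z) (δ-≢ x≢0))

    ∑1-δ : ∑ (λ x → 1ℤ - δ 0F x) ≡ + q - 1ℤ
    ∑1-δ = trans (∑-- (λ _ → 1ℤ) (δ 0F)) (cong₂ _-_ (trans (∑-const 1ℤ) (ℤₚ.*-identityʳ (+ q))) (∑-δ-1 0F))

    q≢1 : + q ≢ 1ℤ
    q≢1 eq = 0≢1 (index-injective (unique q (ℤₚ.+-injective eq) (index 0F) (index 1F)))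
      where
      unique : ∀ n → n ≡ 1 → (i j : Fin n) → i ≡ j
      unique _ refl Fin.zero Fin.zero = refl

    correlation : F → ℤ
    correlation y = ∑ (λ z → χ z * χ (y ⊕ z))

    correlation-0 : correlation 0F ≡ + q - 1ℤ
    correlation-0 = trans (∑-cong (λ z → trans (cong (λ w → χ z * χ w) (⊕-identityˡ z)) (χ-² z))) ∑1-δ

    -- The substitution z ↦ y z pulls out χ(y)² = 1, so the correlation is constant away from 0.
    correlation-scale : ∀ {y} → y ≢ 0F → correlation y ≡ correlation 1F
    correlation-scale {y} y≢0 = trans (∑-scale y≢0 (λ z → χ z * χ (y ⊕ z))) (∑-cong λ z → begin
      χ (y ⊛ z) * χ (y ⊕ y ⊛ z)         ≡⟨ cong (λ w → χ (y ⊛ z) * χ (w ⊕ y ⊛ z)) (⊛-identityʳ y) ⟨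
      χ (y ⊛ z) * χ (y ⊛ 1F ⊕ y ⊛ z)    ≡⟨ cong (λ w → χ (y ⊛ z) * χ w) (⊛-distribˡ y 1F z) ⟨
      χ (y ⊛ z) * χ (y ⊛ (1F ⊕ z))      ≡⟨ cong₂ _*_ (χ-* y z) (χ-* y (1F ⊕ z)) ⟩
      (χ y * χ z) * (χ y * χ (1F ⊕ z))  ≡⟨ solve 3 (λ a b c → (a :* b) :* (a :* c) := (a :* a) :* (b :* c)) refl (χ y) (χ z) (χ (1F ⊕ z)) ⟩
      (χ y * χ y) * (χ z * χ (1F ⊕ z))  ≡⟨ cong (_* (χ z * χ (1F ⊕ z))) (χ-²-nonzero y≢0) ⟩
      1ℤ * (χ z * χ (1F ⊕ z))           ≡⟨ ℤₚ.*-identityˡ _ ⟩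
      χ z * χ (1F ⊕ z)                  ∎)

    -- Summed over y first, the inner sum is χ(z) times a translate of ∑ χ = 0.
    ∑-correlation : ∑ correlation ≡ 0ℤ
    ∑-correlation = begin
      ∑ (λ y → ∑ (λ z → χ z * χ (y ⊕ z))) ≡⟨ ∑-swap (λ y z → χ z * χ (y ⊕ z)) ⟩
      ∑ (λ z → ∑ (λ y → χ z * χ (y ⊕ z))) ≡⟨ ∑-cong (λ z → trans (∑-*ˡ (χ z) (λ y → χ (y ⊕ z)))
                                                (cong (χ z *_) (trans (sym (∑-translate z χ)) ∑χ≡0))) ⟩
      ∑ (λ z → χ z * 0ℤ)                  ≡⟨ ∑-*ʳ 0ℤ χ ⟩
      ∑ χ * 0ℤ                            ≡⟨ ℤₚ.*-zeroʳ (∑ χ) ⟩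
      0ℤ                                  ∎

    correlation-split : ∀ y → correlation y ≡ correlation 1F + δ 0F y * (correlation 0F - correlation 1F)
    correlation-split y with y ≟F 0F
    ... | yes refl = trans (solve 2 (λ a b → a := b :+ con 1ℤ :* (a :- b)) refl (correlation 0F) (correlation 1F))
                       (cong (λ z → correlation 1F + z * (correlation 0F - correlation 1F)) (sym (δ-refl 0F)))
    ... | no  y≢0  = trans (trans (correlation-scale y≢0) (solve 2 (λ a b → b := b :+ con 0ℤ :* (a :- b)) refl (correlation 0F) (correlation 1F)))
                       (cong (λ z → correlation 1F + z * (correlation 0F - correlation 1F)) (sym (δ-≢ y≢0)))

    -- The value q - 1 at 0 and the common value c₁ at the other q - 1 points add up to 0, that is
    -- (q - 1)(c₁ + 1) = 0, where q ≠ 1.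
    correlation-1 : correlation 1F ≡ -1ℤ
    correlation-1 = [ (λ q-1≡0 → ⊥-elim (q≢1 (ℤₚ.i-j≡0⇒i≡j (+ q) 1ℤ q-1≡0))) , ℤₚ.i-j≡0⇒i≡j c₁ -1ℤ ]′
      (ℤₚ.i*j≡0⇒i≡0∨j≡0 (+ q - 1ℤ) {c₁ + 1ℤ} (begin
        (+ q - 1ℤ) * (c₁ + 1ℤ)              ≡⟨ solve 2 (λ n c → (n :- con 1ℤ) :* (c :+ con 1ℤ) := n :* c :+ con 1ℤ :* ((n :- con 1ℤ) :- c)) refl (+ q) c₁ ⟩
        + q * c₁ + 1ℤ * ((+ q - 1ℤ) - c₁)   ≡⟨ cong (λ z → + q * c₁ + 1ℤ * (z - c₁)) correlation-0 ⟨
        + q * c₁ + 1ℤ * (correlation 0F - c₁) ≡⟨ cong₂ _+_ (sym (∑-const c₁)) (trans (cong (_* (correlation 0F - c₁)) (sym (∑-δ-1 0F))) (sym (∑-*ʳ (correlation 0F - c₁) (δ 0F)))) ⟩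
        ∑ (λ _ → c₁) + ∑ (λ y → δ 0F y * (correlation 0F - c₁)) ≡⟨ ∑-+ (λ _ → c₁) (λ y → δ 0F y * (correlation 0F - c₁)) ⟨
        ∑ (λ y → c₁ + δ 0F y * (correlation 0F - c₁)) ≡⟨ ∑-cong correlation-split ⟨
        ∑ correlation ≡⟨ ∑-correlation ⟩
        0ℤ ∎))
      where
      c₁ : ℤ
      c₁ = correlation 1F

    correlation-value : ∀ y → correlation y ≡ + q * δ 0F y - 1ℤ
    correlation-value y = begin
      correlation y ≡⟨ correlation-split y ⟩
      correlation 1F + δ 0F y * (correlation 0F - correlation 1F) ≡⟨ cong₂ (λ a b → a + δ 0F y * (b - a)) correlation-1 correlation-0 ⟩
      -1ℤ + δ 0F y * ((+ q - 1ℤ) - -1ℤ) ≡⟨ solve 2 (λ d n → con -1ℤ :+ d :* ((n :- con 1ℤ) :- con -1ℤ) := n :* d :- con 1ℤ) refl (δ 0F y) (+ q) ⟩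
      + q * δ 0F y - 1ℤ ∎

    -- The parity of the number of squares and the value of χ(-1)

    squareCount : ℤ
    squareCount = ∑ squareIndicator

    2*squareCount : + 2 * squareCount ≡ + q - 1ℤ
    2*squareCount = begin
      + 2 * ∑ squareIndicator               ≡⟨ ∑-*ˡ (+ 2) squareIndicator ⟨
      ∑ (λ x → + 2 * squareIndicator x)     ≡⟨ ∑-cong squareIndicator-χ ⟩
      ∑ (λ x → (1ℤ - δ 0F x) + χ x)         ≡⟨ ∑-+ (λ x → 1ℤ - δ 0F x) χ ⟩
      ∑ (λ x → 1ℤ - δ 0F x) + ∑ χ           ≡⟨ cong₂ _+_ ∑1-δ ∑χ≡0 ⟩
      (+ q - 1ℤ) + 0ℤ                       ≡⟨ ℤₚ.+-identityʳ _ ⟩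
      + q - 1ℤ                              ∎

    -- A strict total order carried over from the enumeration; it selects one element from every
    -- two-element orbit of an involution.
    before : F → F → ℤ
    before x y = if toℕ (index x) <ᵇ toℕ (index y) then 1ℤ else 0ℤ

    before-< : ∀ {x y} → toℕ (index x) ℕ.< toℕ (index y) → before x y ≡ 1ℤ
    before-< {x} {y} x<y with toℕ (index x) <ᵇ toℕ (index y) | ℕₚ.<⇒<ᵇ x<y
    ... | true | _ = refl

    before-≮ : ∀ {x y} → ¬ (toℕ (index x) ℕ.< toℕ (index y)) → before x y ≡ 0ℤ
    before-≮ {x} {y} x≮y with toℕ (index x) <ᵇ toℕ (index y) in eq
    ... | true  = ⊥-elim (x≮y (ℕₚ.<ᵇ⇒< _ _ (subst T (sym eq) tt)))
    ... | false = refl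

    trichotomy : ∀ x y → (δ x y + before x y) + before y x ≡ 1ℤ
    trichotomy x y with ℕₚ.<-cmp (toℕ (index x)) (toℕ (index y))
    ... | tri< x<y x≢y y≮x = cong₂ _+_ (cong₂ _+_ (δ-≢ (λ y≡x → x≢y (cong (toℕ ∘ index) (sym y≡x)))) (before-< {x} {y} x<y)) (before-≮ {y} {x} y≮x)
    ... | tri> x≮y x≢y y<x = cong₂ _+_ (cong₂ _+_ (δ-≢ (λ y≡x → x≢y (cong (toℕ ∘ index) (sym y≡x)))) (before-≮ {x} {y} x≮y)) (before-< {y} {x} y<x)
    ... | tri≈ x≮y x≡y y≮x = cong₂ _+_ (cong₂ _+_ (trans (cong (δ x) (index-injective (Finₚ.toℕ-injective (sym x≡y)))) (δ-refl x)) (before-≮ {x} {y} x≮y)) (before-≮ {y} {x} y≮x)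

    -- Modulo 2 only fixed points count. The witness sums `f` over the points that precede their
    -- image; reindexing by `σ` shows that those that follow their image contribute the same.
    ∑-involution : (σ : F → F) → (∀ x → σ (σ x) ≡ x) → (f : F → ℤ) → (∀ x → f (σ x) ≡ f x) →
      ∃ λ m → ∑ f ≡ ∑ (λ x → δ x (σ x) * f x) + + 2 * m
    ∑-involution σ σσ f fσ = m , (begin
      ∑ f
        ≡⟨ ∑-cong (λ x → trans (sym (ℤₚ.*-identityˡ (f x))) (trans (cong (_* f x) (sym (trichotomy x (σ x))))
             (solve 4 (λ a b c d → ((a :+ b) :+ c) :* d := (a :* d :+ b :* d) :+ c :* d) refl (δ x (σ x)) (before x (σ x)) (before (σ x) x) (f x)))) ⟩
      ∑ (λ x → (δ x (σ x) * f x + before x (σ x) * f x) + before (σ x) x * f x)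
        ≡⟨ trans (∑-+ (λ x → δ x (σ x) * f x + before x (σ x) * f x) (λ x → before (σ x) x * f x))
                 (cong (_+ ∑ (λ x → before (σ x) x * f x)) (∑-+ (λ x → δ x (σ x) * f x) (λ x → before x (σ x) * f x))) ⟩
      (fixed + m) + ∑ (λ x → before (σ x) x * f x)
        ≡⟨ cong (λ z → (fixed + m) + z) (trans (∑-reindex (λ x → before (σ x) x * f x) σ σ σσ σσ)
             (∑-cong (λ x → cong₂ (λ u v → before u (σ x) * v) (σσ x) (fσ x)))) ⟩
      (fixed + m) + m
        ≡⟨ solve 2 (λ a b → (a :+ b) :+ b := a :+ con (+ 2) :* b) refl fixed m ⟩
      fixed + + 2 * m ∎)
      where
      fixed m : ℤ
      fixed = ∑ (λ x → δ x (σ x) * f x)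
      m = ∑ (λ x → before x (σ x) * f x)

    -- Twice the indicator is a function of `δ 0F` and `χ`, so its invariance under an involution
    -- reduces to theirs.
    squareIndicator-cong : ∀ {x y} → δ 0F x ≡ δ 0F y → χ x ≡ χ y → squareIndicator x ≡ squareIndicator y
    squareIndicator-cong {x} {y} δ≡ χ≡ = ℤₚ.*-cancelˡ-≡ (+ 2) (squareIndicator x) (squareIndicator y)
      (trans (squareIndicator-χ x) (trans (cong₂ (λ a b → (1ℤ - a) + b) δ≡ χ≡) (sym (squareIndicator-χ y))))

    squareIndicator-0 : squareIndicator 0F ≡ 0ℤ
    squareIndicator-0 rewrite ==-refl 0F = refl

    ⊖-nonzero : ∀ {x} → x ≢ 0F → ⊖ x ≢ 0F
    ⊖-nonzero {x} x≢0 eq = x≢0 (trans (sym (⊖-involutive x)) (trans (cong ⊖_ eq) ⊖0≡0))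

    δ-0-cong : ∀ (σ : F → F) → σ 0F ≡ 0F → (∀ {x} → x ≢ 0F → σ x ≢ 0F) → ∀ x → δ 0F (σ x) ≡ δ 0F x
    δ-0-cong σ σ0 σ≢0 x with x ≟F 0F
    ... | yes refl = cong (δ 0F) σ0
    ... | no  x≢0  = trans (δ-≢ (σ≢0 x≢0)) (sym (δ-≢ x≢0))

    χ-⊖ : ∀ x → χ (⊖ x) ≡ χ (⊖ 1F) * χ x
    χ-⊖ x = trans (cong χ (sym (-1⊛x≡⊖x x))) (χ-* (⊖ 1F) x)

    -- If χ (−1) = 1, then negation is an involution of the squares without fixed points.
    χ-1≡1⇒q : χ (⊖ 1F) ≡ 1ℤ → ∃ λ m → + q ≡ + 1 + + 4 * m
    χ-1≡1⇒q χ-1 = m , (begin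
      + q                         ≡⟨ solve 1 (λ n → n := con 1ℤ :+ (n :- con 1ℤ)) refl (+ q) ⟩
      1ℤ + (+ q - 1ℤ)             ≡⟨ cong (λ z → 1ℤ + z) 2*squareCount ⟨
      1ℤ + + 2 * squareCount      ≡⟨ cong (λ z → 1ℤ + + 2 * z) (trans (proj₂ involution) (cong (_+ + 2 * m) noFixedPoint)) ⟩
      1ℤ + + 2 * (0ℤ + + 2 * m)   ≡⟨ solve 1 (λ n → con 1ℤ :+ con (+ 2) :* (con 0ℤ :+ con (+ 2) :* n) := con 1ℤ :+ con (+ 4) :* n) refl m ⟩
      1ℤ + + 4 * m                ∎)
      where
      involution = ∑-involution ⊖_ ⊖-involutive squareIndicator
        (λ x → squareIndicator-cong (δ-0-cong ⊖_ ⊖0≡0 ⊖-nonzero x)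
          (trans (χ-⊖ x) (trans (cong (_* χ x) χ-1) (ℤₚ.*-identityˡ (χ x)))))
      m = proj₁ involution
      vanish : ∀ x → δ x (⊖ x) * squareIndicator x ≡ 0ℤ
      vanish x with x ≟F 0F
      -- Negation does fix 0, but 0 does not belong to `H`.
      ... | yes refl = trans (cong (δ 0F (⊖ 0F) *_) squareIndicator-0) (ℤₚ.*-zeroʳ (δ 0F (⊖ 0F)))
      ... | no  x≢0  = trans (cong (_* squareIndicator x) (δ-≢ (x≢⊖x x≢0 ∘ sym))) (ℤₚ.*-zeroˡ (squareIndicator x))
      noFixedPoint : ∑ (λ x → δ x (⊖ x) * squareIndicator x) ≡ 0ℤ
      noFixedPoint = trans (∑-cong vanish) (trans (∑-const 0ℤ) (ℤₚ.*-zeroʳ (+ q)))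

    -- If χ (−1) = −1, then inversion is an involution of the squares with 1 as its only fixed point.
    χ-1≡-1⇒q : χ (⊖ 1F) ≡ -1ℤ → ∃ λ m → + q ≡ + 3 + + 4 * m
    χ-1≡-1⇒q χ-1 = m , (begin
      + q                         ≡⟨ solve 1 (λ n → n := con 1ℤ :+ (n :- con 1ℤ)) refl (+ q) ⟩
      1ℤ + (+ q - 1ℤ)             ≡⟨ cong (λ z → 1ℤ + z) 2*squareCount ⟨
      1ℤ + + 2 * squareCount      ≡⟨ cong (λ z → 1ℤ + + 2 * z) (trans (proj₂ involution) (cong (_+ + 2 * m) oneFixedPoint)) ⟩
      1ℤ + + 2 * (1ℤ + + 2 * m)   ≡⟨ solve 1 (λ n → con 1ℤ :+ con (+ 2) :* (con 1ℤ :+ con (+ 2) :* n) := con (+ 3) :+ con (+ 4) :* n) refl m ⟩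
      + 3 + + 4 * m               ∎)
      where
      χ-inv : ∀ x → χ (inv x) ≡ χ x
      χ-inv x with x ≟F 0F
      ... | yes refl = cong χ inv-0
      ... | no  x≢0  = begin
        χ (inv x)                 ≡⟨ cong χ (⊛-cancel-inv (inv x) x≢0) ⟨
        χ (x ⊛ (inv x ⊛ inv x))   ≡⟨ χ-* x (inv x ⊛ inv x) ⟩
        χ x * χ (inv x ⊛ inv x)   ≡⟨ cong (χ x *_) (χ-square (inv x) (inv-nonzero x≢0) refl) ⟩
        χ x * 1ℤ                  ≡⟨ ℤₚ.*-identityʳ (χ x) ⟩
        χ x                       ∎
      involution = ∑-involution inv inv-involutive squareIndicator
        (λ x → squareIndicator-cong (δ-0-cong inv inv-0 inv-nonzero x) (χ-inv x))
      m = proj₁ involution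
      1⊛1≡1 = ⊛-identityˡ 1F
      squareIndicator-1 : squareIndicator 1F ≡ 1ℤ
      squareIndicator-1 rewrite isNonzeroSquare-square 1F 1≢0 1⊛1≡1 = refl
      squareIndicator--1 : squareIndicator (⊖ 1F) ≡ 0ℤ
      squareIndicator--1 = ℤₚ.*-cancelˡ-≡ (+ 2) (squareIndicator (⊖ 1F)) 0ℤ (trans (squareIndicator-χ (⊖ 1F))
        (cong₂ (λ a b → (1ℤ - a) + b) (δ-≢ (⊖-nonzero 1≢0)) χ-1))
      inv-1 : inv 1F ≡ 1F
      inv-1 = trans (sym (⊛-identityˡ _)) (inv-inverseʳ 1≢0)
      fixedPoint : ∀ x → δ x (inv x) * squareIndicator x ≡ δ 1F x
      fixedPoint x with x ≟F 0F
      ... | yes refl = trans (cong (δ 0F (inv 0F) *_) squareIndicator-0) (trans (ℤₚ.*-zeroʳ (δ 0F (inv 0F))) (sym (δ-≢ 0≢1)))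
      ... | no  x≢0 with x ≟F 1F
      ...   | yes refl = trans (cong₂ _*_ (trans (cong (δ 1F) inv-1) (δ-refl 1F)) squareIndicator-1) (sym (δ-refl 1F))
      -- The other fixed point of inversion among the nonzero elements is -1, which is a nonsquare
      -- by hypothesis and so is not counted.
      ...   | no  x≢1 with x ≟F (⊖ 1F)
      ...     | yes refl = trans (cong (δ (⊖ 1F) (inv (⊖ 1F)) *_) squareIndicator--1) (trans (ℤₚ.*-zeroʳ (δ (⊖ 1F) (inv (⊖ 1F)))) (sym (δ-≢ x≢1)))
      ...     | no  x≢-1 = trans (cong (_* squareIndicator x) (δ-≢ inv≢)) (trans (ℤₚ.*-zeroˡ (squareIndicator x)) (sym (δ-≢ x≢1)))
        where
        inv≢ : inv x ≢ x
        inv≢ eq with square-injective-up-to-sign x 1F (trans (cong (x ⊛_) (sym eq)) (trans (inv-inverseʳ x≢0) (sym 1⊛1≡1)))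
        ... | inj₁ x≡1  = x≢1 x≡1
        ... | inj₂ x≡-1 = x≢-1 x≡-1
      oneFixedPoint : ∑ (λ x → δ x (inv x) * squareIndicator x) ≡ 1ℤ
      oneFixedPoint = trans (∑-cong fixedPoint) (∑-δ-1 1F)

    χ-1-cases : χ (⊖ 1F) ≡ 1ℤ ⊎ χ (⊖ 1F) ≡ -1ℤ
    χ-1-cases with squareClass (⊖ 1F)
    ... | isZero′ -1≡0       = ⊥-elim (⊖-nonzero 1≢0 -1≡0)
    ... | isSquare r r≢0 eq  = inj₁ (χ-square r r≢0 eq)
    ... | isNonsquare ≢0 ≢²  = inj₂ (χ-nonsquare ≢0 ≢²)

  -- Integer sums along antidiagonals and lists

  antidiagonalℤ : (ℕ → ℕ → ℤ) → ℕ → ℤ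
  antidiagonalℤ = antidiagonal _+_ 0ℤ

  module _ where
    open +-*-Solver using (solve; _:=_; _:+_; _:-_; con)

    antidiagonalℤ-+ : (f g : ℕ → ℕ → ℤ) → ∀ k →
      antidiagonalℤ (λ j m → f j m + g j m) k ≡ antidiagonalℤ f k + antidiagonalℤ g k
    antidiagonalℤ-+ f g zero    = refl
    antidiagonalℤ-+ f g (suc k) = trans (cong (λ z → (f 0 k + g 0 k) + z) (antidiagonalℤ-+ (f ∘ suc) (g ∘ suc) k))
      (solve 4 (λ a b c d → (a :+ b) :+ (c :+ d) := (a :+ c) :+ (b :+ d)) refl (f 0 k) (g 0 k) _ _)

    antidiagonalℤ-0 : (f : ℕ → ℕ → ℤ) → (∀ j m → f j m ≡ 0ℤ) → ∀ k → antidiagonalℤ f k ≡ 0ℤ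
    antidiagonalℤ-0 f f0 zero    = refl
    antidiagonalℤ-0 f f0 (suc k) = cong₂ _+_ (f0 0 k) (antidiagonalℤ-0 (f ∘ suc) (f0 ∘ suc) k)

    -- Adapted to the recursion of `signed`, which subtracts nothing in degree 0; the antidiagonal
    -- of the subtracted terms is therefore shorter by one.
    antidiagonalℤ-difference : (f g h : ℕ → ℕ → ℤ) → (∀ j → f j 0 ≡ g j 0) →
      (∀ j m → f j (suc m) ≡ g j (suc m) - h j m) → ∀ k →
      antidiagonalℤ f (suc k) ≡ antidiagonalℤ g (suc k) - antidiagonalℤ h k
    antidiagonalℤ-difference f g h f0 fs zero    = trans (cong (_+ 0ℤ) (f0 0)) (sym (ℤₚ.+-identityʳ _))
    antidiagonalℤ-difference f g h f0 fs (suc k) =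
      trans (cong₂ _+_ (fs 0 k) (antidiagonalℤ-difference (f ∘ suc) (g ∘ suc) (h ∘ suc) (f0 ∘ suc) (fs ∘ suc) k))
        (solve 4 (λ a b c d → (a :- b) :+ (c :- d) := (a :+ c) :- (b :+ d)) refl (g 0 (suc k)) (h 0 k)
          (antidiagonalℤ (g ∘ suc) (suc k)) (antidiagonalℤ (h ∘ suc) k))

  open ListSum ℤₚ.+-*-isCommutativeRing
    using (sumOver; sumOver-cong; sumOver-++; sumOver-map; sumOver-filter; sumOver-+; sumOver-*ˡ)

  sumOver-- : {X : Set} (f g : X → ℤ) → ∀ xs → sumOver (λ x → f x - g x) xs ≡ sumOver f xs - sumOver g xs
  sumOver-- f g xs = trans (sumOver-+ f (λ x → - g x) xs) (cong (λ z → sumOver f xs + z)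
    (trans (sumOver-cong (λ x → sym (ℤₚ.-1*i≡-i (g x))) xs) (trans (sumOver-*ˡ -1ℤ g xs) (ℤₚ.-1*i≡-i (sumOver g xs)))))

  sumOver-1 : {X : Set} (xs : List X) → sumOver (λ _ → 1ℤ) xs ≡ + length xs
  sumOver-1 []       = refl
  sumOver-1 (x ∷ xs) = cong (λ z → 1ℤ + z) (sumOver-1 xs)

  -- Signed subset counts and Newton's identities

  module SubsetSums {q : ℕ} (K : FiniteField q) where
    open FiniteField K
    open FieldSum K
    open FieldArithmetic K
    open ≡-Reasoning
    open +-*-Solver using (solve; _:=_; _:+_; _:*_; _:-_; con)

    -- (−1)ᵏ times the number of k-element sublists of the list with sum x.
    signed : List F → ℕ → F → ℤ
    signed L       zero    x = δ 0F x
    signed []      (suc k) x = 0ℤ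
    signed (h ∷ L) (suc k) x = signed L (suc k) x - signed L k (x ⊝ h)

    -- The index `j` stands for the power sum of degree j + 1, since `antidiagonal` counts from 0.
    powerSum : List F → (F → ℤ) → ℕ → F → ℤ
    powerSum L f j x = sumOver (λ h → f (x ⊝ fromℕF (suc j) ⊛ h)) L

    ⊝-⊕ : ∀ x a b → x ⊝ (a ⊕ b) ≡ (x ⊝ a) ⊝ b
    ⊝-⊕ x a b = trans (cong (x ⊕_) (sym (⊖-⊕-comm a b))) (sym (⊕-assoc _ _ _))

    ⊝-comm : ∀ x a b → (x ⊝ a) ⊝ b ≡ (x ⊝ b) ⊝ a
    ⊝-comm x a b = trans (sym (⊝-⊕ x a b)) (trans (cong (x ⊝_) (⊕-comm a b)) (⊝-⊕ x b a))

    ⊝-suc : ∀ x h j → x ⊝ fromℕF (suc j) ⊛ h ≡ (x ⊝ h) ⊝ fromℕF j ⊛ h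
    ⊝-suc x h j = trans (cong (x ⊝_) (trans (⊛-distribʳ h 1F (fromℕF j)) (cong (_⊕ fromℕF j ⊛ h) (⊛-identityˡ h)))) (⊝-⊕ x h _)

    ⊝-zero : ∀ x h → x ⊝ fromℕF 0 ⊛ h ≡ x
    ⊝-zero x h = trans (cong (x ⊝_) (⊛-zeroˡ h)) (trans (cong (x ⊕_) ⊖0≡0) (⊕-identityʳ x))

    -- (1 − hT)⁻¹ = ∑ hʲTʲ
    signed-geometric : ∀ h L k y → antidiagonalℤ (λ j m → signed (h ∷ L) m (y ⊝ fromℕF j ⊛ h)) (suc k) ≡ signed L k y
    signed-geometric h L zero    y = trans (ℤₚ.+-identityʳ _) (cong (δ 0F) (⊝-zero y h))
    signed-geometric h L (suc k) y = begin
      signed (h ∷ L) (suc k) (y ⊝ fromℕF 0 ⊛ h) + antidiagonalℤ (λ j m → signed (h ∷ L) m (y ⊝ fromℕF (suc j) ⊛ h)) (suc k)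
        ≡⟨ cong₂ _+_ (cong (signed (h ∷ L) (suc k)) (⊝-zero y h))
             (antidiagonal-cong _+_ 0ℤ _ _ (suc k) (λ j m _ → cong (signed (h ∷ L) m) (⊝-suc y h j))) ⟩
      (signed L (suc k) y - signed L k (y ⊝ h)) + antidiagonalℤ (λ j m → signed (h ∷ L) m ((y ⊝ h) ⊝ fromℕF j ⊛ h)) (suc k)
        ≡⟨ cong (λ z → (signed L (suc k) y - signed L k (y ⊝ h)) + z) (signed-geometric h L k (y ⊝ h)) ⟩
      (signed L (suc k) y - signed L k (y ⊝ h)) + signed L k (y ⊝ h)
        ≡⟨ solve 2 (λ a b → (a :- b) :+ b := a) refl (signed L (suc k) y) (signed L k (y ⊝ h)) ⟩
      signed L (suc k) y ∎

    -- Induction on the list: adjoining h multiplies the generating series ∑ eₖ Tᵏ by 1 - h T. In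
    -- the convolution with the power sums, the powers of h (`own`) form a geometric series that
    -- cancels this factor and leaves a shifted term of the old series. The powers of the old
    -- elements (`others`) give a difference, and the whole becomes the difference of two instances
    -- of the induction hypothesis, in degree k + 1 at x and in degree k at x - h.
    newton : ∀ L k x → + k * signed L k x + antidiagonalℤ (λ j m → powerSum L (signed L m) j x) k ≡ 0ℤ
    newton L       zero    x = trans (ℤₚ.+-identityʳ _) (ℤₚ.*-zeroˡ (δ 0F x))
    newton []      (suc k) x = cong₂ _+_ (ℤₚ.*-zeroʳ (+ suc k)) (antidiagonalℤ-0 _ (λ _ _ → refl) (suc k))
    newton (h ∷ L) (suc k) x = begin
      + suc k * (s₁ - s₀) + antidiagonalℤ (λ j m → powerSum (h ∷ L) (signed (h ∷ L) m) j x) (suc k)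
        ≡⟨ cong (λ z → + suc k * (s₁ - s₀) + z) (trans (antidiagonalℤ-+ own others (suc k)) (cong₂ _+_ own-sum others-sum)) ⟩
      + suc k * (s₁ - s₀) + (s₀ + (a₁ - a₀))
        ≡⟨ cong (λ z → z * (s₁ - s₀) + (s₀ + (a₁ - a₀))) (ℤₚ.pos-+ 1 k) ⟩
      (1ℤ + + k) * (s₁ - s₀) + (s₀ + (a₁ - a₀))
        ≡⟨ solve 5 (λ n u v b c → (con 1ℤ :+ n) :* (u :- v) :+ (v :+ (b :- c)) := ((con 1ℤ :+ n) :* u :+ b) :- (n :* v :+ c)) refl (+ k) s₁ s₀ a₁ a₀ ⟩
      ((1ℤ + + k) * s₁ + a₁) - (+ k * s₀ + a₀)
        ≡⟨ cong₂ _-_ (trans (cong (λ z → z * s₁ + a₁) (sym (ℤₚ.pos-+ 1 k))) (newton L (suc k) x)) (newton L k (x ⊝ h)) ⟩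
      0ℤ ∎
      where
      s₁ s₀ a₁ a₀ : ℤ
      s₁ = signed L (suc k) x
      s₀ = signed L k (x ⊝ h)
      a₁ = antidiagonalℤ (λ j m → powerSum L (signed L m) j x) (suc k)
      a₀ = antidiagonalℤ (λ j m → powerSum L (signed L m) j (x ⊝ h)) k
      own others : ℕ → ℕ → ℤ
      own j m = signed (h ∷ L) m (x ⊝ fromℕF (suc j) ⊛ h)
      others j m = powerSum L (signed (h ∷ L) m) j x
      own-sum : antidiagonalℤ own (suc k) ≡ s₀
      own-sum = trans (antidiagonal-cong _+_ 0ℤ _ _ (suc k) (λ j m _ → cong (signed (h ∷ L) m) (⊝-suc x h j)))
        (signed-geometric h L k (x ⊝ h))
      others-sum : antidiagonalℤ others (suc k) ≡ a₁ - a₀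
      others-sum = antidiagonalℤ-difference others (λ j m → powerSum L (signed L m) j x) (λ j m → powerSum L (signed L m) j (x ⊝ h))
        (λ j → refl)
        (λ j m → trans (sumOver-- (λ g → signed L (suc m) (x ⊝ fromℕF (suc j) ⊛ g)) (λ g → signed L m ((x ⊝ fromℕF (suc j) ⊛ g) ⊝ h)) L) (cong (λ z → powerSum L (signed L (suc m)) j x - z)
          (sumOver-cong (λ g → cong (signed L m) (⊝-comm x (fromℕF (suc j) ⊛ g) h)) L)))
        k

    sign : ℕ → ℤ
    sign k = -1ℤ ℤ.^ k

    δ-⊝ : ∀ x h s → δ x (h ⊕ s) ≡ δ (x ⊝ h) s
    δ-⊝ x h s with s ≟F (x ⊝ h)
    ... | yes refl = trans (trans (cong (δ x) (trans (⊕-comm h _) (⊝⊕-cancel x h))) (δ-refl x)) (sym (δ-refl (x ⊝ h)))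
    ... | no  s≢   = trans (δ-≢ (λ eq → s≢ (trans (sym (⊕⊝-cancel s h)) (cong (_⊝ h) (trans (⊕-comm s h) eq))))) (sym (δ-≢ s≢))

    -- The two terms of the recursion correspond to the sublists without and with `h`; every chosen
    -- element contributes one sign.
    signed-count : ∀ L k x → signed L k x ≡ sign k * sumOver (λ S → δ x (sumF S)) (choose k L)
    signed-count L zero x with x ≟F 0F
    ... | yes refl = trans (δ-refl 0F) (cong (λ z → 1ℤ * (z + 0ℤ)) (sym (δ-refl 0F)))
    ... | no  x≢0  = trans (δ-≢ x≢0) (cong (λ z → 1ℤ * (z + 0ℤ)) (sym (δ-≢ (x≢0 ∘ sym))))
    signed-count []      (suc k) x = sym (ℤₚ.*-zeroʳ (sign (suc k)))
    signed-count (h ∷ L) (suc k) x = begin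
      signed L (suc k) x - signed L k (x ⊝ h)
        ≡⟨ cong₂ _-_ (signed-count L (suc k) x) (signed-count L k (x ⊝ h)) ⟩
      (-1ℤ * sign k) * a - sign k * b
        ≡⟨ solve 3 (λ s u v → (con -1ℤ :* s) :* u :- s :* v := (con -1ℤ :* s) :* (v :+ u)) refl (sign k) a b ⟩
      (-1ℤ * sign k) * (b + a)
        ≡⟨ cong (λ z → (-1ℤ * sign k) * (z + a)) (trans (sumOver-map (λ S → δ x (sumF S)) (h ∷_) (choose k L)) (sumOver-cong (λ S → δ-⊝ x h (sumF S)) (choose k L))) ⟨
      (-1ℤ * sign k) * (sumOver (λ S → δ x (sumF S)) (map (h ∷_) (choose k L)) + a)
        ≡⟨ cong ((-1ℤ * sign k) *_) (sumOver-++ (λ S → δ x (sumF S)) (map (h ∷_) (choose k L)) (choose (suc k) L)) ⟨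
      (-1ℤ * sign k) * sumOver (λ S → δ x (sumF S)) (choose (suc k) (h ∷ L)) ∎
      where
      a b : ℤ
      a = sumOver (λ S → δ x (sumF S)) (choose (suc k) L)
      b = sumOver (λ S → δ (x ⊝ h) (sumF S)) (choose k L)

    signed-N-H : ∀ k → signed Hlist k 0F ≡ sign k * + N-H K k
    signed-N-H k = trans (signed-count Hlist k 0F) (cong (sign k *_)
      (trans (sym (sumOver-filter (λ _ → 1ℤ) (λ S → isZero (sumF S)) (choose k Hlist))) (sumOver-1 (filterᵇ (λ S → isZero (sumF S)) (choose k Hlist)))))

    -- Summation over x forgets the translations, and the recursion of `signed` becomes Pascal's
    -- rule.
    ∑-signed : ∀ L k → ∑ (signed L k) ≡ sign k * + (length L C k)
    ∑-signed []      zero    = ∑-δ-1 0F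
    ∑-signed (h ∷ L) zero    = ∑-δ-1 0F
    ∑-signed []      (suc k) = trans (trans (∑-const 0ℤ) (ℤₚ.*-zeroʳ (+ q)))
      (sym (trans (cong (λ z → sign (suc k) * + z) (k>n⇒nCk≡0 {0} {suc k} (ℕ.s≤s ℕ.z≤n))) (ℤₚ.*-zeroʳ (sign (suc k)))))
    ∑-signed (h ∷ L) (suc k) = begin
      ∑ (λ x → signed L (suc k) x - signed L k (x ⊝ h))
        ≡⟨ ∑-- (signed L (suc k)) (λ x → signed L k (x ⊝ h)) ⟩
      ∑ (signed L (suc k)) - ∑ (λ x → signed L k (x ⊝ h))
        ≡⟨ cong₂ _-_ (∑-signed L (suc k)) (trans (sym (∑-translate⁻ h (signed L k))) (∑-signed L k)) ⟩
      (-1ℤ * sign k) * + (length L C suc k) - sign k * + (length L C k)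
        ≡⟨ solve 3 (λ s u v → (con -1ℤ :* s) :* u :- s :* v := (con -1ℤ :* s) :* (v :+ u)) refl (sign k) (+ (length L C suc k)) (+ (length L C k)) ⟩
      (-1ℤ * sign k) * (+ (length L C k) + + (length L C suc k))
        ≡⟨ cong ((-1ℤ * sign k) *_) (trans (sym (ℤₚ.pos-+ (length L C k) (length L C suc k))) (cong +_ (nCk+nC[k+1]≡[n+1]C[k+1] (length L) k))) ⟩
      (-1ℤ * sign k) * + (suc (length L) C suc k) ∎

    open SemiringSum ℤₚ.+-*-semiring using (sum)

    sumOver-Hlist : (f : F → ℤ) → sumOver f Hlist ≡ ∑ (λ x → squareIndicator x * f x)
    sumOver-Hlist f = begin
      sumOver f Hlist
        ≡⟨ sumOver-filter f isNonzeroSquare elems ⟩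
      sumOver (λ x → if isNonzeroSquare x then f x else 0ℤ) elems
        ≡⟨ sumOver-map (λ x → if isNonzeroSquare x then f x else 0ℤ) from (allFin q) ⟩
      sumOver (λ i → if isNonzeroSquare (from i) then f (from i) else 0ℤ) (allFin q)
        ≡⟨ go (λ i → if isNonzeroSquare (from i) then f (from i) else 0ℤ) id ⟩
      ∑ (λ x → if isNonzeroSquare x then f x else 0ℤ)
        ≡⟨ ∑-cong pointwise ⟩
      ∑ (λ x → squareIndicator x * f x) ∎
      where
      go : ∀ {m n} (g : Fin m → ℤ) (t : Fin n → Fin m) → sumOver g (tabulate t) ≡ sum {n} (g ∘ t)
      go {n = zero}  g t = refl
      go {n = suc n} g t = cong (λ z → g (t Fin.zero) + z) (go g (t ∘ Fin.suc))
      pointwise : ∀ x → (if isNonzeroSquare x then f x else 0ℤ) ≡ squareIndicator x * f x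
      pointwise x with isNonzeroSquare x
      ... | true  = sym (ℤₚ.*-identityˡ (f x))
      ... | false = sym (ℤₚ.*-zeroˡ (f x))

    length-Hlist : + length Hlist ≡ ∑ squareIndicator
    length-Hlist = trans (sym (sumOver-1 Hlist)) (trans (sumOver-Hlist (λ _ → 1ℤ)) (∑-cong (λ x → ℤₚ.*-identityʳ (squareIndicator x))))

  -- The action of translation sums on α and β

  module Functionals {q : ℕ} (K : FiniteField q) (2≢0 : FiniteField.fromℕF K 2 ≢ FiniteField.0F K) where
    open FiniteField K
    open FieldSum K
    open FieldArithmetic K
    open SubsetSums K
    open OddCharacteristic K 2≢0
    open ≡-Reasoning
    open +-*-Solver using (solve; _:=_; _:+_; _:*_; _:-_; con)

    -- For the nontrivial additive characters ψ_b, the average of ∑ f(x) ψ_b(x)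
    -- over the nonzero squares b is (α f + β f · G) / (q − 1) with G the Gauss
    -- sum: α and β encode it without roots of unity.
    α β : (F → ℤ) → ℤ
    α f = + q * f 0F - ∑ f
    β f = ∑ (λ x → χ x * f x)

    χ-inv-⊛ : ∀ {c} z → c ≢ 0F → χ (inv c ⊛ z) ≡ χ c * χ z
    χ-inv-⊛ {c} z c≢0 = begin
      χ (inv c ⊛ z)               ≡⟨ ℤₚ.*-identityˡ _ ⟨
      1ℤ * χ (inv c ⊛ z)          ≡⟨ cong (_* χ (inv c ⊛ z)) (χ-²-nonzero c≢0) ⟨
      (χ c * χ c) * χ (inv c ⊛ z) ≡⟨ ℤₚ.*-assoc (χ c) (χ c) _ ⟩
      χ c * (χ c * χ (inv c ⊛ z)) ≡⟨ cong (χ c *_) (χ-* c (inv c ⊛ z)) ⟨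
      χ c * χ (c ⊛ (inv c ⊛ z))   ≡⟨ cong (λ w → χ c * χ w) (⊛-cancel-inv z c≢0) ⟩
      χ c * χ z                   ∎

    ⊝0 : ∀ x → x ⊝ 0F ≡ x
    ⊝0 x = trans (cong (x ⊕_) ⊖0≡0) (⊕-identityʳ x)

    -- The sum of the translations by c h with h in `H`, written over the whole field so that
    -- `squareIndicator-χ` applies.
    shiftSum : F → (F → ℤ) → F → ℤ
    shiftSum c f x = ∑ (λ z → squareIndicator z * f (x ⊝ c ⊛ z))

    -- Convolution with χ, in the role of the Gauss sum: `∑-twist` and `twist-0` give α(twist f) = D
    -- β(f) with D = χ(-1) q, and `β-twist` gives β(twist f) = α(f), which is multiplication by √D
    -- on α + β √D.
    twist : (F → ℤ) → F → ℤ
    twist f x = ∑ (λ z → χ z * f (x ⊝ z))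

    ∑-reflect : ∀ x (f : F → ℤ) → ∑ f ≡ ∑ (λ z → f (x ⊝ z))
    ∑-reflect x f = ∑-reindex f (x ⊝_) (x ⊝_) (⊝-⊝-cancel x) (⊝-⊝-cancel x)

    -- In the expansion of the indicator of `H` the constant gives ∑ f and the δ gives f(x). In the
    -- χ part the dilation by c can be undone at the cost of a factor χ(c).
    2*shiftSum : ∀ {c} → c ≢ 0F → ∀ f x → + 2 * shiftSum c f x ≡ (∑ f - f x) + χ c * twist f x
    2*shiftSum {c} c≢0 f x = begin
      + 2 * shiftSum c f x
        ≡⟨ ∑-*ˡ (+ 2) (λ z → squareIndicator z * g z) ⟨
      ∑ (λ z → + 2 * (squareIndicator z * g z))
        ≡⟨ ∑-cong (λ z → trans (sym (ℤₚ.*-assoc (+ 2) (squareIndicator z) (g z))) (trans (cong (_* g z) (squareIndicator-χ z))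
             (solve 3 (λ d e u → ((con 1ℤ :- d) :+ e) :* u := (u :- d :* u) :+ e :* u) refl (δ 0F z) (χ z) (g z)))) ⟩
      ∑ (λ z → (g z - δ 0F z * g z) + χ z * g z)
        ≡⟨ trans (∑-+ (λ z → g z - δ 0F z * g z) (λ z → χ z * g z)) (cong (_+ ∑ (λ z → χ z * g z)) (∑-- g (λ z → δ 0F z * g z))) ⟩
      (∑ g - ∑ (λ z → δ 0F z * g z)) + ∑ (λ z → χ z * g z)
        ≡⟨ cong₂ _+_ (cong₂ _-_ ∑g (trans (∑-δ 0F g) (cong f (trans (cong (x ⊝_) (⊛-zeroʳ c)) (⊝0 x))))) ∑χg ⟩
      (∑ f - f x) + χ c * twist f x ∎
      where
      g : F → ℤ
      g z = f (x ⊝ c ⊛ z)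
      ∑g : ∑ g ≡ ∑ f
      ∑g = sym (trans (∑-reflect x f) (∑-scale c≢0 (λ z → f (x ⊝ z))))
      ∑χg : ∑ (λ z → χ z * g z) ≡ χ c * twist f x
      ∑χg = begin
        ∑ (λ z → χ z * g z)
          ≡⟨ ∑-cong (λ z → cong (λ w → χ w * g z) (inv-cancel-⊛ z c≢0)) ⟨
        ∑ (λ z → χ (inv c ⊛ (c ⊛ z)) * f (x ⊝ c ⊛ z))
          ≡⟨ ∑-scale c≢0 (λ z → χ (inv c ⊛ z) * f (x ⊝ z)) ⟨
        ∑ (λ z → χ (inv c ⊛ z) * f (x ⊝ z))
          ≡⟨ ∑-cong (λ z → trans (cong (_* f (x ⊝ z)) (χ-inv-⊛ z c≢0)) (ℤₚ.*-assoc (χ c) (χ z) _)) ⟩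
        ∑ (λ z → χ c * (χ z * f (x ⊝ z)))
          ≡⟨ ∑-*ˡ (χ c) (λ z → χ z * f (x ⊝ z)) ⟩
        χ c * twist f x ∎

    ∑-twist : ∀ f → ∑ (twist f) ≡ 0ℤ
    ∑-twist f = begin
      ∑ (λ x → ∑ (λ z → χ z * f (x ⊝ z))) ≡⟨ ∑-swap (λ x z → χ z * f (x ⊝ z)) ⟩
      ∑ (λ z → ∑ (λ x → χ z * f (x ⊝ z))) ≡⟨ ∑-cong (λ z → trans (∑-*ˡ (χ z) (λ x → f (x ⊝ z))) (cong (χ z *_) (sym (∑-translate⁻ z f)))) ⟩
      ∑ (λ z → χ z * ∑ f)                 ≡⟨ ∑-*ʳ (∑ f) χ ⟩
      ∑ χ * ∑ f                           ≡⟨ cong (_* ∑ f) ∑χ≡0 ⟩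
      0ℤ * ∑ f                            ≡⟨ ℤₚ.*-zeroˡ (∑ f) ⟩
      0ℤ                                  ∎

    twist-0 : ∀ f → twist f 0F ≡ χ (⊖ 1F) * β f
    twist-0 f = begin
      ∑ (λ z → χ z * f (0F ⊝ z))             ≡⟨ ∑-reflect 0F (λ z → χ z * f (0F ⊝ z)) ⟩
      ∑ (λ z → χ (0F ⊝ z) * f (0F ⊝ (0F ⊝ z))) ≡⟨ ∑-cong (λ z → trans (cong₂ (λ u v → χ u * f v) (⊕-identityˡ (⊖ z)) (⊝-⊝-cancel 0F z))
                                                    (trans (cong (_* f z) (χ-⊖ z)) (ℤₚ.*-assoc (χ (⊖ 1F)) (χ z) (f z)))) ⟩
      ∑ (λ z → χ (⊖ 1F) * (χ z * f z))       ≡⟨ ∑-*ˡ (χ (⊖ 1F)) (λ z → χ z * f z) ⟩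
      χ (⊖ 1F) * β f                         ∎

    -- After the substitution x = y + z the coefficient of f(y) is the correlation at y, that is q δ
    -- - 1. This takes the place of the evaluation of G².
    β-twist : ∀ f → β (twist f) ≡ α f
    β-twist f = begin
      ∑ (λ x → χ x * ∑ (λ z → χ z * f (x ⊝ z)))
        ≡⟨ ∑-cong (λ x → sym (∑-*ˡ (χ x) (λ z → χ z * f (x ⊝ z)))) ⟩
      ∑ (λ x → ∑ (λ z → χ x * (χ z * f (x ⊝ z))))
        ≡⟨ ∑-swap (λ x z → χ x * (χ z * f (x ⊝ z))) ⟩
      ∑ (λ z → ∑ (λ x → χ x * (χ z * f (x ⊝ z))))
        ≡⟨ ∑-cong (λ z → trans (∑-translate z (λ x → χ x * (χ z * f (x ⊝ z))))
             (∑-cong (λ y → trans (cong (λ w → χ (y ⊕ z) * (χ z * f w)) (⊕⊝-cancel y z))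
               (solve 3 (λ a b c → a :* (b :* c) := c :* (b :* a)) refl (χ (y ⊕ z)) (χ z) (f y))))) ⟩
      ∑ (λ z → ∑ (λ y → f y * (χ z * χ (y ⊕ z))))
        ≡⟨ ∑-swap (λ z y → f y * (χ z * χ (y ⊕ z))) ⟩
      ∑ (λ y → ∑ (λ z → f y * (χ z * χ (y ⊕ z))))
        ≡⟨ ∑-cong (λ y → trans (∑-*ˡ (f y) (λ z → χ z * χ (y ⊕ z))) (trans (cong (f y *_) (correlation-value y))
             (solve 3 (λ a n d → a :* (n :* d :- con 1ℤ) := n :* (d :* a) :- a) refl (f y) (+ q) (δ 0F y)))) ⟩
      ∑ (λ y → + q * (δ 0F y * f y) - f y)
        ≡⟨ ∑-- (λ y → + q * (δ 0F y * f y)) f ⟩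
      ∑ (λ y → + q * (δ 0F y * f y)) - ∑ f
        ≡⟨ cong (_- ∑ f) (trans (∑-*ˡ (+ q) (λ y → δ 0F y * f y)) (cong (+ q *_) (∑-δ 0F f))) ⟩
      α f ∎

    -- Together with `2β-shiftSum` this says that `shiftSum c` multiplies α + β √D by (-1 + χ(c)
    -- √D)/2, where D = χ(-1) q.
    2α-shiftSum : ∀ {c} → c ≢ 0F → ∀ f → + 2 * α (shiftSum c f) ≡ - α f + χ c * ((χ (⊖ 1F) * + q) * β f)
    2α-shiftSum {c} c≢0 f = begin
      + 2 * (+ q * shiftSum c f 0F - ∑ (shiftSum c f))
        ≡⟨ solve 3 (λ n a b → con (+ 2) :* (n :* a :- b) := n :* (con (+ 2) :* a) :- con (+ 2) :* b) refl (+ q) (shiftSum c f 0F) (∑ (shiftSum c f)) ⟩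
      + q * (+ 2 * shiftSum c f 0F) - + 2 * ∑ (shiftSum c f)
        ≡⟨ cong₂ (λ a b → + q * a - b) (trans (2*shiftSum c≢0 f 0F) (cong (λ w → (∑ f - f 0F) + χ c * w) (twist-0 f))) total ⟩
      + q * ((∑ f - f 0F) + χ c * (χ (⊖ 1F) * β f)) - (+ q * ∑ f - ∑ f)
        ≡⟨ solve 6 (λ n s a e g b → n :* ((s :- a) :+ e :* (g :* b)) :- (n :* s :- s) := (con 0ℤ :- (n :* a :- s)) :+ e :* ((g :* n) :* b)) refl
             (+ q) (∑ f) (f 0F) (χ c) (χ (⊖ 1F)) (β f) ⟩
      (0ℤ - α f) + χ c * ((χ (⊖ 1F) * + q) * β f)
        ≡⟨ cong (_+ χ c * ((χ (⊖ 1F) * + q) * β f)) (ℤₚ.+-identityˡ (- α f)) ⟩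
      - α f + χ c * ((χ (⊖ 1F) * + q) * β f) ∎
      where
      total : + 2 * ∑ (shiftSum c f) ≡ + q * ∑ f - ∑ f
      total = begin
        + 2 * ∑ (shiftSum c f)
          ≡⟨ ∑-*ˡ (+ 2) (shiftSum c f) ⟨
        ∑ (λ x → + 2 * shiftSum c f x)
          ≡⟨ ∑-cong (2*shiftSum c≢0 f) ⟩
        ∑ (λ x → (∑ f - f x) + χ c * twist f x)
          ≡⟨ trans (∑-+ (λ x → ∑ f - f x) (λ x → χ c * twist f x)) (cong₂ _+_ (∑-- (λ _ → ∑ f) f) (∑-*ˡ (χ c) (twist f))) ⟩
        (∑ (λ _ → ∑ f) - ∑ f) + χ c * ∑ (twist f)
          ≡⟨ cong₂ (λ a b → (a - ∑ f) + χ c * b) (∑-const (∑ f)) (∑-twist f) ⟩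
        (+ q * ∑ f - ∑ f) + χ c * 0ℤ
          ≡⟨ solve 2 (λ a e → a :+ e :* con 0ℤ := a) refl (+ q * ∑ f - ∑ f) (χ c) ⟩
        + q * ∑ f - ∑ f ∎

    2β-shiftSum : ∀ {c} → c ≢ 0F → ∀ f → + 2 * β (shiftSum c f) ≡ - β f + χ c * α f
    2β-shiftSum {c} c≢0 f = begin
      + 2 * ∑ (λ x → χ x * shiftSum c f x)
        ≡⟨ ∑-*ˡ (+ 2) (λ x → χ x * shiftSum c f x) ⟨
      ∑ (λ x → + 2 * (χ x * shiftSum c f x))
        ≡⟨ ∑-cong (λ x → trans (solve 2 (λ a b → con (+ 2) :* (a :* b) := a :* (con (+ 2) :* b)) refl (χ x) (shiftSum c f x))
             (trans (cong (χ x *_) (2*shiftSum c≢0 f x))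
               (solve 5 (λ a s u e t → a :* ((s :- u) :+ e :* t) := (a :* s :- a :* u) :+ e :* (a :* t)) refl (χ x) (∑ f) (f x) (χ c) (twist f x)))) ⟩
      ∑ (λ x → (χ x * ∑ f - χ x * f x) + χ c * (χ x * twist f x))
        ≡⟨ trans (∑-+ (λ x → χ x * ∑ f - χ x * f x) (λ x → χ c * (χ x * twist f x)))
             (cong₂ _+_ (∑-- (λ x → χ x * ∑ f) (λ x → χ x * f x)) (∑-*ˡ (χ c) (λ x → χ x * twist f x))) ⟩
      (∑ (λ x → χ x * ∑ f) - β f) + χ c * β (twist f)
        ≡⟨ cong₂ (λ a b → (a - β f) + χ c * b) (trans (∑-*ʳ (∑ f) χ) (trans (cong (_* ∑ f) ∑χ≡0) (ℤₚ.*-zeroˡ (∑ f)))) (β-twist f) ⟩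
      (0ℤ - β f) + χ c * α f
        ≡⟨ cong (_+ χ c * α f) (ℤₚ.+-identityˡ (- β f)) ⟩
      - β f + χ c * α f ∎

    shiftSum-0 : ∀ f x → shiftSum 0F f x ≡ squareCount * f x
    shiftSum-0 f x = trans (∑-cong (λ z → cong (λ w → squareIndicator z * f w) (trans (cong (x ⊝_) (⊛-zeroˡ z)) (⊝0 x)))) (∑-*ʳ (f x) squareIndicator)

    α-cong : ∀ {f g} → (∀ x → f x ≡ g x) → α f ≡ α g
    α-cong eq = cong₂ (λ a b → + q * a - b) (eq 0F) (∑-cong eq)

    β-cong : ∀ {f g} → (∀ x → f x ≡ g x) → β f ≡ β g
    β-cong eq = ∑-cong (λ x → cong (χ x *_) (eq x))

    α-* : ∀ c f → α (λ x → c * f x) ≡ c * α f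
    α-* c f = trans (cong (λ z → + q * (c * f 0F) - z) (∑-*ˡ c f))
      (solve 4 (λ n c a s → n :* (c :* a) :- c :* s := c :* (n :* a :- s)) refl (+ q) c (f 0F) (∑ f))

    β-* : ∀ c f → β (λ x → c * f x) ≡ c * β f
    β-* c f = trans (∑-cong (λ x → solve 3 (λ a b d → a :* (b :* d) := b :* (a :* d)) refl (χ x) c (f x))) (∑-*ˡ c (λ x → χ x * f x))

    α-+ : ∀ f g → α (λ x → f x + g x) ≡ α f + α g
    α-+ f g = trans (cong (λ z → + q * (f 0F + g 0F) - z) (∑-+ f g))
      (solve 5 (λ n a b s t → n :* (a :+ b) :- (s :+ t) := (n :* a :- s) :+ (n :* b :- t)) refl (+ q) (f 0F) (g 0F) (∑ f) (∑ g))

    β-+ : ∀ f g → β (λ x → f x + g x) ≡ β f + β g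
    β-+ f g = trans (∑-cong (λ x → ℤₚ.*-distribˡ-+ (χ x) (f x) (g x))) (∑-+ (λ x → χ x * f x) (λ x → χ x * g x))

    e : ℕ → F → ℤ
    e = signed Hlist

    shiftSum-power : ∀ j f x → powerSum Hlist f j x ≡ shiftSum (fromℕF (suc j)) f x
    shiftSum-power j f x = sumOver-Hlist (λ h → f (x ⊝ fromℕF (suc j) ⊛ h))

    newton-e : ∀ k x → + k * e k x + antidiagonalℤ (λ j m → shiftSum (fromℕF (suc j)) (e m) x) k ≡ 0ℤ
    newton-e k x = trans (cong (λ z → + k * e k x + z) (antidiagonal-cong _+_ 0ℤ _ _ k (λ j m _ → sym (shiftSum-power j (e m) x)))) (newton Hlist k x)

    module _ (φ : (F → ℤ) → ℤ) (φ-cong : ∀ {f g} → (∀ x → f x ≡ g x) → φ f ≡ φ g)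
      (φ-+ : ∀ f g → φ (λ x → f x + g x) ≡ φ f + φ g) (φ-* : ∀ c f → φ (λ x → c * f x) ≡ c * φ f) where

      linear-0 : φ (λ _ → 0ℤ) ≡ 0ℤ
      linear-0 = trans (φ-* 0ℤ (λ _ → 0ℤ)) (ℤₚ.*-zeroˡ (φ (λ _ → 0ℤ)))

      linear-antidiagonal : (f : ℕ → ℕ → F → ℤ) → ∀ k →
        φ (λ x → antidiagonalℤ (λ j m → f j m x) k) ≡ antidiagonalℤ (λ j m → φ (f j m)) k
      linear-antidiagonal f zero    = linear-0
      linear-antidiagonal f (suc k) = trans (φ-+ (f 0 k) (λ x → antidiagonalℤ (λ j m → f (suc j) m x) k))
        (cong (λ z → φ (f 0 k) + z) (linear-antidiagonal (λ j → f (suc j)) k))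

      -- Newton's identities hold at every point x with integer coefficients, so they pass through
      -- any additive and ℤ-homogeneous functional.
      linear-newton : ∀ k → + k * φ (e k) + antidiagonalℤ (λ j m → φ (shiftSum (fromℕF (suc j)) (e m))) k ≡ 0ℤ
      linear-newton k = begin
        + k * φ (e k) + antidiagonalℤ (λ j m → φ (shiftSum (fromℕF (suc j)) (e m))) k
          ≡⟨ cong₂ _+_ (sym (φ-* (+ k) (e k))) (sym (linear-antidiagonal (λ j m → shiftSum (fromℕF (suc j)) (e m)) k)) ⟩
        φ (λ x → + k * e k x) + φ rest
          ≡⟨ φ-+ (λ x → + k * e k x) rest ⟨
        φ (λ x → + k * e k x + rest x)
          ≡⟨ φ-cong (newton-e k) ⟩
        φ (λ _ → 0ℤ)
          ≡⟨ linear-0 ⟩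
        0ℤ ∎
        where
        rest : F → ℤ
        rest x = antidiagonalℤ (λ j m → shiftSum (fromℕF (suc j)) (e m) x) k

    α-newton : ∀ k → + k * α (e k) + antidiagonalℤ (λ j m → α (shiftSum (fromℕF (suc j)) (e m))) k ≡ 0ℤ
    α-newton = linear-newton α α-cong α-+ α-*

    β-newton : ∀ k → + k * β (e k) + antidiagonalℤ (λ j m → β (shiftSum (fromℕF (suc j)) (e m))) k ≡ 0ℤ
    β-newton = linear-newton β β-cong β-+ β-*

    α-e-0 : α (e 0) ≡ + q - 1ℤ
    α-e-0 = cong₂ _-_ (trans (cong (+ q *_) (δ-refl 0F)) (ℤₚ.*-identityʳ (+ q))) (∑-δ-1 0F)

    β-e-0 : β (e 0) ≡ 0ℤ
    β-e-0 = trans (∑-cong (λ x → ℤₚ.*-comm (χ x) (δ 0F x))) (trans (∑-δ 0F χ) χ-0)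

  -- The characteristic of the field

  module Characteristic {q : ℕ} (K : FiniteField q) where
    open FiniteField K
    open FieldSum K
    open FieldArithmetic K
    open ≡-Reasoning
    open Over (CommutativeRing.+-commutativeMonoid fieldRing)
    open MonoidSum (CommutativeRing.+-commutativeMonoid fieldRing) using (sum; ∑-distrib-+)

    -- Translation by 1 permutes the field, so the sum of all elements equals itself plus q · 1.
    fromℕF-q : fromℕF q ≡ 0F
    fromℕF-q = sym (begin
      0F
        ≡⟨ ⊖-inverseˡ (∑F id) ⟨
      ⊖ ∑F id ⊕ ∑F id
        ≡⟨ cong (⊖ ∑F id ⊕_) (∑F-reindex id (_⊕ 1F) (_⊝ 1F) (λ x → ⊝⊕-cancel x 1F) (λ x → ⊕⊝-cancel x 1F)) ⟩
      ⊖ ∑F id ⊕ ∑F (_⊕ 1F)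
        ≡⟨ cong (⊖ ∑F id ⊕_) (trans (∑-distrib-+ from (λ _ → 1F)) (cong (∑F id ⊕_) (sum-1 q))) ⟩
      ⊖ ∑F id ⊕ (∑F id ⊕ fromℕF q)
        ≡⟨ ⊕-assoc _ _ _ ⟨
      (⊖ ∑F id ⊕ ∑F id) ⊕ fromℕF q
        ≡⟨ cong (_⊕ fromℕF q) (⊖-inverseˡ (∑F id)) ⟩
      0F ⊕ fromℕF q
        ≡⟨ ⊕-identityˡ _ ⟩
      fromℕF q ∎)
      where
      sum-1 : ∀ n → sum {n} (λ _ → 1F) ≡ fromℕF n
      sum-1 zero    = refl
      sum-1 (suc n) = cong (1F ⊕_) (sum-1 n)

    fromℕF-1≢0 : fromℕF 1 ≢ 0F
    fromℕF-1≢0 eq = 0≢1 (sym (trans (sym (⊕-identityʳ 1F)) eq))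

    -- There are no zero divisors, so from q · 1 = 0 and q = pˢ it follows that p · 1 = 0.
    fromℕF-^ : ∀ m n → fromℕF (m ^ n) ≡ 0F → fromℕF m ≡ 0F
    fromℕF-^ m zero    eq = ⊥-elim (fromℕF-1≢0 eq)
    fromℕF-^ m (suc n) eq with ⊛-zero _ _ (trans (sym (fromℕF-* m (m ^ n))) eq)
    ... | inj₁ m≡0  = m≡0
    ... | inj₂ mⁿ≡0 = fromℕF-^ m n mⁿ≡0

    module PrimeCharacteristic (p : ℕ) (p-prime : Prime p) (p≡0 : fromℕF p ≡ 0F) where

      multiple : ∀ m → fromℕF (m ℕ.* p) ≡ 0F
      multiple m = trans (fromℕF-* m p) (trans (cong (fromℕF m ⊛_) p≡0) (⊛-zeroʳ _))

      ∣⇒fromℕF≡0 : ∀ {j} → p ∣ j → fromℕF j ≡ 0F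
      ∣⇒fromℕF≡0 (divides m refl) = multiple m

      -- As p is prime, Bézout writes 1 as a difference of a multiple of p and a multiple of j. If
      -- both vanished in the field, so would 1. The two cases are the two orders of subtraction in
      -- ℕ.
      ∤⇒fromℕF≢0 : ∀ {j} → ¬ (p ∣ j) → fromℕF j ≢ 0F
      ∤⇒fromℕF≢0 {j} p∤j j≡0 with coprime-Bézout coprime
        where
        coprime : Coprime p j
        coprime {d} (d∣p , d∣j) with prime⇒irreducible p-prime d∣p
        ... | inj₁ d≡1  = d≡1
        ... | inj₂ refl = ⊥-elim (p∤j d∣j)
      ... | Bézout.+- x y eq = fromℕF-1≢0 (trans (sym (trans (fromℕF-+ 1 (y ℕ.* j))
              (trans (cong (fromℕF 1 ⊕_) (trans (fromℕF-* y j) (trans (cong (fromℕF y ⊛_) j≡0) (⊛-zeroʳ _)))) (⊕-identityʳ _))))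
              (trans (cong fromℕF eq) (multiple x)))
      ... | Bézout.-+ x y eq = fromℕF-1≢0 (trans (sym (trans (fromℕF-+ 1 (x ℕ.* p))
              (trans (cong (fromℕF 1 ⊕_) (multiple x)) (⊕-identityʳ _))))
              (trans (cong fromℕF eq) (trans (fromℕF-* y j) (trans (cong (fromℕF y ⊛_) j≡0) (⊛-zeroʳ _)))))

      fromℕF-2≢0 : p ≢ 2 → fromℕF 2 ≢ 0F
      fromℕF-2≢0 p≢2 = ∤⇒fromℕF≢0 λ p∣2 → p≢2 (ℕₚ.≤-antisym (∣⇒≤ p∣2) (ℕ.nonTrivial⇒n>1 p ⦃ prime⇒nonTrivial p-prime ⦄))

  -- Residues modulo 4 and the sign of the discriminant

  ^-%4-1 : ∀ p s → p % 4 ≡ 1 → (p ^ s) % 4 ≡ 1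
  ^-%4-1 p zero    eq = refl
  ^-%4-1 p (suc s) eq = trans (%-distribˡ-* p (p ^ s) 4) (cong₂ (λ a b → (a ℕ.* b) % 4) eq (^-%4-1 p s eq))

  -- The recursion descends by two: `suc (suc s) % 2` reduces to `s % 2`, and multiplying twice by 3
  -- changes nothing modulo 4.
  ^-%4-3 : ∀ p s → p % 4 ≡ 3 → (s % 2 ≡ 0 → (p ^ s) % 4 ≡ 1) × (s % 2 ≡ 1 → (p ^ s) % 4 ≡ 3)
  ^-%4-3 p zero          eq = (λ _ → refl) , λ ()
  ^-%4-3 p (suc zero)    eq = (λ ()) , λ _ → trans (cong (_% 4) (ℕₚ.*-identityʳ p)) eq
  ^-%4-3 p (suc (suc s)) eq = step 1 ∘ proj₁ (^-%4-3 p s eq) , step 3 ∘ proj₂ (^-%4-3 p s eq)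
    where
    twice : (p ^ suc (suc s)) % 4 ≡ (3 ℕ.* ((3 ℕ.* ((p ^ s) % 4)) % 4)) % 4
    twice = trans (%-distribˡ-* p (p ^ suc s) 4) (cong₂ (λ a b → (a ℕ.* b) % 4) eq
      (trans (%-distribˡ-* p (p ^ s) 4) (cong (λ a → (a ℕ.* ((p ^ s) % 4)) % 4) eq)))
    step : ∀ r → (p ^ s) % 4 ≡ r → (p ^ suc (suc s)) % 4 ≡ (3 ℕ.* ((3 ℕ.* r) % 4)) % 4
    step r eqr = trans twice (cong (λ r → (3 ℕ.* ((3 ℕ.* r) % 4)) % 4) eqr)

  1+4m≢3+4n : ∀ (m n : ℤ) → + 1 + + 4 * m ≢ + 3 + + 4 * n
  1+4m≢3+4n m n eq = toWitnessFalse {a? = 4 ∣? 2} _ (divides ℤ.∣ m - n ∣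
    (trans (cong ℤ.∣_∣ {x = + 2} {y = (m - n) * + 4} (begin
      + 2                               ≡⟨ solve 1 (λ b → con (+ 2) := (con (+ 3) :+ con (+ 4) :* b) :- (con 1ℤ :+ con (+ 4) :* b)) refl n ⟩
      (+ 3 + + 4 * n) - (1ℤ + + 4 * n)  ≡⟨ cong (_- (1ℤ + + 4 * n)) eq ⟨
      (+ 1 + + 4 * m) - (1ℤ + + 4 * n)  ≡⟨ solve 2 (λ a b → (con 1ℤ :+ con (+ 4) :* a) :- (con 1ℤ :+ con (+ 4) :* b) := (a :- b) :* con (+ 4)) refl m n ⟩
      (m - n) * + 4                     ∎)) (ℤₚ.abs-* (m - n) (+ 4))))
    where
    open ≡-Reasoning
    open +-*-Solver using (solve; _:=_; _:+_; _:*_; _:-_; con)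

  %4⇒ℤ : ∀ n r → n % 4 ≡ r → + n ≡ + r + + 4 * + (n / 4)
  %4⇒ℤ n r refl = trans (cong +_ (trans (m≡m%n+[m/n]*n n 4) (cong (n % 4 ℕ.+_) (ℕₚ.*-comm (n / 4) 4))))
    (trans (ℤₚ.pos-+ (n % 4) (4 ℕ.* (n / 4))) (cong (λ z → + (n % 4) + z) (ℤₚ.pos-* 4 (n / 4))))

  module MinusOne {q : ℕ} (K : FiniteField q) (2≢0 : FiniteField.fromℕF K 2 ≢ FiniteField.0F K) where
    open FiniteField K
    open FieldArithmetic K
    open OddCharacteristic K 2≢0

    -- The involutions lead from χ(-1) to q modulo 4. Since χ(-1) is 1 or -1 and the residues 1 and
    -- 3 exclude each other, the implications can be reversed.
    q%4≡1⇒χ-1 : q % 4 ≡ 1 → χ (⊖ 1F) ≡ 1ℤ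
    q%4≡1⇒χ-1 q%4 = [ id , (λ eq → ⊥-elim (impossible (χ-1≡-1⇒q eq))) ]′ χ-1-cases
      where
      impossible : ¬ (∃ λ m → + q ≡ + 3 + + 4 * m)
      impossible (m , q≡3) = 1+4m≢3+4n (+ (q / 4)) m (trans (sym (%4⇒ℤ q 1 q%4)) q≡3)

    q%4≡3⇒χ-1 : q % 4 ≡ 3 → χ (⊖ 1F) ≡ -1ℤ
    q%4≡3⇒χ-1 q%4 = [ (λ eq → ⊥-elim (impossible (χ-1≡1⇒q eq))) , id ]′ χ-1-cases
      where
      impossible : ¬ (∃ λ m → + q ≡ + 1 + + 4 * m)
      impossible (m , q≡1) = 1+4m≢3+4n m (+ (q / 4)) (trans (sym q≡1) (%4⇒ℤ q 3 q%4))

-- Integers and reciprocals in ℚ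

module _ where
  open import Data.Integer using (+_)
  open import Data.Rational using (_+_; _*_; -_)

  fromℚᵘ-+ : ∀ x y → fromℚᵘ (x ℚᵘ.+ y) ≡ fromℚᵘ x + fromℚᵘ y
  fromℚᵘ-+ x y = ℚₚ.toℚᵘ-injective (ℚᵘₚ.≃-trans (ℚₚ.toℚᵘ-fromℚᵘ (x ℚᵘ.+ y))
    (ℚᵘₚ.≃-trans (ℚᵘₚ.≃-sym (ℚᵘₚ.+-cong (ℚₚ.toℚᵘ-fromℚᵘ x) (ℚₚ.toℚᵘ-fromℚᵘ y)))
      (ℚᵘₚ.≃-sym (ℚₚ.toℚᵘ-homo-+ (fromℚᵘ x) (fromℚᵘ y)))))

  fromℚᵘ-* : ∀ x y → fromℚᵘ (x ℚᵘ.* y) ≡ fromℚᵘ x * fromℚᵘ y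
  fromℚᵘ-* x y = ℚₚ.toℚᵘ-injective (ℚᵘₚ.≃-trans (ℚₚ.toℚᵘ-fromℚᵘ (x ℚᵘ.* y))
    (ℚᵘₚ.≃-trans (ℚᵘₚ.≃-sym (ℚᵘₚ.*-cong (ℚₚ.toℚᵘ-fromℚᵘ x) (ℚₚ.toℚᵘ-fromℚᵘ y)))
      (ℚᵘₚ.≃-sym (ℚₚ.toℚᵘ-homo-* (fromℚᵘ x) (fromℚᵘ y)))))

  opaque
    -- Opaque, so that the normalisation of fractions never unfolds in later goals. Its laws are
    -- checked on unnormalised fractions, where equality is cross-multiplication.
    ι : ℤ → ℚ
    ι z = z ℚ./ 1

    ι-def : ∀ z → ι z ≡ z ℚ./ 1
    ι-def z = refl

    ι-0 : ι 0ℤ ≡ 0ℚ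
    ι-0 = refl

    ι-1 : ι 1ℤ ≡ 1ℚ
    ι-1 = refl

    ι-+ : ∀ a b → ι (a ℤ.+ b) ≡ ι a + ι b
    ι-+ a b = trans (ℚₚ.fromℚᵘ-cong {mkℚᵘ (a ℤ.+ b) 0} {mkℚᵘ a 0 ℚᵘ.+ mkℚᵘ b 0}
        (*≡* (solve 2 (λ a b → (a :+ b) :* con 1ℤ := (a :* con 1ℤ :+ b :* con 1ℤ) :* con 1ℤ) refl a b)))
      (fromℚᵘ-+ (mkℚᵘ a 0) (mkℚᵘ b 0))
      where open +-*-Solver

    ι-* : ∀ a b → ι (a ℤ.* b) ≡ ι a * ι b
    ι-* a b = fromℚᵘ-* (mkℚᵘ a 0) (mkℚᵘ b 0)

    frac-ι : ∀ n d → d ≢ 0 → frac n d * ι (+ d) ≡ ι n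
    frac-ι n zero    d≢0 with () ← d≢0 refl
    frac-ι n (suc d) d≢0 = trans (sym (fromℚᵘ-* (mkℚᵘ n d) (mkℚᵘ (+ suc d) 0)))
      (ℚₚ.fromℚᵘ-cong {mkℚᵘ n d ℚᵘ.* mkℚᵘ (+ suc d) 0} {mkℚᵘ n 0} (*≡* (trans (ℤₚ.*-identityʳ (n ℤ.* + suc d))
        (cong (λ z → n ℤ.* + z) (sym (ℕₚ.*-identityʳ (suc d)))))))

  ι-neg : ∀ a → ι (ℤ.- a) ≡ - ι a
  ι-neg a = inverse-unique (ι (ℤ.- a)) (ι a) (trans (sym (ι-+ (ℤ.- a) a)) (trans (cong ι (ℤₚ.+-inverseˡ a)) ι-0))
    where
    inverse-unique : ∀ x y → x + y ≡ 0ℚ → x ≡ - y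
    inverse-unique x y eq = trans (solve 2 (λ x y → x := (x :+ y) :+ :- y) refl x y) (trans (cong (_+ - y) eq) (ℚₚ.+-identityˡ (- y)))
      where open ℚSolver

  opaque
    recip : ℕ → ℚ
    recip = frac (+ 1)

    recip-1 : recip 1 ≡ 1ℚ
    recip-1 = refl

    recip-ι : ∀ d → d ≢ 0 → recip d * ι (+ d) ≡ 1ℚ
    recip-ι d d≢0 = trans (frac-ι (+ 1) d d≢0) ι-1

  ι-cancel : ∀ d → d ≢ 0 → ∀ x y → x * ι (+ d) ≡ y * ι (+ d) → x ≡ y
  ι-cancel d d≢0 x y eq = trans (expand x) (trans (cong (recip d *_) eq) (sym (expand y)))
    where
    open ℚSolver
    expand : ∀ x → x ≡ recip d * (x * ι (+ d))
    expand x = trans (sym (ℚₚ.*-identityʳ x)) (trans (cong (x *_) (sym (recip-ι d d≢0)))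
      (solve 3 (λ x r i → x :* (r :* i) := r :* (x :* i)) refl x (recip d) (ι (+ d))))

  frac-recip : ∀ n d → d ≢ 0 → frac n d ≡ ι n * recip d
  frac-recip n d d≢0 = ι-cancel d d≢0 _ _ (trans (frac-ι n d d≢0)
    (sym (trans (ℚₚ.*-assoc (ι n) (recip d) (ι (+ d))) (trans (cong (ι n *_) (recip-ι d d≢0)) (ℚₚ.*-identityʳ (ι n))))))

  ι-pos-* : ∀ m n → ι (+ (m ℕ.* n)) ≡ ι (+ m) * ι (+ n)
  ι-pos-* m n = trans (cong ι (ℤₚ.pos-* m n)) (ι-* (+ m) (+ n))

  *-≢0 : ∀ {m n} → m ≢ 0 → n ≢ 0 → m ℕ.* n ≢ 0
  *-≢0 {zero}          m≢0 n≢0 eq = m≢0 refl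
  *-≢0 {suc m} {zero}  m≢0 n≢0 eq = n≢0 refl
  *-≢0 {suc m} {suc n} m≢0 n≢0 ()

  !≢0 : ∀ c → c ! ≢ 0
  !≢0 c eq = ℕₚ.<⇒≢ (ℕₚ.1≤n! c) (sym eq)

  recip-* : ∀ m n → m ≢ 0 → n ≢ 0 → recip (m ℕ.* n) ≡ recip m * recip n
  recip-* m n m≢0 n≢0 = ι-cancel (m ℕ.* n) (*-≢0 m≢0 n≢0) _ _ (begin
    recip (m ℕ.* n) * ι (+ (m ℕ.* n))         ≡⟨ recip-ι (m ℕ.* n) (*-≢0 m≢0 n≢0) ⟩
    1ℚ * 1ℚ                                   ≡⟨ cong₂ _*_ (recip-ι m m≢0) (recip-ι n n≢0) ⟨
    (recip m * ι (+ m)) * (recip n * ι (+ n)) ≡⟨ solve 4 (λ a b c d → (a :* b) :* (c :* d) := (a :* c) :* (b :* d)) refl (recip m) (ι (+ m)) (recip n) (ι (+ n)) ⟩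
    (recip m * recip n) * (ι (+ m) * ι (+ n)) ≡⟨ cong ((recip m * recip n) *_) (ι-pos-* m n) ⟨
    (recip m * recip n) * ι (+ (m ℕ.* n))     ∎)
    where
    open ≡-Reasoning
    open ℚSolver

  -- The ring ℚ[√D]

  module QuadraticRing (D : ℚ) where
    open QuadArith D
    open ℚSolver using (solve; _:=_; _:+_; _:*_; :-_; con)

    negQ : Q2 → Q2
    negQ (a , b) = (- a , - b)

    ⊗-comm : ∀ x y → x ⊗ y ≡ y ⊗ x
    ⊗-comm (a , b) (c , d) = cong₂ _,_
      (solve 5 (λ a b c d D → a :* c :+ D :* (b :* d) := c :* a :+ D :* (d :* b)) refl a b c d D)
      (solve 4 (λ a b c d → a :* d :+ b :* c := c :* b :+ d :* a) refl a b c d)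

    ⊗-assoc : ∀ x y z → (x ⊗ y) ⊗ z ≡ x ⊗ (y ⊗ z)
    ⊗-assoc (a , b) (c , d) (e , f) = cong₂ _,_
      (solve 7 (λ a b c d e f D → (a :* c :+ D :* (b :* d)) :* e :+ D :* ((a :* d :+ b :* c) :* f)
        := a :* (c :* e :+ D :* (d :* f)) :+ D :* (b :* (c :* f :+ d :* e))) refl a b c d e f D)
      (solve 7 (λ a b c d e f D → (a :* c :+ D :* (b :* d)) :* f :+ (a :* d :+ b :* c) :* e
        := a :* (c :* f :+ d :* e) :+ b :* (c :* e :+ D :* (d :* f))) refl a b c d e f D)

    ⊗-distribˡ : ∀ x y z → x ⊗ (y ⊕ z) ≡ (x ⊗ y) ⊕ (x ⊗ z)
    ⊗-distribˡ (a , b) (c , d) (e , f) = cong₂ _,_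
      (solve 7 (λ a b c d e f D → a :* (c :+ e) :+ D :* (b :* (d :+ f)) := (a :* c :+ D :* (b :* d)) :+ (a :* e :+ D :* (b :* f))) refl a b c d e f D)
      (solve 6 (λ a b c d e f → a :* (d :+ f) :+ b :* (c :+ e) := (a :* d :+ b :* c) :+ (a :* f :+ b :* e)) refl a b c d e f)

    sc-⊗ : ∀ r x → sc r x ≡ (r , 0ℚ) ⊗ x
    sc-⊗ r (a , b) = cong₂ _,_
      (solve 4 (λ r a b D → r :* a := r :* a :+ D :* (con 0ℚ :* b)) refl r a b D)
      (solve 3 (λ r a b → r :* b := r :* b :+ con 0ℚ :* a) refl r a b)

    ⊗-identityˡ : ∀ x → 1Q ⊗ x ≡ x
    ⊗-identityˡ x@(a , b) = trans (sym (sc-⊗ 1ℚ x)) (cong₂ _,_ (ℚₚ.*-identityˡ a) (ℚₚ.*-identityˡ b))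

    Q2-isCommutativeRing : IsCommutativeRing _≡_ _⊕_ _⊗_ negQ 0Q 1Q
    Q2-isCommutativeRing = record
      { isRing = record
        { +-isAbelianGroup = record
          { isGroup = record
            { isMonoid = record
              { isSemigroup = record
                { isMagma = record { isEquivalence = isEquivalence ; ∙-cong = cong₂ _⊕_ }
                ; assoc = λ (a , b) (c , d) (e , f) → cong₂ _,_ (ℚₚ.+-assoc a c e) (ℚₚ.+-assoc b d f) }
              ; identity = (λ (a , b) → cong₂ _,_ (ℚₚ.+-identityˡ a) (ℚₚ.+-identityˡ b))
                         , (λ (a , b) → cong₂ _,_ (ℚₚ.+-identityʳ a) (ℚₚ.+-identityʳ b)) }
            ; inverse = (λ (a , b) → cong₂ _,_ (ℚₚ.+-inverseˡ a) (ℚₚ.+-inverseˡ b))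
                      , (λ (a , b) → cong₂ _,_ (ℚₚ.+-inverseʳ a) (ℚₚ.+-inverseʳ b))
            ; ⁻¹-cong = cong negQ }
          ; comm = λ (a , b) (c , d) → cong₂ _,_ (ℚₚ.+-comm a c) (ℚₚ.+-comm b d) }
        ; *-cong = cong₂ _⊗_
        ; *-assoc = ⊗-assoc
        ; *-identity = ⊗-identityˡ , (λ x → trans (⊗-comm x 1Q) (⊗-identityˡ x))
        ; distrib = ⊗-distribˡ , (λ x y z → trans (⊗-comm (y ⊕ z) x) (trans (⊗-distribˡ x y z) (cong₂ _⊕_ (⊗-comm x y) (⊗-comm x z)))) }
      ; *-comm = ⊗-comm }

    open ListSum Q2-isCommutativeRing
      using (natural; sumOver; sumOver-cong; sumOver-filter-*; sumOver-*ˡ; indicator; module PartitionSum) public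

    sc-sc : ∀ r s x → sc r (sc s x) ≡ sc (r * s) x
    sc-sc r s (a , b) = cong₂ _,_ (sym (ℚₚ.*-assoc r s a)) (sym (ℚₚ.*-assoc r s b))

    sc-1 : ∀ x → sc 1ℚ x ≡ x
    sc-1 (a , b) = cong₂ _,_ (ℚₚ.*-identityˡ a) (ℚₚ.*-identityˡ b)

    sc-⊗ʳ : ∀ r x y → x ⊗ sc r y ≡ sc r (x ⊗ y)
    sc-⊗ʳ r (a , b) (c , d) = cong₂ _,_
      (solve 6 (λ r a b c d D → a :* (r :* c) :+ D :* (b :* (r :* d)) := r :* (a :* c :+ D :* (b :* d))) refl r a b c d D)
      (solve 5 (λ r a b c d → a :* (r :* d) :+ b :* (r :* c) := r :* (a :* d :+ b :* c)) refl r a b c d)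

    sc-⊗-sc : ∀ r s x y → sc r x ⊗ sc s y ≡ sc (r * s) (x ⊗ y)
    sc-⊗-sc r s (a , b) (c , d) = cong₂ _,_
      (solve 7 (λ r s a b c d D → (r :* a) :* (s :* c) :+ D :* ((r :* b) :* (s :* d)) := (r :* s) :* (a :* c :+ D :* (b :* d))) refl r s a b c d D)
      (solve 6 (λ r s a b c d → (r :* a) :* (s :* d) :+ (r :* b) :* (s :* c) := (r :* s) :* (a :* d :+ b :* c)) refl r s a b c d)

    natural-ι : ∀ n → natural n ≡ (ι (+ n) , 0ℚ)
    natural-ι zero    = cong (_, 0ℚ) (sym ι-0)
    natural-ι (suc n) = trans (cong (1Q ⊕_) (natural-ι n))
      (cong (_, 0ℚ) (trans (cong (_+ ι (+ n)) (sym ι-1)) (sym (ι-+ 1ℤ (+ n)))))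

    natural-sc : ∀ n x → natural n ⊗ x ≡ sc (ι (+ n)) x
    natural-sc n x = trans (cong (_⊗ x) (natural-ι n)) (sym (sc-⊗ (ι (+ n)) x))

    -- An integer acts as scaling by a rational, and a nonzero rational is invertible whatever `D`
    -- is.
    natural-cancel : ∀ n x y → natural (suc n) ⊗ x ≡ natural (suc n) ⊗ y → x ≡ y
    natural-cancel n x y eq = trans (sym (expand x)) (trans (cong (sc (recip (suc n))) eq) (expand y))
      where
      expand : ∀ x → sc (recip (suc n)) (natural (suc n) ⊗ x) ≡ x
      expand x = trans (cong (sc (recip (suc n))) (natural-sc (suc n) x)) (trans (sc-sc (recip (suc n)) (ι (+ suc n)) x)
        (trans (cong (λ r → sc r x) (recip-ι (suc n) (λ ()))) (sc-1 x)))

    module Exponential (t : ℕ → Q2) where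

      term : ℕ → ℕ → Q2
      term j c = sc (recip (j ^ c ℕ.* c !)) (t j ^Q c)

      term-zero : ∀ j → term j 0 ≡ 1Q
      term-zero j = trans (cong (λ r → sc r 1Q) recip-1) (sc-1 1Q)

      ^≢0 : ∀ {j} c → 1 ≤ j → j ^ c ≢ 0
      ^≢0 {suc j} c 1≤j eq = ℕₚ.<⇒≢ (ℕₚ.m^n>0 (suc j) c) (sym eq)

      -- Passing from c to c + 1 multiplies the denominator jᶜ c! by j (c + 1), which the factor on
      -- the left cancels.
      term-suc : ∀ j c → 1 ≤ j → natural (j ℕ.* suc c) ⊗ term j (suc c) ≡ t j ⊗ term j c
      term-suc j c 1≤j = begin
        natural (j ℕ.* suc c) ⊗ term j (suc c)
          ≡⟨ natural-sc (j ℕ.* suc c) (term j (suc c)) ⟩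
        sc (ι (+ (j ℕ.* suc c))) (sc (recip (j ^ suc c ℕ.* suc c !)) (t j ⊗ (t j ^Q c)))
          ≡⟨ sc-sc (ι (+ (j ℕ.* suc c))) (recip (j ^ suc c ℕ.* suc c !)) (t j ⊗ (t j ^Q c)) ⟩
        sc (ι (+ (j ℕ.* suc c)) * recip (j ^ suc c ℕ.* suc c !)) (t j ⊗ (t j ^Q c))
          ≡⟨ cong (λ r → sc r (t j ⊗ (t j ^Q c))) coefficient ⟩
        sc (recip (j ^ c ℕ.* c !)) (t j ⊗ (t j ^Q c))
          ≡⟨ sc-⊗ʳ (recip (j ^ c ℕ.* c !)) (t j) (t j ^Q c) ⟨
        t j ⊗ term j c ∎
        where
        open ≡-Reasoning
        j≢0 : j ≢ 0
        j≢0 j≡0 = ℕₚ.<⇒≢ 1≤j (sym j≡0)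
        n≢0 : j ℕ.* suc c ≢ 0
        n≢0 = *-≢0 j≢0 (λ ())
        coefficient : ι (+ (j ℕ.* suc c)) * recip (j ^ suc c ℕ.* suc c !) ≡ recip (j ^ c ℕ.* c !)
        coefficient = begin
          ι (+ (j ℕ.* suc c)) * recip (j ^ suc c ℕ.* suc c !)
            ≡⟨ cong (λ d → ι (+ (j ℕ.* suc c)) * recip d)
                 (ℕSolver.solve 4 (λ j x s f → (j ℕSolver.:* x) ℕSolver.:* (s ℕSolver.:* f) ℕSolver.:= (j ℕSolver.:* s) ℕSolver.:* (x ℕSolver.:* f)) refl j (j ^ c) (suc c) (c !)) ⟩
          ι (+ (j ℕ.* suc c)) * recip ((j ℕ.* suc c) ℕ.* (j ^ c ℕ.* c !))
            ≡⟨ cong (ι (+ (j ℕ.* suc c)) *_) (recip-* (j ℕ.* suc c) (j ^ c ℕ.* c !) n≢0 (*-≢0 (^≢0 c 1≤j) (!≢0 c))) ⟩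
          ι (+ (j ℕ.* suc c)) * (recip (j ℕ.* suc c) * recip (j ^ c ℕ.* c !))
            ≡⟨ solve 3 (λ i r s → i :* (r :* s) := (r :* i) :* s) refl (ι (+ (j ℕ.* suc c))) (recip (j ℕ.* suc c)) (recip (j ^ c ℕ.* c !)) ⟩
          (recip (j ℕ.* suc c) * ι (+ (j ℕ.* suc c))) * recip (j ^ c ℕ.* c !)
            ≡⟨ cong (_* recip (j ^ c ℕ.* c !)) (recip-ι (j ℕ.* suc c) n≢0) ⟩
          1ℚ * recip (j ^ c ℕ.* c !)
            ≡⟨ ℚₚ.*-identityˡ _ ⟩
          recip (j ^ c ℕ.* c !) ∎

      open PartitionSum t term term-zero term-suc public

      denomFrom≢0 : ∀ j cs → 1 ≤ j → denomFrom j cs ≢ 0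
      denomFrom≢0 j []       1≤j = λ ()
      denomFrom≢0 j (c ∷ cs) 1≤j = *-≢0 (*-≢0 (^≢0 c 1≤j) (!≢0 c)) (denomFrom≢0 (suc j) cs (s≤s z≤n))

  -- The sums A_k as exponential coefficients

  module PartitionPolynomial {q : ℕ} (K : FiniteField q) (p : ℕ) (D : ℚ) (u v w : Q2) where
    open QuadArith D
    open QuadraticRing D
    open Exponential (tj K p D u v w) public
    open ≡-Reasoning

    weight-prodFrom : ∀ j cs → 1 ≤ j → weight j cs ≡ sc (recip (denomFrom j cs)) (prodFrom K p D u v w j cs)
    weight-prodFrom j []       1≤j = sym (trans (cong (λ r → sc r 1Q) recip-1) (sc-1 1Q))
    weight-prodFrom j (c ∷ cs) 1≤j = begin
      term j c ⊗ weight (suc j) cs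
        ≡⟨ cong (term j c ⊗_) (weight-prodFrom (suc j) cs (s≤s z≤n)) ⟩
      term j c ⊗ sc (recip (denomFrom (suc j) cs)) (prodFrom K p D u v w (suc j) cs)
        ≡⟨ sc-⊗-sc (recip (j ^ c ℕ.* c !)) (recip (denomFrom (suc j) cs)) (tj K p D u v w j ^Q c) (prodFrom K p D u v w (suc j) cs) ⟩
      sc (recip (j ^ c ℕ.* c !) * recip (denomFrom (suc j) cs)) ((tj K p D u v w j ^Q c) ⊗ prodFrom K p D u v w (suc j) cs)
        ≡⟨ cong (λ r → sc r ((tj K p D u v w j ^Q c) ⊗ prodFrom K p D u v w (suc j) cs))
             (recip-* (j ^ c ℕ.* c !) (denomFrom (suc j) cs) (*-≢0 (^≢0 c 1≤j) (!≢0 c)) (denomFrom≢0 (suc j) cs (s≤s z≤n))) ⟨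
      sc (recip (denomFrom j (c ∷ cs))) ((tj K p D u v w j ^Q c) ⊗ prodFrom K p D u v w (suc j) cs) ∎

    -- `Ncoef` is k! divided by the product of the denominators in `term`, and filtering by weight
    -- is multiplication by the indicator. The ranges in `cands k k` explain the first two arguments
    -- of `coefficient`.
    A1-coefficient : ∀ k → A1 K p D k u v w ≡ sc (ι (+ (k !))) (coefficient k k k)
    A1-coefficient k = begin
      A1 K p D k u v w
        ≡⟨ sumOver-filter-* (λ c → sc (Ncoef k c) (prodFrom K p D u v w 1 c)) (λ c → weightFrom 1 c ≡ᵇ k) (cands k k) ⟩
      sumOver (λ c → sc (Ncoef k c) (prodFrom K p D u v w 1 c) ⊗ indicator k (weightFrom 1 c)) (cands k k)
        ≡⟨ sumOver-cong (λ c → trans (cong (_⊗ indicator k (weightFrom 1 c)) (Ncoef-weight c))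
             (⊗-assoc (ι (+ (k !)) , 0ℚ) (weight 1 c) (indicator k (weightFrom 1 c)))) (cands k k) ⟩
      sumOver (λ c → (ι (+ (k !)) , 0ℚ) ⊗ (weight 1 c ⊗ indicator k (weightFrom 1 c))) (cands k k)
        ≡⟨ sumOver-*ˡ (ι (+ (k !)) , 0ℚ) (λ c → weight 1 c ⊗ indicator k (weightFrom 1 c)) (cands k k) ⟩
      (ι (+ (k !)) , 0ℚ) ⊗ coefficient k k k
        ≡⟨ sc-⊗ (ι (+ (k !))) (coefficient k k k) ⟨
      sc (ι (+ (k !))) (coefficient k k k) ∎
      where
      Ncoef-weight : ∀ c → sc (Ncoef k c) (prodFrom K p D u v w 1 c) ≡ (ι (+ (k !)) , 0ℚ) ⊗ weight 1 c
      Ncoef-weight c = begin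
        sc (Ncoef k c) (prodFrom K p D u v w 1 c)
          ≡⟨ cong (λ r → sc r (prodFrom K p D u v w 1 c)) (frac-recip (+ (k !)) (denomFrom 1 c) (denomFrom≢0 1 c (s≤s z≤n))) ⟩
        sc (ι (+ (k !)) * recip (denomFrom 1 c)) (prodFrom K p D u v w 1 c)
          ≡⟨ sc-sc (ι (+ (k !))) (recip (denomFrom 1 c)) (prodFrom K p D u v w 1 c) ⟨
        sc (ι (+ (k !))) (sc (recip (denomFrom 1 c)) (prodFrom K p D u v w 1 c))
          ≡⟨ cong (sc (ι (+ (k !)))) (weight-prodFrom 1 c (s≤s z≤n)) ⟨
        sc (ι (+ (k !))) (weight 1 c)
          ≡⟨ sc-⊗ (ι (+ (k !))) (weight 1 c) ⟩
        (ι (+ (k !)) , 0ℚ) ⊗ weight 1 c ∎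

  module _ {q : ℕ} (K : FiniteField q) (p : ℕ) (D : ℚ) (u v w : Q2) where

    tj-∣ : ∀ {j} → p ∣ j → tj K p D u v w j ≡ w
    tj-∣ {j} p∣j with p ∣? j
    ... | yes _   = refl
    ... | no  p∤j = ⊥-elim (p∤j p∣j)

    tj-∤ : ∀ {j} → ¬ (p ∣ j) →
      tj K p D u v w j ≡ (if FiniteField.isNonzeroSquare K (FiniteField.fromℕF K j) then u else v)
    tj-∤ {j} p∤j with p ∣? j
    ... | yes p∣j = ⊥-elim (p∤j p∣j)
    ... | no  _   = refl

  antidiagonal-ι : (D : ℚ) (f g : ℕ → ℕ → ℤ) → ∀ k →
    antidiagonal (QuadArith._⊕_ D) (0ℚ , 0ℚ) (λ j m → (ι (f j m) , ι (g j m))) k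
      ≡ (ι (antidiagonalℤ f k) , ι (antidiagonalℤ g k))
  antidiagonal-ι D f g zero    = cong₂ _,_ (sym ι-0) (sym ι-0)
  antidiagonal-ι D f g (suc k) = trans (cong (QuadArith._⊕_ D (ι (f 0 k) , ι (g 0 k))) (antidiagonal-ι D (λ j → f (suc j)) (λ j → g (suc j)) k))
    (cong₂ _,_ (sym (ι-+ (f 0 k) _)) (sym (ι-+ (g 0 k) _)))

  half : ℚ
  half = frac (+ 1) 2

  half-ι : ∀ x y → + 2 ℤ.* x ≡ y → ι x ≡ half * ι y
  half-ι x y refl = begin
    ι x                       ≡⟨ ℚₚ.*-identityˡ (ι x) ⟨
    1ℚ * ι x                  ≡⟨ cong (_* ι x) (trans (frac-ι (+ 1) 2 (λ ())) ι-1) ⟨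
    (half * ι (+ 2)) * ι x    ≡⟨ ℚₚ.*-assoc half (ι (+ 2)) (ι x) ⟩
    half * (ι (+ 2) * ι x)    ≡⟨ cong (half *_) (ι-* (+ 2) x) ⟨
    half * ι (+ 2 ℤ.* x)      ∎
    where open ≡-Reasoning

  module _ where
    open ≡-Reasoning
    open ℚSolver

    half-⊗-real : ∀ a d s b → half * ι a + ι d * ((half * ι s) * ι b) ≡ half * ι (a ℤ.+ d ℤ.* (s ℤ.* b))
    half-⊗-real a d s b = begin
      half * ι a + ι d * ((half * ι s) * ι b)
        ≡⟨ solve 5 (λ h a d s b → h :* a :+ d :* ((h :* s) :* b) := h :* (a :+ d :* (s :* b))) refl half (ι a) (ι d) (ι s) (ι b) ⟩
      half * (ι a + ι d * (ι s * ι b))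
        ≡⟨ cong (λ z → half * (ι a + ι d * z)) (ι-* s b) ⟨
      half * (ι a + ι d * ι (s ℤ.* b))
        ≡⟨ cong (λ z → half * (ι a + z)) (ι-* d (s ℤ.* b)) ⟨
      half * (ι a + ι (d ℤ.* (s ℤ.* b)))
        ≡⟨ cong (half *_) (ι-+ a (d ℤ.* (s ℤ.* b))) ⟨
      half * ι (a ℤ.+ d ℤ.* (s ℤ.* b)) ∎

    half-⊗-root : ∀ a s b → half * ι b + (half * ι s) * ι a ≡ half * ι (b ℤ.+ s ℤ.* a)
    half-⊗-root a s b = begin
      half * ι b + (half * ι s) * ι a   ≡⟨ solve 4 (λ h a s b → h :* b :+ (h :* s) :* a := h :* (b :+ s :* a)) refl half (ι a) (ι s) (ι b) ⟩
      half * (ι b + ι s * ι a)          ≡⟨ cong (λ z → half * (ι b + z)) (ι-* s a) ⟨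
      half * (ι b + ι (s ℤ.* a))        ≡⟨ cong (half *_) (ι-+ b (s ℤ.* a)) ⟨
      half * ι (b ℤ.+ s ℤ.* a)          ∎

    -- The closing computation with its atoms as variables: N = N_H, B the binomial, g = (-1)ᵏ, Q =
    -- q, r = 1/q, R = 1/(2 q k!), P = k!, T = 2 and A is q - 1 times the rational part of the two
    -- sums A_k. The relations among them are hypotheses because a ring solver cannot use inverses.
    final-real : ∀ N B g Q r R P T A → r * Q ≡ 1ℚ → R * (T * Q * P) ≡ 1ℚ → g * g ≡ 1ℚ → A ≡ P * (T * (g * (Q * N + - B))) →
      B * r + (g * R) * A ≡ N
    final-real N B g Q r R P T A rQ RTQP gg refl = begin
      B * r + (g * R) * (P * (T * (g * (Q * N + - B))))
        ≡⟨ solve 8 (λ N B g Q r R P T → B :* r :+ (g :* R) :* (P :* (T :* (g :* (Q :* N :+ :- B))))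
             := B :* r :+ (g :* g) :* ((R :* (T :* P)) :* (Q :* N :+ :- B))) refl N B g Q r R P T ⟩
      B * r + (g * g) * ((R * (T * P)) * (Q * N + - B))
        ≡⟨ cong₂ (λ a b → B * r + a * (b * (Q * N + - B))) gg RTP≡r ⟩
      B * r + 1ℚ * (r * (Q * N + - B))
        ≡⟨ solve 4 (λ B r Q N → B :* r :+ con 1ℚ :* (r :* (Q :* N :+ :- B)) := (r :* Q) :* N) refl B r Q N ⟩
      (r * Q) * N
        ≡⟨ cong (_* N) rQ ⟩
      1ℚ * N
        ≡⟨ ℚₚ.*-identityˡ N ⟩
      N ∎
      where
      RTP≡r : R * (T * P) ≡ r
      RTP≡r = begin
        R * (T * P)             ≡⟨ ℚₚ.*-identityʳ _ ⟨
        (R * (T * P)) * 1ℚ      ≡⟨ cong ((R * (T * P)) *_) rQ ⟨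
        (R * (T * P)) * (r * Q) ≡⟨ solve 5 (λ R T P r Q → (R :* (T :* P)) :* (r :* Q) := r :* (R :* (T :* Q :* P))) refl R T P r Q ⟩
        r * (R * (T * Q * P))   ≡⟨ cong (r *_) RTQP ⟩
        r * 1ℚ                  ≡⟨ ℚₚ.*-identityʳ r ⟩
        r                       ∎

  pos-∸1 : ∀ n → n ≢ 0 → + (n ∸ 1) ≡ + n ℤ.- 1ℤ
  pos-∸1 zero    n≢0 = ⊥-elim (n≢0 refl)
  pos-∸1 (suc n) n≢0 = refl

  -- Evaluation of the two sums

  module Evaluation {q : ℕ} (K : FiniteField q) (p : ℕ)
    (∣⇒0 : ∀ {j} → p ∣ j → FiniteField.fromℕF K j ≡ FiniteField.0F K)
    (∤⇒≢0 : ∀ {j} → ¬ (p ∣ j) → FiniteField.fromℕF K j ≢ FiniteField.0F K)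
    (2≢0 : FiniteField.fromℕF K 2 ≢ FiniteField.0F K) where
    open FiniteField K
    open FieldArithmetic K using (χ; ⊖_; squareClass; isSquare; isNonsquare; isZero′; χ-square; χ-nonsquare; isNonzeroSquare-square; isNonzeroSquare-nonsquare; ∑)
    open SubsetSums K
    open OddCharacteristic K 2≢0
    open Functionals K 2≢0
    open ≡-Reasoning

    discriminant : ℤ
    discriminant = χ (⊖ 1F) ℤ.* + q

    D : ℚ
    D = ι discriminant

    open QuadArith D
    open QuadraticRing D

    -- The sign `σ` treats both sums at once: it stands for the substitution √D ↦ σ √D, applied both
    -- to t and to the pair (α , β).
    module Recurrence (σ : ℤ) (σσ : σ ℤ.* σ ≡ 1ℤ) (t : ℕ → Q2)
      (t-∣ : ∀ {j} → p ∣ j → t j ≡ (ι (ℤ.- squareCount) , 0ℚ))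
      (t-∤ : ∀ {j} → ¬ (p ∣ j) → t j ≡ (half , half * ι (ℤ.- (σ ℤ.* χ (fromℕF j))))) where

      ψ : ℕ → Q2
      ψ m = (ι (α (e m)) , ι (σ ℤ.* β (e m)))

      -- If p divides j, every translation by j h is trivial and the translation sum is
      -- multiplication by (q - 1)/2. Otherwise its action is given by `2α-shiftSum` and
      -- `2β-shiftSum`, halved in ℚ.
      ψ-shift : ∀ j f → t j ⊗ (ι (α f) , ι (σ ℤ.* β f))
        ≡ (ι (ℤ.- α (shiftSum (fromℕF j) f)) , ι (ℤ.- (σ ℤ.* β (shiftSum (fromℕF j) f))))
      ψ-shift j f with p ∣? j
      ... | yes p∣j = begin
        t j ⊗ (ι (α f) , ι (σ ℤ.* β f))
          ≡⟨ cong (_⊗ (ι (α f) , ι (σ ℤ.* β f))) (t-∣ p∣j) ⟩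
        (ι (ℤ.- squareCount) , 0ℚ) ⊗ (ι (α f) , ι (σ ℤ.* β f))
          ≡⟨ sc-⊗ (ι (ℤ.- squareCount)) (ι (α f) , ι (σ ℤ.* β f)) ⟨
        (ι (ℤ.- squareCount) * ι (α f) , ι (ℤ.- squareCount) * ι (σ ℤ.* β f))
          ≡⟨ cong₂ _,_ (ι-* (ℤ.- squareCount) (α f)) (ι-* (ℤ.- squareCount) (σ ℤ.* β f)) ⟨
        (ι (ℤ.- squareCount ℤ.* α f) , ι (ℤ.- squareCount ℤ.* (σ ℤ.* β f)))
          ≡⟨ cong₂ (λ x y → (ι x , ι y)) αEq βEq ⟩
        (ι (ℤ.- α (shiftSum (fromℕF j) f)) , ι (ℤ.- (σ ℤ.* β (shiftSum (fromℕF j) f)))) ∎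
        where
        open +-*-Solver using (solve; _:=_; _:*_; :-_)
        pointwise : ∀ x → shiftSum (fromℕF j) f x ≡ squareCount ℤ.* f x
        pointwise x = trans (cong (λ c → shiftSum c f x) (∣⇒0 p∣j)) (shiftSum-0 f x)
        αEq : ℤ.- squareCount ℤ.* α f ≡ ℤ.- α (shiftSum (fromℕF j) f)
        αEq = trans (sym (ℤₚ.neg-distribˡ-* squareCount (α f))) (cong ℤ.-_ (sym (trans (α-cong pointwise) (α-* squareCount f))))
        βEq : ℤ.- squareCount ℤ.* (σ ℤ.* β f) ≡ ℤ.- (σ ℤ.* β (shiftSum (fromℕF j) f))
        βEq = trans (solve 3 (λ n s b → (:- n) :* (s :* b) := :- (s :* (n :* b))) refl squareCount σ (β f))
          (cong (λ z → ℤ.- (σ ℤ.* z)) (sym (trans (β-cong pointwise) (β-* squareCount f))))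
      ... | no p∤j = begin
        t j ⊗ (ι (α f) , ι (σ ℤ.* β f))
          ≡⟨ cong (_⊗ (ι (α f) , ι (σ ℤ.* β f))) (t-∤ p∤j) ⟩
        (half * ι (α f) + D * ((half * ι s) * ι (σ ℤ.* β f)) , half * ι (σ ℤ.* β f) + (half * ι s) * ι (α f))
          ≡⟨ cong₂ _,_ (half-⊗-real (α f) discriminant s (σ ℤ.* β f)) (half-⊗-root (α f) s (σ ℤ.* β f)) ⟩
        (half * ι (α f ℤ.+ discriminant ℤ.* (s ℤ.* (σ ℤ.* β f))) , half * ι (σ ℤ.* β f ℤ.+ s ℤ.* α f))
          ≡⟨ cong₂ _,_ (half-ι (ℤ.- α (shiftSum c f)) _ αEq) (half-ι (ℤ.- (σ ℤ.* β (shiftSum c f))) _ βEq) ⟨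
        (ι (ℤ.- α (shiftSum c f)) , ι (ℤ.- (σ ℤ.* β (shiftSum c f)))) ∎
        where
        open +-*-Solver using (solve; _:=_; _:+_; _:*_; :-_; con)
        c : F
        c = fromℕF j
        s : ℤ
        s = ℤ.- (σ ℤ.* χ c)
        αEq : + 2 ℤ.* (ℤ.- α (shiftSum c f)) ≡ α f ℤ.+ discriminant ℤ.* (s ℤ.* (σ ℤ.* β f))
        αEq = begin
          + 2 ℤ.* (ℤ.- α (shiftSum c f))
            ≡⟨ ℤₚ.neg-distribʳ-* (+ 2) (α (shiftSum c f)) ⟨
          ℤ.- (+ 2 ℤ.* α (shiftSum c f))
            ≡⟨ cong ℤ.-_ (2α-shiftSum (∤⇒≢0 p∤j) f) ⟩
          ℤ.- (ℤ.- α f ℤ.+ χ c ℤ.* (discriminant ℤ.* β f))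
            ≡⟨ solve 4 (λ a x d b → :- (:- a :+ x :* (d :* b)) := a :+ d :* (:- (con 1ℤ :* x) :* b)) refl (α f) (χ c) discriminant (β f) ⟩
          α f ℤ.+ discriminant ℤ.* (ℤ.- (1ℤ ℤ.* χ c) ℤ.* β f)
            -- Inserting σ² = 1 supplies one σ for the root part of t and one for that of ψ.
            ≡⟨ cong (λ z → α f ℤ.+ discriminant ℤ.* (ℤ.- (z ℤ.* χ c) ℤ.* β f)) σσ ⟨
          α f ℤ.+ discriminant ℤ.* (ℤ.- (σ ℤ.* σ ℤ.* χ c) ℤ.* β f)
            ≡⟨ cong (λ z → α f ℤ.+ discriminant ℤ.* z) (solve 3 (λ σ x b → :- (σ :* σ :* x) :* b := :- (σ :* x) :* (σ :* b)) refl σ (χ c) (β f)) ⟩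
          α f ℤ.+ discriminant ℤ.* (s ℤ.* (σ ℤ.* β f)) ∎
        βEq : + 2 ℤ.* (ℤ.- (σ ℤ.* β (shiftSum c f))) ≡ σ ℤ.* β f ℤ.+ s ℤ.* α f
        βEq = begin
          + 2 ℤ.* (ℤ.- (σ ℤ.* β (shiftSum c f)))
            ≡⟨ solve 2 (λ σ b → con (+ 2) :* (:- (σ :* b)) := :- (σ :* (con (+ 2) :* b))) refl σ (β (shiftSum c f)) ⟩
          ℤ.- (σ ℤ.* (+ 2 ℤ.* β (shiftSum c f)))
            ≡⟨ cong (λ z → ℤ.- (σ ℤ.* z)) (2β-shiftSum (∤⇒≢0 p∤j) f) ⟩
          ℤ.- (σ ℤ.* (ℤ.- β f ℤ.+ χ c ℤ.* α f))
            ≡⟨ solve 4 (λ σ b x a → :- (σ :* (:- b :+ x :* a)) := σ :* b :+ (:- (σ :* x)) :* a) refl σ (β f) (χ c) (α f) ⟩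
          σ ℤ.* β f ℤ.+ s ℤ.* α f ∎

      negated : ∀ x y → x ℤ.+ y ≡ 0ℤ → ℤ.- y ≡ x
      negated x y eq = trans (cong ℤ.-_ (trans (solve 2 (λ x y → y := (x :+ y) :+ :- x) refl x y) (trans (cong (ℤ._+ ℤ.- x) eq) (ℤₚ.+-identityˡ (ℤ.- x)))))
        (ℤₚ.neg-involutive x)
        where open +-*-Solver

      ψ-newton : ∀ m → natural m ⊗ ψ m ≡ antidiagonal _⊕_ 0Q (λ i r → t (suc i) ⊗ ψ r) m
      ψ-newton m = sym (begin
        antidiagonal _⊕_ 0Q (λ i r → t (suc i) ⊗ ψ r) m
          ≡⟨ antidiagonal-cong _⊕_ 0Q _ _ m (λ i r _ → ψ-shift (suc i) (e r)) ⟩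
        antidiagonal _⊕_ 0Q (λ i r → (ι (ℤ.- a i r) , ι (ℤ.- (σ ℤ.* b i r)))) m
          ≡⟨ antidiagonal-ι D (λ i r → ℤ.- a i r) (λ i r → ℤ.- (σ ℤ.* b i r)) m ⟩
        (ι (antidiagonalℤ (λ i r → ℤ.- a i r) m) , ι (antidiagonalℤ (λ i r → ℤ.- (σ ℤ.* b i r)) m))
          ≡⟨ cong₂ (λ x y → (ι x , ι y)) αEq βEq ⟩
        (ι (+ m ℤ.* α (e m)) , ι (+ m ℤ.* (σ ℤ.* β (e m))))
          ≡⟨ cong₂ _,_ (ι-* (+ m) (α (e m))) (ι-* (+ m) (σ ℤ.* β (e m))) ⟩
        sc (ι (+ m)) (ψ m)
          ≡⟨ natural-sc m (ψ m) ⟨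
        natural m ⊗ ψ m ∎)
        where
        a b : ℕ → ℕ → ℤ
        a i r = α (shiftSum (fromℕF (suc i)) (e r))
        b i r = β (shiftSum (fromℕF (suc i)) (e r))
        αEq : antidiagonalℤ (λ i r → ℤ.- a i r) m ≡ + m ℤ.* α (e m)
        αEq = trans (sym (antidiagonal-map ℤ._+_ 0ℤ ℤ._+_ 0ℤ ℤ.-_ refl ℤₚ.neg-distrib-+ a m))
          (negated (+ m ℤ.* α (e m)) (antidiagonalℤ a m) (α-newton m))
        open +-*-Solver using (solve; _:=_; _:+_; _:*_; :-_; con)
        βEq : antidiagonalℤ (λ i r → ℤ.- (σ ℤ.* b i r)) m ≡ + m ℤ.* (σ ℤ.* β (e m))
        βEq = begin
          antidiagonalℤ (λ i r → ℤ.- (σ ℤ.* b i r)) m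
            ≡⟨ antidiagonal-map ℤ._+_ 0ℤ ℤ._+_ 0ℤ (λ z → ℤ.- (σ ℤ.* z)) (cong ℤ.-_ (ℤₚ.*-zeroʳ σ))
                 (λ x y → solve 3 (λ σ x y → :- (σ :* (x :+ y)) := :- (σ :* x) :+ :- (σ :* y)) refl σ x y) b m ⟨
          ℤ.- (σ ℤ.* antidiagonalℤ b m)
            ≡⟨ ℤₚ.neg-distribʳ-* σ (antidiagonalℤ b m) ⟩
          σ ℤ.* (ℤ.- antidiagonalℤ b m)
            ≡⟨ cong (σ ℤ.*_) (negated (+ m ℤ.* β (e m)) (antidiagonalℤ b m) (β-newton m)) ⟩
          σ ℤ.* (+ m ℤ.* β (e m))
            ≡⟨ solve 3 (λ σ n x → σ :* (n :* x) := n :* (σ :* x)) refl σ (+ m) (β (e m)) ⟩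
          + m ℤ.* (σ ℤ.* β (e m)) ∎

      ψ-0 : ψ 0 ≡ (ι (+ q ℤ.- 1ℤ) , 0ℚ)
      ψ-0 = cong₂ _,_ (cong ι α-e-0) (trans (cong ι (trans (cong (σ ℤ.*_) β-e-0) (ℤₚ.*-zeroʳ σ))) ι-0)

      ψ-coefficient : ∀ k → ψ k ≡ sc (ι (+ q ℤ.- 1ℤ)) (Exponential.coefficient t k k k)
      ψ-coefficient k = trans (Exponential.newton-unique t natural-cancel ψ ψ-newton k k k ℕₚ.≤-refl ℕₚ.≤-refl)
        (trans (cong (_⊗ Exponential.coefficient t k k k) ψ-0) (sym (sc-⊗ (ι (+ q ℤ.- 1ℤ)) (Exponential.coefficient t k k k))))

    -- Replaces the Boolean choice in `tj` by a formula in χ; as j is nonzero in the field, only the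
    -- values of `a` at 1 and -1 have to be prescribed.
    tj-character : ∀ (u v w : Q2) {j} → ¬ (p ∣ j) → ∀ (a : ℤ → Q2) → a 1ℤ ≡ u → a -1ℤ ≡ v →
      tj K p D u v w j ≡ a (χ (fromℕF j))
    tj-character u v w {j} p∤j a refl refl = trans (tj-∤ K p D u v w p∤j) choice
      where
      choice : (if isNonzeroSquare (fromℕF j) then a 1ℤ else a -1ℤ) ≡ a (χ (fromℕF j))
      choice with squareClass (fromℕF j)
      ... | isZero′ j≡0 = ⊥-elim (∤⇒≢0 p∤j j≡0)
      ... | isSquare r r≢0 eq = trans (cong (λ b → if b then a 1ℤ else a -1ℤ) (isNonzeroSquare-square r r≢0 eq)) (cong a (sym (χ-square r r≢0 eq)))
      ... | isNonsquare j≢0 j≢² = trans (cong (λ b → if b then a 1ℤ else a -1ℤ) (isNonzeroSquare-nonsquare j≢0 j≢²)) (cong a (sym (χ-nonsquare j≢0 j≢²)))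

    half-1 : half * ι 1ℤ ≡ half
    half-1 = trans (cong (half *_) ι-1) (ℚₚ.*-identityʳ half)

    half--1 : half * ι -1ℤ ≡ - half
    half--1 = trans (cong (half *_) (trans (ι-neg 1ℤ) (cong -_ ι-1))) (trans (sym (ℚₚ.neg-distribʳ-* half 1ℚ)) (cong -_ (ℚₚ.*-identityʳ half)))

    u₀ v₀ w₀ : Q2
    u₀ = (half , - half)
    v₀ = (half , half)
    w₀ = (frac (+ 1 ℤ.- + q) 2 , 0ℚ)

    w₀-squareCount : w₀ ≡ (ι (ℤ.- squareCount) , 0ℚ)
    w₀-squareCount = cong (_, 0ℚ) (ι-cancel 2 (λ ()) _ _ (begin
      frac (+ 1 ℤ.- + q) 2 * ι (+ 2)    ≡⟨ frac-ι (+ 1 ℤ.- + q) 2 (λ ()) ⟩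
      ι (+ 1 ℤ.- + q)                   ≡⟨ cong ι (solve 1 (λ n → con 1ℤ :- n := :- (n :- con 1ℤ)) refl (+ q)) ⟩
      ι (ℤ.- (+ q ℤ.- 1ℤ))              ≡⟨ cong (λ z → ι (ℤ.- z)) 2*squareCount ⟨
      ι (ℤ.- (+ 2 ℤ.* squareCount))     ≡⟨ cong ι (solve 1 (λ n → :- (con (+ 2) :* n) := (:- n) :* con (+ 2)) refl squareCount) ⟩
      ι (ℤ.- squareCount ℤ.* + 2)       ≡⟨ ι-* (ℤ.- squareCount) (+ 2) ⟩
      ι (ℤ.- squareCount) * ι (+ 2)     ∎))
      where open +-*-Solver

    module Plus = Recurrence 1ℤ refl (tj K p D u₀ v₀ w₀)
      (λ p∣j → trans (tj-∣ K p D u₀ v₀ w₀ p∣j) w₀-squareCount)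
      (λ p∤j → tj-character u₀ v₀ w₀ p∤j (λ x → (half , half * ι (ℤ.- (1ℤ ℤ.* x)))) (cong (half ,_) half--1) (cong (half ,_) half-1))

    module Minus = Recurrence -1ℤ refl (tj K p D v₀ u₀ w₀)
      (λ p∣j → trans (tj-∣ K p D v₀ u₀ w₀ p∣j) w₀-squareCount)
      (λ p∤j → tj-character v₀ u₀ w₀ p∤j (λ x → (half , half * ι (ℤ.- (-1ℤ ℤ.* x)))) (cong (half ,_) half-1) (cong (half ,_) half--1))

    scaled-A1 : ∀ u v w k (y : Q2) → y ≡ sc (ι (+ q ℤ.- 1ℤ)) (PartitionPolynomial.coefficient K p D u v w k k k) →
      sc (ι (+ q ℤ.- 1ℤ)) (A1 K p D k u v w) ≡ sc (ι (+ (k !))) y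
    scaled-A1 u v w k y refl = begin
      sc m (A1 K p D k u v w) ≡⟨ cong (sc m) (PartitionPolynomial.A1-coefficient K p D u v w k) ⟩
      sc m (sc f z)           ≡⟨ sc-sc m f z ⟩
      sc (m * f) z            ≡⟨ cong (λ r → sc r z) (ℚₚ.*-comm m f) ⟩
      sc (f * m) z            ≡⟨ sc-sc f m z ⟨
      sc f (sc m z)           ∎
      where
      m f : ℚ
      m = ι (+ q ℤ.- 1ℤ)
      f = ι (+ (k !))
      z : Q2
      z = PartitionPolynomial.coefficient K p D u v w k k k

    sign² : ∀ k → sign k ℤ.* sign k ≡ 1ℤ
    sign² zero    = refl
    sign² (suc k) = trans (solve 1 (λ s → (con -1ℤ :* s) :* (con -1ℤ :* s) := s :* s) refl (sign k)) (sign² k)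
      where open +-*-Solver

    half-q≡length : q ≢ 0 → (q ∸ 1) / 2 ≡ length Hlist
    half-q≡length q≢0 = trans (cong (_/ 2) (ℤₚ.+-injective (begin
      + (q ∸ 1)                     ≡⟨ pos-∸1 q q≢0 ⟩
      + q ℤ.- 1ℤ                    ≡⟨ 2*squareCount ⟨
      + 2 ℤ.* squareCount           ≡⟨ cong (+ 2 ℤ.*_) length-Hlist ⟨
      + 2 ℤ.* + length Hlist        ≡⟨ ℤₚ.*-comm (+ 2) (+ length Hlist) ⟩
      + length Hlist ℤ.* + 2        ≡⟨ ℤₚ.pos-* (length Hlist) 2 ⟨
      + (length Hlist ℕ.* 2)        ∎))) (m*n/n≡m (length Hlist) 2)

    α-e : ∀ k → α (e k) ≡ sign k ℤ.* (+ q ℤ.* + N-H K k ℤ.- + (length Hlist C k))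
    α-e k = trans (cong₂ (λ a b → + q ℤ.* a ℤ.- b) (signed-N-H k) (∑-signed Hlist k))
      (solve 4 (λ n s a b → n :* (s :* a) :- s :* b := s :* (n :* a :- b)) refl (+ q) (sign k) (+ N-H K k) (+ (length Hlist C k)))
      where open +-*-Solver

    -- Times q - 1, the two sums are k! (α eₖ + β eₖ √D) and its conjugate. Adding them removes the
    -- root part and doubles the rational one.
    formula : q ≢ 0 → ∀ k → (ℕ→ℚ (N-H K k) , 0ℚ) ≡ RHS K p D k
    formula q≢0 k = sym (cong₂ _,_ real root)
      where
      M : ℕ
      M = 2 ℕ.* q ℕ.* (k !)
      binomial : ℕ
      binomial = ((q ∸ 1) / 2) C k
      M≢0 : M ≢ 0
      M≢0 = *-≢0 (*-≢0 {2} (λ ()) q≢0) (!≢0 k)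
      A A′ : Q2
      A  = A1 K p D k u₀ v₀ w₀
      A′ = A1 K p D k v₀ u₀ w₀
      g m Q P : ℚ
      g = ι (sign k)
      m = ι (+ q ℤ.- 1ℤ)
      Q = ι (+ q)
      P = ι (+ (k !))
      scaled  : sc m A ≡ sc P (Plus.ψ k)
      scaled  = scaled-A1 u₀ v₀ w₀ k (Plus.ψ k) (Plus.ψ-coefficient k)
      scaled′ : sc m A′ ≡ sc P (Minus.ψ k)
      scaled′ = scaled-A1 v₀ u₀ w₀ k (Minus.ψ k) (Minus.ψ-coefficient k)
      factor : frac (sign k) 1 * frac (+ (q ∸ 1)) M ≡ (g * recip M) * m
      factor = trans (cong₂ _*_ (sym (ι-def (sign k))) (trans (frac-recip (+ (q ∸ 1)) M M≢0) (cong (λ z → ι z * recip M) (pos-∸1 q q≢0))))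
        (solve 3 (λ g m r → g :* (m :* r) := (g :* r) :* m) refl g m (recip M))
        where open ℚSolver
      pull : ∀ x y → (frac (sign k) 1 * frac (+ (q ∸ 1)) M) * (x + y) ≡ (g * recip M) * (m * x + m * y)
      pull x y = trans (cong (_* (x + y)) factor)
        (solve 4 (λ c m x y → (c :* m) :* (x :+ y) := c :* (m :* x :+ m :* y)) refl (g * recip M) m x y)
        where open ℚSolver
      ια : ι (α (e k)) ≡ g * (Q * ι (+ N-H K k) + - ι (+ binomial))
      ια = begin
        ι (α (e k))
          ≡⟨ cong ι (trans (α-e k) (cong (λ l → sign k ℤ.* (+ q ℤ.* + N-H K k ℤ.- + (l C k))) (sym (half-q≡length q≢0)))) ⟩
        ι (sign k ℤ.* (+ q ℤ.* + N-H K k ℤ.- + binomial))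
          ≡⟨ ι-* (sign k) _ ⟩
        g * ι (+ q ℤ.* + N-H K k ℤ.- + binomial)
          ≡⟨ cong (g *_) (trans (ι-+ (+ q ℤ.* + N-H K k) (ℤ.- + binomial)) (cong₂ _+_ (ι-* (+ q) (+ N-H K k)) (ι-neg (+ binomial)))) ⟩
        g * (Q * ι (+ N-H K k) + - ι (+ binomial)) ∎
      2≡1+1 : ι (+ 2) ≡ 1ℚ + 1ℚ
      2≡1+1 = trans (ι-+ 1ℤ 1ℤ) (cong₂ _+_ ι-1 ι-1)
      -- The 2 that arises here is the one in the denominator 2 q k! of the formula.
      doubled : m * proj₁ A + m * proj₁ A′ ≡ P * (ι (+ 2) * (g * (Q * ι (+ N-H K k) + - ι (+ binomial))))
      doubled = begin
        m * proj₁ A + m * proj₁ A′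
          ≡⟨ cong₂ _+_ (cong proj₁ scaled) (cong proj₁ scaled′) ⟩
        P * ι (α (e k)) + P * ι (α (e k))
          ≡⟨ solve 2 (λ p a → p :* a :+ p :* a := p :* ((con 1ℚ :+ con 1ℚ) :* a)) refl P (ι (α (e k))) ⟩
        P * ((1ℚ + 1ℚ) * ι (α (e k)))
          ≡⟨ cong₂ (λ a b → P * (a * b)) (sym 2≡1+1) ια ⟩
        P * (ι (+ 2) * (g * (Q * ι (+ N-H K k) + - ι (+ binomial)))) ∎
        where open ℚSolver
      real : frac (+ binomial) q + (frac (sign k) 1 * frac (+ (q ∸ 1)) M) * (proj₁ A + proj₁ A′) ≡ ℕ→ℚ (N-H K k)
      real = begin
        frac (+ binomial) q + (frac (sign k) 1 * frac (+ (q ∸ 1)) M) * (proj₁ A + proj₁ A′)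
          ≡⟨ cong₂ _+_ (frac-recip (+ binomial) q q≢0) (pull (proj₁ A) (proj₁ A′)) ⟩
        ι (+ binomial) * recip q + (g * recip M) * (m * proj₁ A + m * proj₁ A′)
          ≡⟨ final-real (ι (+ N-H K k)) (ι (+ binomial)) g Q (recip q) (recip M) P (ι (+ 2)) _ (recip-ι q q≢0)
               (trans (cong (recip M *_) (sym (trans (ι-pos-* (2 ℕ.* q) (k !)) (cong (_* P) (ι-pos-* 2 q))))) (recip-ι M M≢0))
               (trans (sym (ι-* (sign k) (sign k))) (trans (cong ι (sign² k)) ι-1)) doubled ⟩
        ι (+ N-H K k)
          ≡⟨ ι-def (+ N-H K k) ⟩
        ℕ→ℚ (N-H K k) ∎
      cancelled : m * proj₂ A + m * proj₂ A′ ≡ 0ℚ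
      cancelled = begin
        m * proj₂ A + m * proj₂ A′
          ≡⟨ cong₂ _+_ (cong proj₂ scaled) (cong proj₂ scaled′) ⟩
        P * ι (1ℤ ℤ.* β (e k)) + P * ι (-1ℤ ℤ.* β (e k))
          ≡⟨ ℚₚ.*-distribˡ-+ P _ _ ⟨
        P * (ι (1ℤ ℤ.* β (e k)) + ι (-1ℤ ℤ.* β (e k)))
          ≡⟨ cong (P *_) (trans (sym (ι-+ (1ℤ ℤ.* β (e k)) (-1ℤ ℤ.* β (e k))))
               (trans (cong ι (solve 1 (λ b → con 1ℤ :* b :+ con -1ℤ :* b := con 0ℤ) refl (β (e k)))) ι-0)) ⟩
        P * 0ℚ
          ≡⟨ ℚₚ.*-zeroʳ P ⟩
        0ℚ ∎
        where open +-*-Solver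
      root : 0ℚ + (frac (sign k) 1 * frac (+ (q ∸ 1)) M) * (proj₂ A + proj₂ A′) ≡ 0ℚ
      root = begin
        0ℚ + (frac (sign k) 1 * frac (+ (q ∸ 1)) M) * (proj₂ A + proj₂ A′)
          ≡⟨ ℚₚ.+-identityˡ _ ⟩
        (frac (sign k) 1 * frac (+ (q ∸ 1)) M) * (proj₂ A + proj₂ A′)
          ≡⟨ pull (proj₂ A) (proj₂ A′) ⟩
        (g * recip M) * (m * proj₂ A + m * proj₂ A′)
          ≡⟨ cong ((g * recip M) *_) cancelled ⟩
        (g * recip M) * 0ℚ
          ≡⟨ ℚₚ.*-zeroʳ (g * recip M) ⟩
        0ℚ ∎

-- The two cases of the theorem

theorem5p2 : (p s : ℕ) → Prime p → p ≢ 2 → 1 ≤ s →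
    (K : FiniteField (p ^ s)) → (k : ℕ) → 1 ≤ k → k ≤ (p ^ s ∸ 1) / 2 →
    ((p % 4 ≡ 1 ⊎ (p % 4 ≡ 3 × s % 2 ≡ 0)) →
    (ℕ→ℚ (N-H K k) , 0ℚ) ≡ RHS K p (ℕ→ℚ (p ^ s)) k)
    × ((p % 4 ≡ 3 × s % 2 ≡ 1) →
    (ℕ→ℚ (N-H K k) , 0ℚ) ≡ RHS K p (-ℚ (ℕ→ℚ (p ^ s))) k)
theorem5p2 p s p-prime p≢2 1≤s K k 1≤k k≤ =
    (λ { (inj₁ p%4≡1)           → split (q%4≡1⇒χ-1 (^-%4-1 p s p%4≡1))
       ; (inj₂ (p%4≡3 , s-even)) → split (q%4≡1⇒χ-1 (proj₁ (^-%4-3 p s p%4≡3) s-even)) })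
  , (λ { (p%4≡3 , s-odd) → nonsplit (q%4≡3⇒χ-1 (proj₂ (^-%4-3 p s p%4≡3) s-odd)) })
  where
  open FiniteField K
  open FieldArithmetic K using (χ; ⊖_)
  open Characteristic K
  open PrimeCharacteristic p p-prime (fromℕF-^ p s fromℕF-q)
  2≢0 : fromℕF 2 ≢ 0F
  2≢0 = fromℕF-2≢0 p≢2
  open MinusOne K 2≢0
  q≢0 : p ^ s ≢ 0
  q≢0 eq = ℕₚ.<⇒≢ (ℕₚ.m^n>0 p ⦃ prime⇒nonZero p-prime ⦄ s) (sym eq)
  open Evaluation K p ∣⇒fromℕF≡0 ∤⇒fromℕF≢0 2≢0
  -- `formula` is stated for D = χ(-1) q, so the value of χ(-1) settles whether D is q or -q.
  split : χ (⊖ 1F) ≡ 1ℤ → (ℕ→ℚ (N-H K k) , 0ℚ) ≡ RHS K p (ℕ→ℚ (p ^ s)) k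
  split χ-1 = trans (formula q≢0 k) (cong (λ d → RHS K p d k)
    (trans (cong (λ c → ι (c ℤ.* ℤ.+ (p ^ s))) χ-1) (trans (cong ι (ℤₚ.*-identityˡ (ℤ.+ (p ^ s)))) (ι-def (ℤ.+ (p ^ s))))))
  nonsplit : χ (⊖ 1F) ≡ -1ℤ → (ℕ→ℚ (N-H K k) , 0ℚ) ≡ RHS K p (-ℚ (ℕ→ℚ (p ^ s))) k
  nonsplit χ-1 = trans (formula q≢0 k) (cong (λ d → RHS K p d k)
    (trans (cong (λ c → ι (c ℤ.* ℤ.+ (p ^ s))) χ-1) (trans (cong ι (ℤₚ.-1*i≡-i (ℤ.+ (p ^ s))))
      (trans (ι-neg (ℤ.+ (p ^ s))) (cong -ℚ_ (ι-def (ℤ.+ (p ^ s))))))))
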